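{- Let $R=\mathbb{Z}[\{a_{ij},b_{ij}\}_{1\le i\le j\le3}]$ and let $u=\sum_{1\le i\le j\le3}\left(a_{ij}x_ix_jy_1+b_{ij}x_ix_jy_2\right)$ be the universal double ternary quadratic form over $\mathrm{Spec}\,R$. Then the quartic algebra $Q_u=H^0R\pi_*(\mathcal{K}_u)$ is isomorphic, as an $R$-algebra, to the quartic $R$-algebra constructed from $u$ by Bhargava's multiplication tables.
   Context: **Geometric construction.** Here $W$ is the free $R$-module on $x_1,x_2,x_3$, $U$ is the free $R$-module on $y_1,y_2$, and $u\in\mathrm{Sym}^2W\otimes U$, with orientation $\wedge^3W\otimes\wedge^2U\cong R$ given by the bases. Let $\pi:\mathbb{P}(W)=\mathrm{Proj}\,\mathrm{Sym}^*W=\mathbb{P}^2_R\to\mathrm{Spec}\,R$. The section $u$ gives a map $U^*\to\mathrm{Sym}^2W$, hence $u_1:\pi^*U^*\otimes\mathcal{O}(-2)\to\mathcal{O}$, and the Koszul complex $$\mathcal{K}_u:\quad\wedge^2\pi^*U^*\otimes\mathcal{O}(-4)\xrightarrow{u_2}\pi^*U^*\otimes\mathcal{O}(-2)\xrightarrow{u_1}\mathcal{O}$$ in degrees $-2,-1,0$, where $u_1(c\otimes h)=h\,u(c)$ and $u_2(c\wedge d\otimes h)=d\otimes h\,u(c)-c\otimes h\,u(d)$, with $u(c)$ denoting $u$ with its $U$-components evaluated at $c\in U^*$. Then $Q_u=H^0R\pi_*(\mathcal{K}_u)$ is an $R$-algebra, with multiplication inherited from the differential graded algebra structure of the Koszul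 complex and $R$-algebra structure induced by the map of complexes $\mathcal{O}\to\mathcal{K}_u$. **Bhargava's multiplication tables.** Set $a_{ji}=a_{ij}$, $b_{ji}=b_{ij}$ and $\lambda^{\ell_1\ell_2}_{\ell_3\ell_4}=a_{\ell_1\ell_2}b_{\ell_3\ell_4}-b_{\ell_1\ell_2}a_{\ell_3\ell_4}$. The algebra is the free $R$-module with basis $1,\alpha_1,\alpha_2,\alpha_3$, unit $1$, and commutative multiplication $\alpha_i\alpha_j=c_{ij}^0+\sum_{k=1}^3c_{ij}^k\alpha_k$, where $c_{ij}^k=c_{ji}^k$. For every permutation $(i,j,k)$ of $(1,2,3)$, with $\pm$ denoting its sign, $$c_{ij}^k=\pm\lambda^{jj}_{ii},\quad c_{ii}^k=\pm\lambda^{ij}_{ii},\quad c_{jk}^k-c_{ij}^i=\pm\lambda^{jj}_{ik},\quad c_{ii}^i-c_{ij}^j-c_{ik}^k=\pm\lambda^{ik}_{ij}.$$ The normalization is $c_{12}^1=c_{12}^2=c_{13}^1=0$. The constant terms are $c_{ij}^0=\sum_{r=1}^3\left(c_{jk}^rc_{ri}^k-c_{ij}^rc_{rk}^k\right)$ for any $k\in\{1,2,3\}$ with $k\ne i$ (here $j$ may equal $i$ or $k$; the value does not depend on $k$). These relations determine all the $c_{ij}^k$ and $c_{ij}^0$. -}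

module Defs where

open import Algebra.Bundles using (CommutativeRing; RawRing; Ring)
open import Algebra.Structures using (IsCommutativeMonoid)
open import Algebra.Morphism.Structures using (module RingMorphisms)
open import Data.Bool.Base using (true; false; if_then_else_)
open import Data.Fin.Base using (Fin; zero; suc; combine)
open import Data.Fin.Patterns
open import Data.Fin.Properties using (all?)
open import Data.Fin.Subset using (Subset; _∉_; _⊆_; _∪_; ⁅_⁆; ⊤; ⊥)
open import Data.Fin.Subset.Properties using (_∈?_; p⊆p∪q; q⊆p∪q; ⊆⊤; ⊥⊆)
open import Data.Integer.Base as ℤ using (ℤ; +_; -[1+_]; _⊖_; 0ℤ; 1ℤ)
import Data.Integer.Properties as ℤ
open import Data.List.Base using (List; []; _∷_; _++_; map; length; allFin)
import Data.List.Properties as List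
open import Data.List.Relation.Unary.All as All using (All; []; _∷_)
open import Data.Maybe.Base using (Maybe; just; nothing)
open import Data.Nat.Base as ℕ using (ℕ; zero; suc)
import Data.Nat.Properties as ℕ
open import Data.Vec.Base as Vec using (Vec; []; _∷_; lookup; zipWith; replicate; _[_]≔_)
import Data.Vec.Properties as Vec
open import Data.Product.Base using (_×_; _,_; proj₁; proj₂; Σ-syntax)
open import Data.Sign.Base using (Sign)
open import Function.Base using (_∘_)
open import Level using (0ℓ)
open import Relation.Binary.Definitions using (DecidableEquality)
open import Relation.Binary.PropositionalEquality as ≡ using (_≡_; _≢_)
open import Relation.Nullary.Decidable using (Dec; yes; no; does; from-yes; _×-dec_; _→-dec_; ¬?)
open import Relation.Nullary.Negation using (¬_; contradiction)
open import Relation.Unary using (Pred; Decidable)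
import Algebra.Properties.Monoid.Sum as Sum
import Algebra.Properties.Ring as RingProperties
import Algebra.Properties.Semiring.Mult as Mult
import Algebra.Solver.Ring as RingSolver
import Algebra.Solver.Ring.AlmostCommutativeRing as ACR
import Relation.Binary.Reasoning.Setoid as SetoidReasoning

-- The stdlib ring solver, with integer coefficients so that it can cancel
-- terms in an arbitrary commutative ring.
module ℤ-Solver (R : CommutativeRing 0ℓ 0ℓ) where
  open CommutativeRing R
  open RingProperties ring
  open Mult semiring using (×-homo-+; ×1-homo-*) renaming (_×_ to _×ᴿ_)
  open SetoidReasoning setoid

  fromℤ : ℤ → Carrier
  fromℤ (+ n)    = n ×ᴿ 1#
  fromℤ -[1+ n ] = - (suc n ×ᴿ 1#)

  fromℤ-⊖ : ∀ m n → fromℤ (m ⊖ n) ≈ m ×ᴿ 1# + - (n ×ᴿ 1#)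
  fromℤ-⊖ m zero = sym (trans (+-congˡ -0#≈0#) (+-identityʳ _))
  fromℤ-⊖ zero (suc n) = sym (+-identityˡ _)
  fromℤ-⊖ (suc m) (suc n) = begin
    fromℤ (suc m ⊖ suc n)                       ≡⟨ ≡.cong fromℤ (ℤ.[1+m]⊖[1+n]≡m⊖n m n) ⟩
    fromℤ (m ⊖ n)                               ≈⟨ fromℤ-⊖ m n ⟩
    m ×ᴿ 1# + - (n ×ᴿ 1#)                       ≈⟨ +-congʳ (+-identityˡ _) ⟨
    (0# + m ×ᴿ 1#) + - (n ×ᴿ 1#)                ≈⟨ +-congʳ (+-congʳ (-‿inverseʳ 1#)) ⟨
    ((1# + - 1#) + m ×ᴿ 1#) + - (n ×ᴿ 1#)       ≈⟨ +-congʳ (+-assoc _ _ _) ⟩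
    (1# + (- 1# + m ×ᴿ 1#)) + - (n ×ᴿ 1#)       ≈⟨ +-congʳ (+-congˡ (+-comm _ _)) ⟩
    (1# + (m ×ᴿ 1# + - 1#)) + - (n ×ᴿ 1#)       ≈⟨ +-congʳ (+-assoc _ _ _) ⟨
    ((1# + m ×ᴿ 1#) + - 1#) + - (n ×ᴿ 1#)       ≈⟨ +-assoc _ _ _ ⟩
    (1# + m ×ᴿ 1#) + (- 1# + - (n ×ᴿ 1#))       ≈⟨ +-congˡ (-‿+-comm 1# _) ⟩
    (1# + m ×ᴿ 1#) + - (1# + n ×ᴿ 1#)           ∎

  fromℤ-neg : ∀ i → fromℤ (ℤ.- i) ≈ - fromℤ i
  fromℤ-neg (+ zero)  = sym -0#≈0#
  fromℤ-neg (+ suc n) = refl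
  fromℤ-neg -[1+ n ]  = sym (-‿involutive _)

  fromℤ-+ : ∀ i j → fromℤ (i ℤ.+ j) ≈ fromℤ i + fromℤ j
  fromℤ-+ (+ m) (+ n) = ×-homo-+ 1# m n
  fromℤ-+ (+ m) -[1+ n ] = fromℤ-⊖ m (suc n)
  fromℤ-+ -[1+ m ] (+ n) = trans (fromℤ-⊖ n (suc m)) (+-comm _ _)
  fromℤ-+ -[1+ m ] -[1+ n ] = begin
    - (suc (suc (m ℕ.+ n)) ×ᴿ 1#)         ≡⟨ ≡.cong (λ k → - (suc k ×ᴿ 1#)) (≡.sym (ℕ.+-suc m n)) ⟩
    - ((suc m ℕ.+ suc n) ×ᴿ 1#)           ≈⟨ -‿cong (×-homo-+ 1# (suc m) (suc n)) ⟩
    - (suc m ×ᴿ 1# + suc n ×ᴿ 1#)         ≈⟨ -‿+-comm _ _ ⟨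
    - (suc m ×ᴿ 1#) + - (suc n ×ᴿ 1#)     ∎

  fromℤ-*⁺ : ∀ m j → fromℤ ((+ m) ℤ.* j) ≈ fromℤ (+ m) * fromℤ j
  fromℤ-*⁺ m (+ n) = trans (reflexive (≡.cong fromℤ (≡.sym (ℤ.pos-* m n)))) (×1-homo-* m n)
  fromℤ-*⁺ m -[1+ n ] = begin
    fromℤ ((+ m) ℤ.* (ℤ.- (+ suc n)))     ≡⟨ ≡.cong fromℤ (≡.sym (ℤ.neg-distribʳ-* (+ m) (+ suc n))) ⟩
    fromℤ (ℤ.- ((+ m) ℤ.* (+ suc n)))     ≈⟨ fromℤ-neg ((+ m) ℤ.* (+ suc n)) ⟩
    - fromℤ ((+ m) ℤ.* (+ suc n))         ≈⟨ -‿cong (fromℤ-*⁺ m (+ suc n)) ⟩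
    - (fromℤ (+ m) * fromℤ (+ suc n))     ≈⟨ -‿distribʳ-* _ _ ⟩
    fromℤ (+ m) * - fromℤ (+ suc n)       ∎

  fromℤ-* : ∀ i j → fromℤ (i ℤ.* j) ≈ fromℤ i * fromℤ j
  fromℤ-* (+ m) j = fromℤ-*⁺ m j
  fromℤ-* -[1+ m ] j = begin
    fromℤ ((ℤ.- (+ suc m)) ℤ.* j)         ≡⟨ ≡.cong fromℤ (≡.sym (ℤ.neg-distribˡ-* (+ suc m) j)) ⟩
    fromℤ (ℤ.- ((+ suc m) ℤ.* j))         ≈⟨ fromℤ-neg ((+ suc m) ℤ.* j) ⟩
    - fromℤ ((+ suc m) ℤ.* j)             ≈⟨ -‿cong (fromℤ-*⁺ (suc m) j) ⟩
    - (fromℤ (+ suc m) * fromℤ j)         ≈⟨ -‿distribˡ-* _ _ ⟩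
    - fromℤ (+ suc m) * fromℤ j           ∎

  fromℤ-≟ : ∀ i j → Maybe (fromℤ i ≈ fromℤ j)
  fromℤ-≟ i j with i ℤ.≟ j
  ... | yes i≡j = just (reflexive (≡.cong fromℤ i≡j))
  ... | no _    = nothing

  almostCommutativeRing : ACR.AlmostCommutativeRing 0ℓ 0ℓ
  almostCommutativeRing = ACR.fromCommutativeRing R

  morphism : ℤ.+-*-rawRing ACR.-Raw-AlmostCommutative⟶ almostCommutativeRing
  morphism = record
    { ⟦_⟧    = fromℤ
    ; +-homo = fromℤ-+
    ; *-homo = fromℤ-*
    ; -‿homo = fromℤ-neg
    ; 0-homo = refl
    ; 1-homo = +-identityʳ 1#
    }

  open RingSolver ℤ.+-*-rawRing almostCommutativeRing morphism fromℤ-≟ public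
    using (Polynomial; var; con; prove; solve; _:=_; _:+_; _:*_; _:-_; :-_)

-- The monoid algebra R[M]: formal sums of terms r·m, two of them being equal
-- when every m ∈ M has the same coefficient in both.
module MonoidAlgebra
  (R : CommutativeRing 0ℓ 0ℓ)
  {M : Set} {_∙_ : M → M → M} {ε : M}
  (isCommutativeMonoid : IsCommutativeMonoid _≡_ _∙_ ε)
  (_≟_ : DecidableEquality M)
  where

  open CommutativeRing R
  open RingProperties ring
  open SetoidReasoning setoid
  open ℤ-Solver R
  private module M = IsCommutativeMonoid isCommutativeMonoid

  FormalSum : Set
  FormalSum = List (Carrier × M)

  coeff : FormalSum → M → Carrier
  coeff []            m = 0#
  coeff ((r , k) ∷ p) m = (if does (k ≟ m) then r else 0#) + coeff p m

  infix 4 _≋_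
  record _≋_ (p q : FormalSum) : Set where
    constructor mk≋
    field at : ∀ m → coeff p m ≈ coeff q m
  open _≋_ public

  term*_ : Carrier × M → FormalSum → FormalSum
  (term* (r , k)) []            = []
  (term* (r , k)) ((s , l) ∷ q) = (r * s , k ∙ l) ∷ (term* (r , k)) q

  infixl 7 _⊛_
  _⊛_ : FormalSum → FormalSum → FormalSum
  []      ⊛ q = []
  (t ∷ p) ⊛ q = (term* t) q ++ p ⊛ q

  ⊝_ : FormalSum → FormalSum
  ⊝ []            = []
  ⊝ ((r , k) ∷ p) = (- r , k) ∷ (⊝ p)

  scalar : Carrier → FormalSum
  scalar r = (r , ε) ∷ []

  -- The R-linear extension of φ : M → R.
  eval : (M → Carrier) → FormalSum → Carrier
  eval φ []            = 0#
  eval φ ((r , k) ∷ p) = r * φ k + eval φ p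

  δ : M → M → Carrier
  δ m k = if does (k ≟ m) then 1# else 0#

  coeff≈eval : ∀ p m → coeff p m ≈ eval (δ m) p
  coeff≈eval [] m = refl
  coeff≈eval ((r , k) ∷ p) m with does (k ≟ m)
  ... | true  = +-cong (sym (*-identityʳ r)) (coeff≈eval p m)
  ... | false = +-cong (sym (zeroʳ r)) (coeff≈eval p m)

  ext : ∀ {p q} → (∀ φ → eval φ p ≈ eval φ q) → p ≋ q
  ext {p} {q} h .at m = trans (coeff≈eval p m) (trans (h (δ m)) (sym (coeff≈eval q m)))

  eval-cong : ∀ {φ ψ} p → (∀ k → φ k ≈ ψ k) → eval φ p ≈ eval ψ p
  eval-cong []            h = refl
  eval-cong ((r , k) ∷ p) h = +-cong (*-congˡ (h k)) (eval-cong p h)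

  eval-++ : ∀ φ p q → eval φ (p ++ q) ≈ eval φ p + eval φ q
  eval-++ φ []            q = sym (+-identityˡ _)
  eval-++ φ ((r , k) ∷ p) q = trans (+-congˡ (eval-++ φ p q)) (sym (+-assoc _ _ _))

  eval-⊝ : ∀ φ p → eval φ (⊝ p) ≈ - eval φ p
  eval-⊝ φ [] = sym -0#≈0#
  eval-⊝ φ ((r , k) ∷ p) =
    trans (+-cong (sym (-‿distribˡ-* r (φ k))) (eval-⊝ φ p)) (-‿+-comm _ _)

  eval-0 : ∀ p → eval (λ _ → 0#) p ≈ 0#
  eval-0 []            = refl
  eval-0 ((r , k) ∷ p) = trans (+-cong (zeroʳ r) (eval-0 p)) (+-identityˡ 0#)

  eval-+φ : ∀ φ ψ p → eval (λ k → φ k + ψ k) p ≈ eval φ p + eval ψ p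
  eval-+φ φ ψ [] = sym (+-identityˡ 0#)
  eval-+φ φ ψ ((r , k) ∷ p) = trans (+-congˡ (eval-+φ φ ψ p))
    (solve 5 (λ r a b x y → r :* (a :+ b) :+ (x :+ y) := (r :* a :+ x) :+ (r :* b :+ y))
      refl r (φ k) (ψ k) (eval φ p) (eval ψ p))

  eval-*φ : ∀ s φ p → eval (λ k → s * φ k) p ≈ s * eval φ p
  eval-*φ s φ [] = sym (zeroʳ s)
  eval-*φ s φ ((r , k) ∷ p) = trans (+-congˡ (eval-*φ s φ p))
    (solve 4 (λ r s a x → r :* (s :* a) :+ s :* x := s :* (r :* a :+ x)) refl r s (φ k) (eval φ p))

  eval-term* : ∀ φ r k q → eval φ ((term* (r , k)) q) ≈ r * eval (λ l → φ (k ∙ l)) q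
  eval-term* φ r k [] = sym (zeroʳ r)
  eval-term* φ r k ((s , l) ∷ q) = trans (+-congˡ (eval-term* φ r k q))
    (solve 4 (λ r s a x → r :* s :* a :+ r :* x := r :* (s :* a :+ x)) refl r s (φ (k ∙ l)) _)

  eval-⊛ : ∀ φ p q → eval φ (p ⊛ q) ≈ eval (λ k → eval (λ l → φ (k ∙ l)) q) p
  eval-⊛ φ [] q = refl
  eval-⊛ φ ((r , k) ∷ p) q =
    trans (eval-++ φ ((term* (r , k)) q) (p ⊛ q)) (+-cong (eval-term* φ r k q) (eval-⊛ φ p q))

  eval-swap : ∀ (F : M → M → Carrier) p q →
              eval (λ k → eval (F k) q) p ≈ eval (λ l → eval (λ k → F k l) p) q
  eval-swap F [] q = sym (eval-0 q)
  eval-swap F ((r , k) ∷ p) q = begin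
    r * eval (F k) q + eval (λ k → eval (F k) q) p
      ≈⟨ +-cong (sym (eval-*φ r (F k) q)) (eval-swap F p q) ⟩
    eval (λ l → r * F k l) q + eval (λ l → eval (λ k → F k l) p) q
      ≈⟨ eval-+φ (λ l → r * F k l) (λ l → eval (λ k → F k l) p) q ⟨
    eval (λ l → r * F k l + eval (λ k → F k l) p) q ∎

  restrict : ∀ {P : Pred M 0ℓ} → Decidable P → FormalSum → FormalSum
  restrict P? [] = []
  restrict P? ((r , k) ∷ p) with does (P? k)
  ... | true  = (r , k) ∷ restrict P? p
  ... | false = restrict P? p

  eval-restrict : ∀ {P : Pred M 0ℓ} (P? : Decidable P) φ p →
                  eval φ (restrict P? p) ≈ eval (λ k → if does (P? k) then φ k else 0#) p
  eval-restrict P? φ [] = refl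
  eval-restrict P? φ ((r , k) ∷ p) with does (P? k)
  ... | true  = +-congˡ (eval-restrict P? φ p)
  ... | false = trans (eval-restrict P? φ p)
                      (sym (trans (+-congʳ (zeroʳ r)) (+-identityˡ _)))

  private
    remove : M → FormalSum → FormalSum
    remove k []            = []
    remove k ((s , l) ∷ p) with does (l ≟ k)
    ... | true  = remove k p
    ... | false = (s , l) ∷ remove k p

    length-remove : ∀ k p → length (remove k p) ℕ.≤ length p
    length-remove k [] = ℕ.z≤n
    length-remove k ((s , l) ∷ p) with does (l ≟ k)
    ... | true  = ℕ.m≤n⇒m≤1+n (length-remove k p)
    ... | false = ℕ.s≤s (length-remove k p)

    eval-remove : ∀ φ k p → eval φ p ≈ coeff p k * φ k + eval φ (remove k p)
    eval-remove φ k [] = sym (trans (+-identityʳ _) (zeroˡ _))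
    eval-remove φ k ((s , l) ∷ p) with l ≟ k
    ... | yes ≡.refl = trans (+-congˡ (eval-remove φ k p))
      (solve 4 (λ s f c e → s :* f :+ (c :* f :+ e) := (s :+ c) :* f :+ e)
        refl s (φ k) (coeff p k) (eval φ (remove k p)))
    ... | no _ = trans (+-congˡ (eval-remove φ k p)) (trans
      (solve 4 (λ sl c f e → sl :+ (c :* f :+ e) := c :* f :+ (sl :+ e))
        refl (s * φ l) (coeff p k) (φ k) (eval φ (remove k p)))
      (+-congʳ (*-congʳ (sym (+-identityˡ _)))))

    coeff-remove-≡ : ∀ k p → coeff (remove k p) k ≈ 0#
    coeff-remove-≡ k [] = refl
    coeff-remove-≡ k ((s , l) ∷ p) with l ≟ k in eq
    ... | yes _ = coeff-remove-≡ k p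
    ... | no _ rewrite eq = trans (+-identityˡ _) (coeff-remove-≡ k p)

    coeff-remove-≢ : ∀ k m p → k ≢ m → coeff (remove k p) m ≈ coeff p m
    coeff-remove-≢ k m [] k≢m = refl
    coeff-remove-≢ k m ((s , l) ∷ p) k≢m with l ≟ k
    ... | no _ = +-congˡ (coeff-remove-≢ k m p k≢m)
    ... | yes ≡.refl with l ≟ m
    ...   | yes l≡m = contradiction l≡m k≢m
    ...   | no _ = trans (coeff-remove-≢ k m p k≢m) (sym (+-identityˡ _))

    null : ∀ n φ p → length p ℕ.≤ n → (∀ m → coeff p m ≈ 0#) → eval φ p ≈ 0#
    null n       φ []                len h = refl
    null (suc n) φ (t@(r , k) ∷ p) (ℕ.s≤s len) h = begin
      eval φ (t ∷ p)
        ≈⟨ eval-remove φ k (t ∷ p) ⟩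
      coeff (t ∷ p) k * φ k + eval φ (remove k (t ∷ p))
        ≈⟨ +-cong (trans (*-congʳ (h k)) (zeroˡ _))
                  (null n φ (remove k (t ∷ p)) shorter (λ m → null-remove m (k ≟ m))) ⟩
      0# + 0#
        ≈⟨ +-identityˡ 0# ⟩
      0# ∎
      where
      shorter : length (remove k (t ∷ p)) ℕ.≤ n
      shorter with k ≟ k
      ... | yes _  = ℕ.≤-trans (length-remove k p) len
      ... | no k≢k = contradiction ≡.refl k≢k
      null-remove : ∀ m → Dec (k ≡ m) → coeff (remove k (t ∷ p)) m ≈ 0#
      null-remove m (yes ≡.refl) = coeff-remove-≡ k (t ∷ p)
      null-remove m (no k≢m)     = trans (coeff-remove-≢ k m (t ∷ p) k≢m) (h m)

  coeff-++ : ∀ p q m → coeff (p ++ q) m ≈ coeff p m + coeff q m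
  coeff-++ p q m = trans (coeff≈eval (p ++ q) m) (trans (eval-++ (δ m) p q)
    (sym (+-cong (coeff≈eval p m) (coeff≈eval q m))))

  coeff-⊝ : ∀ p m → coeff (⊝ p) m ≈ - coeff p m
  coeff-⊝ p m = trans (coeff≈eval (⊝ p) m) (trans (eval-⊝ (δ m) p)
    (-‿cong (sym (coeff≈eval p m))))

  eval-≋ : ∀ {p q} φ → p ≋ q → eval φ p ≈ eval φ q
  eval-≋ {p} {q} φ p≋q = begin
    eval φ p                             ≈⟨ solve 2 (λ a b → a := (a :- b) :+ b) refl (eval φ p) (eval φ q) ⟩
    (eval φ p + - eval φ q) + eval φ q   ≈⟨ +-congʳ (+-congˡ (eval-⊝ φ q)) ⟨
    (eval φ p + eval φ (⊝ q)) + eval φ q ≈⟨ +-congʳ (eval-++ φ p (⊝ q)) ⟨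
    eval φ (p ++ (⊝ q)) + eval φ q       ≈⟨ +-congʳ (null _ φ (p ++ (⊝ q)) ℕ.≤-refl difference) ⟩
    0# + eval φ q                        ≈⟨ +-identityˡ _ ⟩
    eval φ q                             ∎
    where
    difference : ∀ m → coeff (p ++ (⊝ q)) m ≈ 0#
    difference m = begin
      coeff (p ++ (⊝ q)) m        ≈⟨ coeff-++ p (⊝ q) m ⟩
      coeff p m + coeff (⊝ q) m   ≈⟨ +-cong (at p≋q m) (coeff-⊝ q m) ⟩
      coeff q m + - coeff q m     ≈⟨ -‿inverseʳ _ ⟩
      0#                          ∎

  ≋-refl : ∀ {p} → p ≋ p
  ≋-refl .at m = refl

  ≋-sym : ∀ {p q} → p ≋ q → q ≋ p
  ≋-sym p≋q .at m = sym (at p≋q m)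

  ≋-trans : ∀ {p q r} → p ≋ q → q ≋ r → p ≋ r
  ≋-trans p≋q q≋r .at m = trans (at p≋q m) (at q≋r m)

  private
    ++-comm : ∀ p q → p ++ q ≋ q ++ p
    ++-comm p q = ext λ φ → trans (eval-++ φ p q) (trans (+-comm _ _) (sym (eval-++ φ q p)))

    ++-cong : ∀ {p p′ q q′} → p ≋ p′ → q ≋ q′ → p ++ q ≋ p′ ++ q′
    ++-cong {p} {p′} {q} {q′} h k .at m =
      trans (coeff-++ p q m) (trans (+-cong (at h m) (at k m)) (sym (coeff-++ p′ q′ m)))

    ⊝-cong : ∀ {p q} → p ≋ q → ⊝ p ≋ ⊝ q
    ⊝-cong {p} {q} h .at m = trans (coeff-⊝ p m) (trans (-‿cong (at h m)) (sym (coeff-⊝ q m)))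

    ⊝-inverseˡ : ∀ p → (⊝ p) ++ p ≋ []
    ⊝-inverseˡ p .at m = trans (coeff-++ (⊝ p) p m)
      (trans (+-congʳ (coeff-⊝ p m)) (-‿inverseˡ _))

    ⊛-cong : ∀ {p p′ q q′} → p ≋ p′ → q ≋ q′ → p ⊛ q ≋ p′ ⊛ q′
    ⊛-cong {p} {p′} {q} {q′} h k = ext λ φ → begin
      eval φ (p ⊛ q)                                ≈⟨ eval-⊛ φ p q ⟩
      eval (λ a → eval (λ b → φ (a ∙ b)) q) p       ≈⟨ eval-cong p (λ a → eval-≋ _ k) ⟩
      eval (λ a → eval (λ b → φ (a ∙ b)) q′) p      ≈⟨ eval-≋ _ h ⟩
      eval (λ a → eval (λ b → φ (a ∙ b)) q′) p′     ≈⟨ eval-⊛ φ p′ q′ ⟨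
      eval φ (p′ ⊛ q′)                              ∎

    ⊛-comm : ∀ p q → p ⊛ q ≋ q ⊛ p
    ⊛-comm p q = ext λ φ → begin
      eval φ (p ⊛ q)                                ≈⟨ eval-⊛ φ p q ⟩
      eval (λ a → eval (λ b → φ (a ∙ b)) q) p       ≈⟨ eval-swap (λ a b → φ (a ∙ b)) p q ⟩
      eval (λ b → eval (λ a → φ (a ∙ b)) p) q       ≈⟨ eval-cong q (λ b → eval-cong p λ a →
                                                         reflexive (≡.cong φ (M.comm a b))) ⟩
      eval (λ b → eval (λ a → φ (b ∙ a)) p) q       ≈⟨ eval-⊛ φ q p ⟨
      eval φ (q ⊛ p)                                ∎

    ⊛-assoc : ∀ p q r → (p ⊛ q) ⊛ r ≋ p ⊛ (q ⊛ r)
    ⊛-assoc p q r = ext λ φ → begin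
      eval φ ((p ⊛ q) ⊛ r)
        ≈⟨ trans (eval-⊛ φ (p ⊛ q) r) (eval-⊛ _ p q) ⟩
      eval (λ a → eval (λ b → eval (λ c → φ ((a ∙ b) ∙ c)) r) q) p
        ≈⟨ eval-cong p (λ a → eval-cong q λ b → eval-cong r λ c →
             reflexive (≡.cong φ (M.assoc a b c))) ⟩
      eval (λ a → eval (λ b → eval (λ c → φ (a ∙ (b ∙ c))) r) q) p
        ≈⟨ eval-cong p (λ a → eval-⊛ _ q r) ⟨
      eval (λ a → eval (λ b → φ (a ∙ b)) (q ⊛ r)) p
        ≈⟨ eval-⊛ φ p (q ⊛ r) ⟨
      eval φ (p ⊛ (q ⊛ r)) ∎

    ⊛-identityˡ : ∀ p → scalar 1# ⊛ p ≋ p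
    ⊛-identityˡ p = ext λ φ → begin
      eval φ (scalar 1# ⊛ p)                        ≈⟨ eval-⊛ φ (scalar 1#) p ⟩
      1# * eval (λ b → φ (ε ∙ b)) p + 0#            ≈⟨ trans (+-identityʳ _) (*-identityˡ _) ⟩
      eval (λ b → φ (ε ∙ b)) p                      ≈⟨ eval-cong p (λ b → reflexive (≡.cong φ (M.identityˡ b))) ⟩
      eval φ p                                      ∎

    ⊛-distribʳ : ∀ r p q → (p ++ q) ⊛ r ≋ p ⊛ r ++ q ⊛ r
    ⊛-distribʳ r p q = ext λ φ → begin
      eval φ ((p ++ q) ⊛ r)                         ≈⟨ eval-⊛ φ (p ++ q) r ⟩
      eval _ (p ++ q)                               ≈⟨ eval-++ _ p q ⟩
      eval _ p + eval _ q                           ≈⟨ +-cong (eval-⊛ φ p r) (eval-⊛ φ q r) ⟨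
      eval φ (p ⊛ r) + eval φ (q ⊛ r)               ≈⟨ eval-++ φ (p ⊛ r) (q ⊛ r) ⟨
      eval φ (p ⊛ r ++ q ⊛ r)                       ∎

  commutativeRing : CommutativeRing 0ℓ 0ℓ
  commutativeRing = record
    { Carrier = FormalSum
    ; _≈_ = _≋_
    ; _+_ = _++_
    ; _*_ = _⊛_
    ; -_  = ⊝_
    ; 0#  = []
    ; 1#  = scalar 1#
    ; isCommutativeRing = record
      { isRing = record
        { +-isAbelianGroup = record
          { isGroup = record
            { isMonoid = record
              { isSemigroup = record
                { isMagma = record
                  { isEquivalence = record { refl = ≋-refl ; sym = ≋-sym ; trans = ≋-trans }
                  ; ∙-cong = ++-cong
                  }
                ; assoc = λ p q r → ext λ φ →
                    reflexive (≡.cong (eval φ) (List.++-assoc p q r))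
                }
              ; identity = (λ p → ≋-refl) , (λ p → ≋-trans (++-comm p []) ≋-refl)
              }
            ; inverse = ⊝-inverseˡ , (λ p → ≋-trans (++-comm p (⊝ p)) (⊝-inverseˡ p))
            ; ⁻¹-cong = ⊝-cong
            }
          ; comm = ++-comm
          }
        ; *-cong = ⊛-cong
        ; *-assoc = ⊛-assoc
        ; *-identity = ⊛-identityˡ , (λ p → ≋-trans (⊛-comm p (scalar 1#)) (⊛-identityˡ p))
        ; distrib = (λ r p q → ≋-trans (⊛-comm r (p ++ q))
                      (≋-trans (⊛-distribʳ r p q) (++-cong (⊛-comm p r) (⊛-comm q r))))
                    , ⊛-distribʳ
        }
      ; *-comm = ⊛-comm
      }
    }

  -- p lies in the span of the m ∈ M satisfying P.
  Supported : Pred M 0ℓ → FormalSum → Set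
  Supported P p = ∀ m → ¬ P m → coeff p m ≈ 0#

  supported-list : ∀ {P : Pred M 0ℓ} {p} → All (P ∘ proj₂) p → Supported P p
  supported-list [] m ¬Pm = refl
  supported-list {p = (r , k) ∷ p} (Pk ∷ Pp) m ¬Pm with k ≟ m
  ... | yes ≡.refl = contradiction Pk ¬Pm
  ... | no _       = trans (+-identityˡ _) (supported-list Pp m ¬Pm)

  supported-++ : ∀ {P p q} → Supported P p → Supported P q → Supported P (p ++ q)
  supported-++ {p = p} {q} hp hq m ¬Pm =
    trans (coeff-++ p q m) (trans (+-cong (hp m ¬Pm) (hq m ¬Pm)) (+-identityˡ 0#))

  supported-⊝ : ∀ {P p} → Supported P p → Supported P (⊝ p)
  supported-⊝ {p = p} hp m ¬Pm = trans (coeff-⊝ p m) (trans (-‿cong (hp m ¬Pm)) -0#≈0#)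

  eval-supported : ∀ {P : Pred M 0ℓ} (P? : Decidable P) φ p → Supported P p →
                   eval φ p ≈ eval (λ k → if does (P? k) then φ k else 0#) p
  eval-supported {P} P? φ p hp = trans (eval-≋ φ p≋) (eval-restrict P? φ p)
    where
    p≋ : p ≋ restrict P? p
    p≋ .at m with P? m
    ... | yes Pm = trans (coeff≈eval p m) (sym (trans (coeff≈eval (restrict P? p) m)
      (trans (eval-restrict P? (δ m) p) (eval-cong p same))))
      where
      same : ∀ k → (if does (P? k) then δ m k else 0#) ≈ δ m k
      same k with P? k | k ≟ m
      ... | yes _  | _          = refl
      ... | no ¬Pk | yes ≡.refl = contradiction Pm ¬Pk
      ... | no _   | no _       = refl
    ... | no ¬Pm = trans (hp m ¬Pm) (sym (trans (coeff≈eval (restrict P? p) m)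
      (trans (eval-restrict P? (δ m) p) (trans (eval-cong p vanish) (eval-0 p)))))
      where
      vanish : ∀ k → (if does (P? k) then δ m k else 0#) ≈ 0#
      vanish k with P? k | k ≟ m
      ... | yes Pk | yes ≡.refl = contradiction Pk ¬Pm
      ... | yes _  | no _       = refl
      ... | no _   | _          = refl

  supported-⊛ : ∀ {P Q S : Pred M 0ℓ} → Decidable P → Decidable Q →
                (∀ {k l} → P k → Q l → S (k ∙ l)) →
                ∀ {p q} → Supported P p → Supported Q q → Supported S (p ⊛ q)
  supported-⊛ {S = S} P? Q? PQS {p} {q} hp hq m ¬Sm = begin
    coeff (p ⊛ q) m                                    ≈⟨ coeff≈eval (p ⊛ q) m ⟩
    eval (δ m) (p ⊛ q)                                 ≈⟨ eval-⊛ (δ m) p q ⟩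
    eval (λ k → eval (λ l → δ m (k ∙ l)) q) p          ≈⟨ eval-supported P? _ p hp ⟩
    eval (λ k → if does (P? k) then eval (λ l → δ m (k ∙ l)) q else 0#) p
                                                       ≈⟨ eval-cong p inner ⟩
    eval (λ _ → 0#) p                                  ≈⟨ eval-0 p ⟩
    0#                                                 ∎
    where
    inner : ∀ k → (if does (P? k) then eval (λ l → δ m (k ∙ l)) q else 0#) ≈ 0#
    inner k with P? k
    ... | no _   = refl
    ... | yes Pk = trans (eval-supported Q? _ q hq) (trans (eval-cong q vanish) (eval-0 q))
      where
      vanish : ∀ l → (if does (Q? l) then δ m (k ∙ l) else 0#) ≈ 0#
      vanish l with Q? l
      ... | no _   = refl
      ... | yes Ql with (k ∙ l) ≟ m
      ...   | yes ≡.refl = contradiction (PQS Pk Ql) ¬Sm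
      ...   | no _       = refl

module _ {A : Set} {_∙_ : A → A → A} {ε : A} (isCM : IsCommutativeMonoid _≡_ _∙_ ε) where
  private module A = IsCommutativeMonoid isCM

  Vec-isCommutativeMonoid : ∀ n → IsCommutativeMonoid _≡_ (zipWith {n = n} _∙_) (replicate n ε)
  Vec-isCommutativeMonoid n = record
    { isMonoid = record
      { isSemigroup = record
        { isMagma = record { isEquivalence = ≡.isEquivalence ; ∙-cong = ≡.cong₂ (zipWith _∙_) }
        ; assoc = Vec.zipWith-assoc A.assoc
        }
      ; identity = Vec.zipWith-identityˡ A.identityˡ , Vec.zipWith-identityʳ A.identityʳ
      }
    ; comm = Vec.zipWith-comm A.comm
    }

-- ℤ[X₀,…,Xₙ₋₁], with monomials given by their exponent vectors.
module IntegerPolynomials (n : ℕ) where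
  open MonoidAlgebra ℤ.+-*-commutativeRing
    (Vec-isCommutativeMonoid ℕ.+-0-isCommutativeMonoid n) (Vec.≡-dec ℕ._≟_) public

  X : Fin n → FormalSum
  X i = (1ℤ , replicate n 0 [ i ]≔ 1) ∷ []

-- The basis x_i x_j (i ≤ j) of Sym²W; index i j is the position of x_i x_j,
-- for i and j in either order.  Here and below x₁, x₂, x₃ and y₁, y₂ are
-- numbered from 0.
factors : Fin 6 → Fin 3 × Fin 3
factors 0F = 0F , 0F
factors 1F = 0F , 1F
factors 2F = 0F , 2F
factors 3F = 1F , 1F
factors 4F = 1F , 2F
factors 5F = 2F , 2F

index : Fin 3 → Fin 3 → Fin 6
index 0F 0F = 0F
index 0F 1F = 1F
index 0F 2F = 2F
index 1F 0F = 1F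
index 1F 1F = 3F
index 1F 2F = 4F
index 2F 0F = 2F
index 2F 1F = 4F
index 2F 2F = 5F

-- Sym²W ⊗ U: u c k is the coefficient of (the k-th monomial) ⊗ y_c.
DoubleTernaryQuadraticForm : CommutativeRing 0ℓ 0ℓ → Set
DoubleTernaryQuadraticForm R = Fin 2 → Fin 6 → CommutativeRing.Carrier R

-- An R-algebra is recorded by its ring operations and its structure map ι from R;
-- the R-module structure is r • x = ι r * x.
record RawAlgebra (R : CommutativeRing 0ℓ 0ℓ) : Set₁ where
  field
    rawRing : RawRing 0ℓ 0ℓ
  open RawRing rawRing public
  field
    ι : CommutativeRing.Carrier R → Carrier

infix 4 _≅_
_≅_ : ∀ {R} → RawAlgebra R → RawAlgebra R → Set
_≅_ {R} A B =
  Σ[ f ∈ (A.Carrier → B.Carrier) ] IsRingIsomorphism f × (∀ r → f (A.ι r) B.≈ B.ι r)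
  where
  module A = RawAlgebra A
  module B = RawAlgebra B
  open RingMorphisms A.rawRing B.rawRing using (IsRingIsomorphism)

data Edge : Set where
  e₀₁ e₀₂ e₁₂ : Edge

src tgt : Edge → Fin 3
src e₀₁ = 0F
src e₀₂ = 0F
src e₁₂ = 1F
tgt e₀₁ = 1F
tgt e₀₂ = 2F
tgt e₁₂ = 2F

-- The total Čech–Koszul complex T of K_u for the cover of ℙ² by the D₊(xᵢ).
-- Sections over D₊(∏_{i∈I} xᵢ) are Laurent polynomials (see Γ below), so that
-- all restriction maps are inclusions; this module has the formulas for an
-- arbitrary ring L in place of Laurent polynomials.  K⁻¹ has the basis η₀, η₁
-- dual to y₀, y₁, K⁻² has the basis η₀∧η₁, and u c stands for u(η_c).
-- T is Čech ⊗ Koszul: for z in C^p(K^q) and w in C^p′(K^q′),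
--   D z = δ z + (-1)^p d z,   (z w)_{i₀…} = (-1)^{q p′} z_{i₀…i_p} w_{i_p…}.
module ČechKoszul
  (L : CommutativeRing 0ℓ 0ℓ) (u : Fin 2 → CommutativeRing.Carrier L) where

  open CommutativeRing L
  open ℤ-Solver L
  open RingProperties ring

  infix 7 _∧_
  _∧_ : (g h : Fin 2 → Carrier) → Carrier
  g ∧ h = g 0F * h 1F - g 1F * h 0F

  d₁ : (Fin 2 → Carrier) → Carrier
  d₁ h = h 0F * u 0F + h 1F * u 1F

  d₂ : Carrier → Fin 2 → Carrier
  d₂ h 0F = - (h * u 1F)
  d₂ h 1F = h * u 0F

  δ⁰ : (Fin 3 → Carrier) → Edge → Carrier
  δ⁰ f e = f (tgt e) - f (src e)

  δ¹ : (Edge → Carrier) → Carrier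
  δ¹ f = (f e₁₂ - f e₀₂) + f e₀₁

  -- C⁰(K⁻¹) ⊕ C¹(K⁻²)
  record T⁻¹ : Set where
    field
      s : Fin 3 → Fin 2 → Carrier
      t : Edge → Carrier

  -- C⁰(K⁰) ⊕ C¹(K⁻¹) ⊕ C²(K⁻²)
  record T⁰ : Set where
    field
      f₀ : Fin 3 → Carrier
      f₁ : Edge → Fin 2 → Carrier
      f₂ : Carrier

  open T⁻¹ public
  open T⁰ public

  -- The components of D : T⁰ → T¹ in C¹(K⁰) and C²(K⁻¹).
  D₀ : T⁰ → Edge → Carrier
  D₀ z e = δ⁰ (f₀ z) e - d₁ (f₁ z e)

  D₁ : T⁰ → Fin 2 → Carrier
  D₁ z c = δ¹ (λ e → f₁ z e c) + d₂ (f₂ z) c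

  D⁻¹ : T⁻¹ → T⁰
  D⁻¹ h .f₀ i = d₁ (s h i)
  D⁻¹ h .f₁ e c = δ⁰ (λ i → s h i c) e - d₂ (t h e) c
  D⁻¹ h .f₂ = δ¹ (t h)

  infixl 6 _⊞_ _⊞⁻_
  _⊞_ : T⁰ → T⁰ → T⁰
  (z ⊞ w) .f₀ i = f₀ z i + f₀ w i
  (z ⊞ w) .f₁ e c = f₁ z e c + f₁ w e c
  (z ⊞ w) .f₂ = f₂ z + f₂ w

  ⊟_ : T⁰ → T⁰
  (⊟ z) .f₀ i = - f₀ z i
  (⊟ z) .f₁ e c = - f₁ z e c
  (⊟ z) .f₂ = - f₂ z

  infixl 7 _⊠_ _⋉_ _⋊_
  _⊠_ : T⁰ → T⁰ → T⁰
  (z ⊠ w) .f₀ i = f₀ z i * f₀ w i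
  (z ⊠ w) .f₁ e c = f₀ z (src e) * f₁ w e c + f₁ z e c * f₀ w (tgt e)
  (z ⊠ w) .f₂ = (f₀ z 0F * f₂ w - f₁ z e₀₁ ∧ f₁ w e₁₂) + f₂ z * f₀ w 2F

  const⁰ : Carrier → T⁰
  const⁰ r .f₀ i = r
  const⁰ r .f₁ e c = 0#
  const⁰ r .f₂ = 0#

  0⁻¹ : T⁻¹
  0⁻¹ .s i c = 0#
  0⁻¹ .t e = 0#

  _⊞⁻_ : T⁻¹ → T⁻¹ → T⁻¹
  (h ⊞⁻ k) .s i c = s h i c + s k i c
  (h ⊞⁻ k) .t e = t h e + t k e

  ⊟⁻_ : T⁻¹ → T⁻¹
  (⊟⁻ h) .s i c = - s h i c
  (⊟⁻ h) .t e = - t h e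

  _⋉_ : T⁻¹ → T⁰ → T⁻¹
  (h ⋉ w) .s i c = s h i c * f₀ w i
  (h ⋉ w) .t e = t h e * f₀ w (tgt e) - s h (src e) ∧ f₁ w e

  _⋊_ : T⁰ → T⁻¹ → T⁻¹
  (z ⋊ k) .s i c = f₀ z i * s k i c
  (z ⋊ k) .t e = f₀ z (src e) * t k e + f₁ z e ∧ s k (tgt e)

  infix 4 _≈⁰_
  record _≈⁰_ (z w : T⁰) : Set where
    field
      eq₀ : ∀ i → f₀ z i ≈ f₀ w i
      eq₁ : ∀ e c → f₁ z e c ≈ f₁ w e c
      eq₂ : f₂ z ≈ f₂ w
  open _≈⁰_ public

  record Closed (z : T⁰) : Set where
    field
      closed₀ : ∀ e → D₀ z e ≈ 0#
      closed₁ : ∀ c → D₁ z c ≈ 0#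
  open Closed public

  ≈⁰-refl : ∀ {z} → z ≈⁰ z
  ≈⁰-refl = record { eq₀ = λ i → refl ; eq₁ = λ e c → refl ; eq₂ = refl }

  ≈⁰-sym : ∀ {z w} → z ≈⁰ w → w ≈⁰ z
  ≈⁰-sym h = record
    { eq₀ = λ i → sym (eq₀ h i) ; eq₁ = λ e c → sym (eq₁ h e c) ; eq₂ = sym (eq₂ h) }

  ≈⁰-trans : ∀ {x y z} → x ≈⁰ y → y ≈⁰ z → x ≈⁰ z
  ≈⁰-trans h k = record
    { eq₀ = λ i → trans (eq₀ h i) (eq₀ k i)
    ; eq₁ = λ e c → trans (eq₁ h e c) (eq₁ k e c)
    ; eq₂ = trans (eq₂ h) (eq₂ k)
    }

  ⊞-cong : ∀ {z z′ w w′} → z ≈⁰ z′ → w ≈⁰ w′ → z ⊞ w ≈⁰ z′ ⊞ w′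
  ⊞-cong h k = record
    { eq₀ = λ i → +-cong (eq₀ h i) (eq₀ k i)
    ; eq₁ = λ e c → +-cong (eq₁ h e c) (eq₁ k e c)
    ; eq₂ = +-cong (eq₂ h) (eq₂ k)
    }

  ⊟-cong : ∀ {z w} → z ≈⁰ w → ⊟ z ≈⁰ ⊟ w
  ⊟-cong h = record
    { eq₀ = λ i → -‿cong (eq₀ h i)
    ; eq₁ = λ e c → -‿cong (eq₁ h e c)
    ; eq₂ = -‿cong (eq₂ h)
    }

  ∧-cong : ∀ {g g′ h h′ : Fin 2 → Carrier} → (∀ c → g c ≈ g′ c) → (∀ c → h c ≈ h′ c) →
           g ∧ h ≈ g′ ∧ h′
  ∧-cong p q = +-cong (*-cong (p 0F) (q 1F)) (-‿cong (*-cong (p 1F) (q 0F)))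

  ⊠-cong : ∀ {z z′ w w′} → z ≈⁰ z′ → w ≈⁰ w′ → z ⊠ w ≈⁰ z′ ⊠ w′
  ⊠-cong h k = record
    { eq₀ = λ i → *-cong (eq₀ h i) (eq₀ k i)
    ; eq₁ = λ e c → +-cong (*-cong (eq₀ h _) (eq₁ k e c)) (*-cong (eq₁ h e c) (eq₀ k _))
    ; eq₂ = +-cong (+-cong (*-cong (eq₀ h _) (eq₂ k)) (-‿cong (∧-cong (eq₁ h e₀₁) (eq₁ k e₁₂))))
                   (*-cong (eq₂ h) (eq₀ k _))
    }

  ⊞-assoc : ∀ x y z → (x ⊞ y) ⊞ z ≈⁰ x ⊞ (y ⊞ z)
  ⊞-assoc x y z = record
    { eq₀ = λ i → +-assoc _ _ _ ; eq₁ = λ e c → +-assoc _ _ _ ; eq₂ = +-assoc _ _ _ }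

  ⊞-comm : ∀ x y → x ⊞ y ≈⁰ y ⊞ x
  ⊞-comm x y = record
    { eq₀ = λ i → +-comm _ _ ; eq₁ = λ e c → +-comm _ _ ; eq₂ = +-comm _ _ }

  ⊞-identityˡ : ∀ x → const⁰ 0# ⊞ x ≈⁰ x
  ⊞-identityˡ x = record
    { eq₀ = λ i → +-identityˡ _ ; eq₁ = λ e c → +-identityˡ _ ; eq₂ = +-identityˡ _ }

  ⊟-inverseˡ : ∀ x → (⊟ x) ⊞ x ≈⁰ const⁰ 0#
  ⊟-inverseˡ x = record
    { eq₀ = λ i → -‿inverseˡ _ ; eq₁ = λ e c → -‿inverseˡ _ ; eq₂ = -‿inverseˡ _ }

  ⊟-⊞ : ∀ x y → ⊟ (x ⊞ y) ≈⁰ (⊟ x) ⊞ (⊟ y)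
  ⊟-⊞ x y = record
    { eq₀ = λ i → sym (-‿+-comm _ _)
    ; eq₁ = λ e c → sym (-‿+-comm _ _)
    ; eq₂ = sym (-‿+-comm _ _)
    }

  ⊠-assoc : ∀ x y z → (x ⊠ y) ⊠ z ≈⁰ x ⊠ (y ⊠ z)
  ⊠-assoc x y z = record
    { eq₀ = λ i → *-assoc _ _ _
    ; eq₁ = λ e c → solve 7 (λ F f G G′ g H h →
        (F :* G) :* h :+ (F :* g :+ f :* G′) :* H := F :* (G :* h :+ g :* H) :+ f :* (G′ :* H))
        refl (f₀ x (src e)) (f₁ x e c) (f₀ y (src e)) (f₀ y (tgt e)) (f₁ y e c)
        (f₀ z (tgt e)) (f₁ z e c)
    ; eq₂ = solve 16 (λ F f f′ m G₀ G₁ G₂ g g′ k k′ n h h′ l H →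
        ((F :* G₀) :* l :- ((F :* g :+ f :* G₁) :* h′ :- (F :* g′ :+ f′ :* G₁) :* h))
          :+ ((F :* n :- (f :* k′ :- f′ :* k)) :+ m :* G₂) :* H :=
        (F :* ((G₀ :* l :- (g :* h′ :- g′ :* h)) :+ n :* H)
          :- (f :* (G₁ :* h′ :+ k′ :* H) :- f′ :* (G₁ :* h :+ k :* H))) :+ m :* (G₂ :* H))
        refl (f₀ x 0F) (f₁ x e₀₁ 0F) (f₁ x e₀₁ 1F) (f₂ x) (f₀ y 0F) (f₀ y 1F) (f₀ y 2F)
        (f₁ y e₀₁ 0F) (f₁ y e₀₁ 1F) (f₁ y e₁₂ 0F) (f₁ y e₁₂ 1F) (f₂ y)
        (f₁ z e₁₂ 0F) (f₁ z e₁₂ 1F) (f₂ z) (f₀ z 2F)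
    }

  ⊠-identityˡ : ∀ x → const⁰ 1# ⊠ x ≈⁰ x
  ⊠-identityˡ x = record
    { eq₀ = λ i → *-identityˡ _
    ; eq₁ = λ e c → trans
        (solve 3 (λ o a G → o :* a :+ con 0ℤ :* G := o :* a) refl 1# (f₁ x e c) (f₀ x (tgt e)))
        (*-identityˡ _)
    ; eq₂ = trans
        (solve 5 (λ o n a a′ G → (o :* n :- (con 0ℤ :* a′ :- con 0ℤ :* a)) :+ con 0ℤ :* G := o :* n)
          refl 1# (f₂ x) (f₁ x e₁₂ 0F) (f₁ x e₁₂ 1F) (f₀ x 2F))
        (*-identityˡ _)
    }

  ⊠-identityʳ : ∀ x → x ⊠ const⁰ 1# ≈⁰ x
  ⊠-identityʳ x = record
    { eq₀ = λ i → *-identityʳ _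
    ; eq₁ = λ e c → trans
        (solve 3 (λ o a G → G :* con 0ℤ :+ a :* o := a :* o) refl 1# (f₁ x e c) (f₀ x (src e)))
        (*-identityʳ _)
    ; eq₂ = trans
        (solve 5 (λ o n a a′ G → (G :* con 0ℤ :- (a :* con 0ℤ :- a′ :* con 0ℤ)) :+ n :* o := n :* o)
          refl 1# (f₂ x) (f₁ x e₀₁ 0F) (f₁ x e₀₁ 1F) (f₀ x 0F))
        (*-identityʳ _)
    }

  ⊠-distribˡ : ∀ x y z → x ⊠ (y ⊞ z) ≈⁰ x ⊠ y ⊞ x ⊠ z
  ⊠-distribˡ x y z = record
    { eq₀ = λ i → distribˡ _ _ _
    ; eq₁ = λ e c → solve 6 (λ F f a b G H →
        F :* (a :+ b) :+ f :* (G :+ H) := (F :* a :+ f :* G) :+ (F :* b :+ f :* H))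
        refl (f₀ x (src e)) (f₁ x e c) (f₁ y e c) (f₁ z e c) (f₀ y (tgt e)) (f₀ z (tgt e))
    ; eq₂ = solve 12 (λ F f f′ m n g g′ G l h h′ H →
        (F :* (n :+ l) :- (f :* (g′ :+ h′) :- f′ :* (g :+ h))) :+ m :* (G :+ H) :=
        ((F :* n :- (f :* g′ :- f′ :* g)) :+ m :* G) :+ ((F :* l :- (f :* h′ :- f′ :* h)) :+ m :* H))
        refl (f₀ x 0F) (f₁ x e₀₁ 0F) (f₁ x e₀₁ 1F) (f₂ x)
        (f₂ y) (f₁ y e₁₂ 0F) (f₁ y e₁₂ 1F) (f₀ y 2F)
        (f₂ z) (f₁ z e₁₂ 0F) (f₁ z e₁₂ 1F) (f₀ z 2F)
    }

  ⊠-distribʳ : ∀ x y z → (y ⊞ z) ⊠ x ≈⁰ y ⊠ x ⊞ z ⊠ x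
  ⊠-distribʳ x y z = record
    { eq₀ = λ i → distribʳ _ _ _
    ; eq₁ = λ e c → solve 6 (λ F f a b G H →
        (G :+ H) :* f :+ (a :+ b) :* F := (G :* f :+ a :* F) :+ (H :* f :+ b :* F))
        refl (f₀ x (tgt e)) (f₁ x e c) (f₁ y e c) (f₁ z e c) (f₀ y (src e)) (f₀ z (src e))
    ; eq₂ = solve 12 (λ F f f′ m n g g′ G l h h′ H →
        ((G :+ H) :* m :- ((g :+ h) :* f′ :- (g′ :+ h′) :* f)) :+ (n :+ l) :* F :=
        ((G :* m :- (g :* f′ :- g′ :* f)) :+ n :* F) :+ ((H :* m :- (h :* f′ :- h′ :* f)) :+ l :* F))
        refl (f₀ x 2F) (f₁ x e₁₂ 0F) (f₁ x e₁₂ 1F) (f₂ x)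
        (f₂ y) (f₁ y e₀₁ 0F) (f₁ y e₀₁ 1F) (f₀ y 0F)
        (f₂ z) (f₁ z e₀₁ 0F) (f₁ z e₀₁ 1F) (f₀ z 0F)
    }

  private
    drop : ∀ {x y z} r → x ≈ y + r * z → z ≈ 0# → x ≈ y
    drop r h z≈0 = trans h (trans (+-congˡ (trans (*-congˡ z≈0) (zeroʳ r))) (+-identityʳ _))

  D₀-⊞ : ∀ z w e → D₀ (z ⊞ w) e ≈ D₀ z e + D₀ w e
  D₀-⊞ z w e = solve 10 (λ F F′ G G′ f f′ g g′ u v →
    ((F′ :+ G′) :- (F :+ G)) :- ((f :+ g) :* u :+ (f′ :+ g′) :* v) :=
    ((F′ :- F) :- (f :* u :+ f′ :* v)) :+ ((G′ :- G) :- (g :* u :+ g′ :* v)))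
    refl (f₀ z (src e)) (f₀ z (tgt e)) (f₀ w (src e)) (f₀ w (tgt e))
    (f₁ z e 0F) (f₁ z e 1F) (f₁ w e 0F) (f₁ w e 1F) (u 0F) (u 1F)

  d₂-+ : ∀ g h c → d₂ (g + h) c ≈ d₂ g c + d₂ h c
  d₂-+ g h 0F = solve 3 (λ g h v → :- ((g :+ h) :* v) := :- (g :* v) :+ :- (h :* v)) refl g h (u 1F)
  d₂-+ g h 1F = distribʳ _ _ _

  d₂-neg : ∀ g c → d₂ (- g) c ≈ - d₂ g c
  d₂-neg g 0F = -‿cong (sym (-‿distribˡ-* _ _))
  d₂-neg g 1F = sym (-‿distribˡ-* _ _)

  d₂-0 : ∀ c → d₂ 0# c ≈ 0#
  d₂-0 0F = trans (-‿cong (zeroˡ _)) -0#≈0#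
  d₂-0 1F = zeroˡ _

  D₁-⊞ : ∀ z w c → D₁ (z ⊞ w) c ≈ D₁ z c + D₁ w c
  D₁-⊞ z w c = trans (+-congˡ (d₂-+ (f₂ z) (f₂ w) c)) (solve 8 (λ f f′ f″ g g′ g″ m n →
    (((f″ :+ g″) :- (f′ :+ g′)) :+ (f :+ g)) :+ (m :+ n) :=
    (((f″ :- f′) :+ f) :+ m) :+ (((g″ :- g′) :+ g) :+ n))
    refl (f₁ z e₀₁ c) (f₁ z e₀₂ c) (f₁ z e₁₂ c) (f₁ w e₀₁ c) (f₁ w e₀₂ c) (f₁ w e₁₂ c)
    (d₂ (f₂ z) c) (d₂ (f₂ w) c))

  D₀-⊟ : ∀ z e → D₀ (⊟ z) e ≈ - D₀ z e
  D₀-⊟ z e = solve 6 (λ F F′ f f′ u v →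
    (:- F′ :- :- F) :- (:- f :* u :+ :- f′ :* v) := :- ((F′ :- F) :- (f :* u :+ f′ :* v)))
    refl (f₀ z (src e)) (f₀ z (tgt e)) (f₁ z e 0F) (f₁ z e 1F) (u 0F) (u 1F)

  D₁-⊟ : ∀ z c → D₁ (⊟ z) c ≈ - D₁ z c
  D₁-⊟ z c = trans (+-congˡ (d₂-neg (f₂ z) c)) (solve 4 (λ f f′ f″ m →
    ((:- f″ :- :- f′) :+ :- f) :+ :- m := :- (((f″ :- f′) :+ f) :+ m))
    refl (f₁ z e₀₁ c) (f₁ z e₀₂ c) (f₁ z e₁₂ c) (d₂ (f₂ z) c))

  D₀-⊠ : ∀ z w e → D₀ (z ⊠ w) e ≈ D₀ z e * f₀ w (tgt e) + f₀ z (src e) * D₀ w e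
  D₀-⊠ z w e = solve 10 (λ F F′ G G′ p p′ a a′ u v →
    (F′ :* G′ :- F :* G) :- ((F :* a :+ p :* G′) :* u :+ (F :* a′ :+ p′ :* G′) :* v) :=
    ((F′ :- F) :- (p :* u :+ p′ :* v)) :* G′ :+ F :* ((G′ :- G) :- (a :* u :+ a′ :* v)))
    refl (f₀ z (src e)) (f₀ z (tgt e)) (f₀ w (src e)) (f₀ w (tgt e))
    (f₁ z e 0F) (f₁ z e 1F) (f₁ w e 0F) (f₁ w e 1F) (u 0F) (u 1F)

  D₁-⊠ : ∀ z w c → D₁ (z ⊠ w) c ≈
         (D₁ z c * f₀ w 2F + f₀ z 0F * D₁ w c) + (D₀ z e₀₁ * f₁ w e₁₂ c - f₁ z e₀₁ c * D₀ w e₁₂)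
  D₁-⊠ z w 0F = solve 16 (λ F₀ F₁ G₁ G₂ p p′ q r b c a a′ m n u v →
    ((((F₁ :* a :+ r :* G₂) :- (F₀ :* c :+ q :* G₂)) :+ (F₀ :* b :+ p :* G₁)) :+
      :- (((F₀ :* n :- (p :* a′ :- p′ :* a)) :+ m :* G₂) :* v)) :=
    ((((r :- q) :+ p) :+ :- (m :* v)) :* G₂ :+ F₀ :* (((a :- c) :+ b) :+ :- (n :* v)))
      :+ (((F₁ :- F₀) :- (p :* u :+ p′ :* v)) :* a :- p :* ((G₂ :- G₁) :- (a :* u :+ a′ :* v))))
    refl (f₀ z 0F) (f₀ z 1F) (f₀ w 1F) (f₀ w 2F)
    (f₁ z e₀₁ 0F) (f₁ z e₀₁ 1F) (f₁ z e₀₂ 0F) (f₁ z e₁₂ 0F)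
    (f₁ w e₀₁ 0F) (f₁ w e₀₂ 0F) (f₁ w e₁₂ 0F) (f₁ w e₁₂ 1F) (f₂ z) (f₂ w) (u 0F) (u 1F)
  D₁-⊠ z w 1F = solve 16 (λ F₀ F₁ G₁ G₂ p p′ q r b c a a′ m n u v →
    ((((F₁ :* a′ :+ r :* G₂) :- (F₀ :* c :+ q :* G₂)) :+ (F₀ :* b :+ p′ :* G₁)) :+
      (((F₀ :* n :- (p :* a′ :- p′ :* a)) :+ m :* G₂) :* u)) :=
    ((((r :- q) :+ p′) :+ (m :* u)) :* G₂ :+ F₀ :* (((a′ :- c) :+ b) :+ (n :* u)))
      :+ (((F₁ :- F₀) :- (p :* u :+ p′ :* v)) :* a′ :- p′ :* ((G₂ :- G₁) :- (a :* u :+ a′ :* v))))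
    refl (f₀ z 0F) (f₀ z 1F) (f₀ w 1F) (f₀ w 2F)
    (f₁ z e₀₁ 0F) (f₁ z e₀₁ 1F) (f₁ z e₀₂ 1F) (f₁ z e₁₂ 1F)
    (f₁ w e₀₁ 1F) (f₁ w e₀₂ 1F) (f₁ w e₁₂ 0F) (f₁ w e₁₂ 1F) (f₂ z) (f₂ w) (u 0F) (u 1F)

  closed-const : ∀ r → Closed (const⁰ r)
  closed-const r = record
    { closed₀ = λ e → solve 3 (λ r u v →
        (r :- r) :- (con 0ℤ :* u :+ con 0ℤ :* v) := con 0ℤ) refl r (u 0F) (u 1F)
    ; closed₁ = λ c → trans (+-congˡ (d₂-0 c))
        (solve 0 (((con 0ℤ :- con 0ℤ) :+ con 0ℤ) :+ con 0ℤ := con 0ℤ) refl)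
    }

  closed-⊞ : ∀ {z w} → Closed z → Closed w → Closed (z ⊞ w)
  closed-⊞ {z} {w} hz hw = record
    { closed₀ = λ e → trans (D₀-⊞ z w e)
        (trans (+-cong (closed₀ hz e) (closed₀ hw e)) (+-identityˡ 0#))
    ; closed₁ = λ c → trans (D₁-⊞ z w c)
        (trans (+-cong (closed₁ hz c) (closed₁ hw c)) (+-identityˡ 0#))
    }

  closed-⊟ : ∀ {z} → Closed z → Closed (⊟ z)
  closed-⊟ {z} hz = record
    { closed₀ = λ e → trans (D₀-⊟ z e) (trans (-‿cong (closed₀ hz e)) -0#≈0#)
    ; closed₁ = λ c → trans (D₁-⊟ z c) (trans (-‿cong (closed₁ hz c)) -0#≈0#)
    }

  closed-⊠ : ∀ {z w} → Closed z → Closed w → Closed (z ⊠ w)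
  closed-⊠ {z} {w} hz hw = record
    { closed₀ = λ e → trans (D₀-⊠ z w e)
        (trans (+-cong (*-congʳ (closed₀ hz e)) (*-congˡ (closed₀ hw e)))
          (solve 2 (λ F G → con 0ℤ :* G :+ F :* con 0ℤ := con 0ℤ) refl _ _))
    ; closed₁ = λ c → trans (D₁-⊠ z w c)
        (trans (+-cong (+-cong (*-congʳ (closed₁ hz c)) (*-congˡ (closed₁ hw c)))
                       (+-cong (*-congʳ (closed₀ hz e₀₁)) (-‿cong (*-congˡ (closed₀ hw e₁₂)))))
          (solve 4 (λ F G f g → (con 0ℤ :* G :+ F :* con 0ℤ) :+ (con 0ℤ :* g :- f :* con 0ℤ) := con 0ℤ)
            refl _ _ _ _))
    }

  D⁻¹-⊞ : ∀ h k → D⁻¹ (h ⊞⁻ k) ≈⁰ D⁻¹ h ⊞ D⁻¹ k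
  D⁻¹-⊞ h k = record
    { eq₀ = λ i → solve 6 (λ a a′ b b′ u v →
        (a :+ b) :* u :+ (a′ :+ b′) :* v := (a :* u :+ a′ :* v) :+ (b :* u :+ b′ :* v))
        refl (s h i 0F) (s h i 1F) (s k i 0F) (s k i 1F) (u 0F) (u 1F)
    ; eq₁ = λ e c → trans (+-congˡ (-‿cong (d₂-+ (t h e) (t k e) c)))
        (solve 6 (λ a a′ b b′ x y →
          ((a′ :+ b′) :- (a :+ b)) :- (x :+ y) := ((a′ :- a) :- x) :+ ((b′ :- b) :- y))
          refl (s h (src e) c) (s h (tgt e) c) (s k (src e) c) (s k (tgt e) c)
          (d₂ (t h e) c) (d₂ (t k e) c))
    ; eq₂ = solve 6 (λ a a′ a″ b b′ b″ →
        ((a″ :+ b″) :- (a′ :+ b′)) :+ (a :+ b) := ((a″ :- a′) :+ a) :+ ((b″ :- b′) :+ b))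
        refl (t h e₀₁) (t h e₀₂) (t h e₁₂) (t k e₀₁) (t k e₀₂) (t k e₁₂)
    }

  D⁻¹-⊟ : ∀ h → D⁻¹ (⊟⁻ h) ≈⁰ ⊟ D⁻¹ h
  D⁻¹-⊟ h = record
    { eq₀ = λ i → solve 4 (λ a a′ u v →
        :- a :* u :+ :- a′ :* v := :- (a :* u :+ a′ :* v))
        refl (s h i 0F) (s h i 1F) (u 0F) (u 1F)
    ; eq₁ = λ e c → trans (+-congˡ (-‿cong (d₂-neg (t h e) c)))
        (solve 3 (λ a a′ x → (:- a′ :- :- a) :- :- x := :- ((a′ :- a) :- x))
          refl (s h (src e) c) (s h (tgt e) c) (d₂ (t h e) c))
    ; eq₂ = solve 3 (λ a a′ a″ → (:- a″ :- :- a′) :+ :- a := :- ((a″ :- a′) :+ a))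
        refl (t h e₀₁) (t h e₀₂) (t h e₁₂)
    }

  D⁻¹-0 : D⁻¹ 0⁻¹ ≈⁰ const⁰ 0#
  D⁻¹-0 = record
    { eq₀ = λ i → solve 2 (λ u v → con 0ℤ :* u :+ con 0ℤ :* v := con 0ℤ) refl (u 0F) (u 1F)
    ; eq₁ = λ e c → trans (+-congˡ (-‿cong (d₂-0 c)))
        (solve 0 ((con 0ℤ :- con 0ℤ) :- con 0ℤ := con 0ℤ) refl)
    ; eq₂ = solve 0 ((con 0ℤ :- con 0ℤ) :+ con 0ℤ := con 0ℤ) refl
    }

  closed-D⁻¹ : ∀ h → Closed (D⁻¹ h)
  closed-D⁻¹ h = record
    { closed₀ = λ e → solve 7 (λ a a′ b b′ x u v →
        ((b :* u :+ b′ :* v) :- (a :* u :+ a′ :* v))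
          :- (((b :- a) :- :- (x :* v)) :* u :+ ((b′ :- a′) :- x :* u) :* v) := con 0ℤ)
        refl (s h (src e) 0F) (s h (src e) 1F) (s h (tgt e) 0F) (s h (tgt e) 1F) (t h e) (u 0F) (u 1F)
    ; closed₁ = λ where
        0F → solve 7 (λ a b c x y z v →
          ((((c :- b) :- :- (z :* v)) :- ((c :- a) :- :- (y :* v))) :+ ((b :- a) :- :- (x :* v)))
            :+ :- (((z :- y) :+ x) :* v) := con 0ℤ)
          refl (s h 0F 0F) (s h 1F 0F) (s h 2F 0F) (t h e₀₁) (t h e₀₂) (t h e₁₂) (u 1F)
        1F → solve 7 (λ a b c x y z v →
          ((((c :- b) :- z :* v) :- ((c :- a) :- y :* v)) :+ ((b :- a) :- x :* v))
            :+ ((z :- y) :+ x) :* v := con 0ℤ)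
          refl (s h 0F 1F) (s h 1F 1F) (s h 2F 1F) (t h e₀₁) (t h e₀₂) (t h e₁₂) (u 0F)
    }

  D⁻¹-⋉ : ∀ h {w} → Closed w → D⁻¹ h ⊠ w ≈⁰ D⁻¹ (h ⋉ w)
  D⁻¹-⋉ h {w} hw = record
    { eq₀ = λ i → solve 5 (λ a a′ G u v →
        (a :* u :+ a′ :* v) :* G := (a :* G) :* u :+ (a′ :* G) :* v)
        refl (s h i 0F) (s h i 1F) (f₀ w i) (u 0F) (u 1F)
    ; eq₁ = λ e c → drop (- s h (src e) c) (edge e c) (closed₀ hw e)
    ; eq₂ = drop (t h e₀₁) (drop (- s h 0F 1F) (drop (s h 0F 0F) face (closed₁ hw 1F))
        (closed₁ hw 0F)) (closed₀ hw e₁₂)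
    }
    where
    edge : ∀ e c → f₁ (D⁻¹ h ⊠ w) e c ≈ f₁ (D⁻¹ (h ⋉ w)) e c + (- s h (src e) c) * D₀ w e
    edge e 0F = solve 10 (λ p p′ q t G G′ a a′ u v →
      (p :* u :+ p′ :* v) :* a :+ ((q :- p) :- :- (t :* v)) :* G′ :=
      ((q :* G′ :- p :* G) :- :- ((t :* G′ :- (p :* a′ :- p′ :* a)) :* v))
        :+ (:- p) :* ((G′ :- G) :- (a :* u :+ a′ :* v)))
      refl (s h (src e) 0F) (s h (src e) 1F) (s h (tgt e) 0F) (t h e) (f₀ w (src e)) (f₀ w (tgt e))
      (f₁ w e 0F) (f₁ w e 1F) (u 0F) (u 1F)
    edge e 1F = solve 10 (λ p p′ q t G G′ a a′ u v →
      (p :* u :+ p′ :* v) :* a′ :+ ((q :- p′) :- t :* u) :* G′ :=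
      ((q :* G′ :- p′ :* G) :- (t :* G′ :- (p :* a′ :- p′ :* a)) :* u)
        :+ (:- p′) :* ((G′ :- G) :- (a :* u :+ a′ :* v)))
      refl (s h (src e) 0F) (s h (src e) 1F) (s h (tgt e) 1F) (t h e) (f₀ w (src e)) (f₀ w (tgt e))
      (f₁ w e 0F) (f₁ w e 1F) (u 0F) (u 1F)
    face : f₂ (D⁻¹ h ⊠ w) ≈ ((f₂ (D⁻¹ (h ⋉ w)) + t h e₀₁ * D₀ w e₁₂) + (- s h 0F 1F) * D₁ w 0F)
                            + s h 0F 0F * D₁ w 1F
    face = trans
      (solve 13 (λ p p′ q q′ x y z H c c′ n u v →
        ((p :* u :+ p′ :* v) :* n :- (((q :- p) :- :- (x :* v)) :* c′ :- ((q′ :- p′) :- x :* u) :* c))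
          :+ ((z :- y) :+ x) :* H :=
        (z :* H :- (q :* c′ :- q′ :* c)) :+
          ((((p :* u :+ p′ :* v) :* n :+ (p :* c′ :- p′ :* c)) :- x :* (v :* c′ :+ u :* c)) :+ (x :- y) :* H))
        refl (s h 0F 0F) (s h 0F 1F) (s h 1F 0F) (s h 1F 1F) (t h e₀₁) (t h e₀₂) (t h e₁₂)
        (f₀ w 2F) (f₁ w e₁₂ 0F) (f₁ w e₁₂ 1F) (f₂ w) (u 0F) (u 1F))
      (solve 16 (λ Z p p′ x y G H a a′ b b′ c c′ n u v →
        Z :+ ((((p :* u :+ p′ :* v) :* n :+ (p :* c′ :- p′ :* c)) :- x :* (v :* c′ :+ u :* c)) :+ (x :- y) :* H) :=
        ((((Z :- (y :* H :- (p :* b′ :- p′ :* b))) :+ (x :* G :- (p :* a′ :- p′ :* a)))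
            :+ x :* ((H :- G) :- (c :* u :+ c′ :* v)))
          :+ (:- p′) :* (((c :- b) :+ a) :+ :- (n :* v)))
          :+ p :* (((c′ :- b′) :+ a′) :+ n :* u))
        refl (t (h ⋉ w) e₁₂) (s h 0F 0F) (s h 0F 1F) (t h e₀₁) (t h e₀₂)
        (f₀ w 1F) (f₀ w 2F) (f₁ w e₀₁ 0F) (f₁ w e₀₁ 1F) (f₁ w e₀₂ 0F) (f₁ w e₀₂ 1F)
        (f₁ w e₁₂ 0F) (f₁ w e₁₂ 1F) (f₂ w) (u 0F) (u 1F))

  D⁻¹-⋊ : ∀ {z} k → Closed z → z ⊠ D⁻¹ k ≈⁰ D⁻¹ (z ⋊ k)
  D⁻¹-⋊ {z} k hz = record
    { eq₀ = λ i → solve 5 (λ a a′ F u v →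
        F :* (a :* u :+ a′ :* v) := (F :* a) :* u :+ (F :* a′) :* v)
        refl (s k i 0F) (s k i 1F) (f₀ z i) (u 0F) (u 1F)
    ; eq₁ = λ e c → drop (- s k (tgt e) c) (edge e c) (closed₀ hz e)
    ; eq₂ = drop (- t k e₁₂) (drop (- s k 2F 1F) (drop (s k 2F 0F) face (closed₁ hz 1F))
        (closed₁ hz 0F)) (closed₀ hz e₀₁)
    }
    where
    edge : ∀ e c → f₁ (z ⊠ D⁻¹ k) e c ≈ f₁ (D⁻¹ (z ⋊ k)) e c + (- s k (tgt e) c) * D₀ z e
    edge e 0F = solve 10 (λ r q q′ t F F′ a a′ u v →
      F :* ((q :- r) :- :- (t :* v)) :+ a :* (q :* u :+ q′ :* v) :=
      ((F′ :* q :- F :* r) :- :- ((F :* t :+ (a :* q′ :- a′ :* q)) :* v))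
        :+ (:- q) :* ((F′ :- F) :- (a :* u :+ a′ :* v)))
      refl (s k (src e) 0F) (s k (tgt e) 0F) (s k (tgt e) 1F) (t k e) (f₀ z (src e)) (f₀ z (tgt e))
      (f₁ z e 0F) (f₁ z e 1F) (u 0F) (u 1F)
    edge e 1F = solve 10 (λ r q q′ t F F′ a a′ u v →
      F :* ((q′ :- r) :- t :* u) :+ a′ :* (q :* u :+ q′ :* v) :=
      ((F′ :* q′ :- F :* r) :- (F :* t :+ (a :* q′ :- a′ :* q)) :* u)
        :+ (:- q′) :* ((F′ :- F) :- (a :* u :+ a′ :* v)))
      refl (s k (src e) 1F) (s k (tgt e) 0F) (s k (tgt e) 1F) (t k e) (f₀ z (src e)) (f₀ z (tgt e))
      (f₁ z e 0F) (f₁ z e 1F) (u 0F) (u 1F)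
    face : f₂ (z ⊠ D⁻¹ k) ≈ ((f₂ (D⁻¹ (z ⋊ k)) + (- t k e₁₂) * D₀ z e₀₁) + (- s k 2F 1F) * D₁ z 0F)
                            + s k 2F 0F * D₁ z 1F
    face = trans
      (solve 13 (λ p p′ q q′ x y w F a a′ m u v →
        (F :* ((w :- y) :+ x) :- (a :* ((q′ :- p′) :- w :* u) :- a′ :* ((q :- p) :- :- (w :* v))))
          :+ m :* (q :* u :+ q′ :* v) :=
        (F :* x :+ (a :* p′ :- a′ :* p)) :+
          (((F :* (w :- y) :- a :* (q′ :- w :* u)) :+ a′ :* (q :+ w :* v)) :+ m :* (q :* u :+ q′ :* v)))
        refl (s k 1F 0F) (s k 1F 1F) (s k 2F 0F) (s k 2F 1F) (t k e₀₁) (t k e₀₂) (t k e₁₂)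
        (f₀ z 0F) (f₁ z e₀₁ 0F) (f₁ z e₀₁ 1F) (f₂ z) (u 0F) (u 1F))
      (solve 16 (λ X q q′ y w F G a a′ b b′ c c′ m u v →
        X :+ (((F :* (w :- y) :- a :* (q′ :- w :* u)) :+ a′ :* (q :+ w :* v)) :+ m :* (q :* u :+ q′ :* v)) :=
        (((((G :* w :+ (c :* q′ :- c′ :* q)) :- (F :* y :+ (b :* q′ :- b′ :* q))) :+ X)
            :+ (:- w) :* ((G :- F) :- (a :* u :+ a′ :* v)))
          :+ (:- q′) :* (((c :- b) :+ a) :+ :- (m :* v)))
          :+ q :* (((c′ :- b′) :+ a′) :+ m :* u))
        refl (t (z ⋊ k) e₀₁) (s k 2F 0F) (s k 2F 1F) (t k e₀₂) (t k e₁₂)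
        (f₀ z 0F) (f₀ z 1F) (f₁ z e₀₁ 0F) (f₁ z e₀₁ 1F) (f₁ z e₀₂ 0F) (f₁ z e₀₂ 1F)
        (f₁ z e₁₂ 0F) (f₁ z e₁₂ 1F) (f₂ z) (u 0F) (u 1F))

-- Exponent vectors of Laurent monomials in x₀, x₁, x₂.
Exponent : Set
Exponent = Vec ℤ 3

degree : Exponent → ℤ
degree (k₀ ∷ k₁ ∷ k₂ ∷ []) = k₀ ℤ.+ k₁ ℤ.+ k₂

-- The Laurent monomials of degree n whose denominators involve only the xᵢ, i ∈ I.
IsRegular : Subset 3 → ℤ → Exponent → Set
IsRegular I n m = degree m ≡ n × (∀ i → i ∉ I → 0ℤ ℤ.≤ lookup m i)

isRegular? : ∀ I n → Decidable (IsRegular I n)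
isRegular? I n m = (degree m ℤ.≟ n) ×-dec all? (λ i → ¬? (i ∈? I) →-dec (0ℤ ℤ.≤? lookup m i))

regular-+ : ∀ {I n n′ k l} → IsRegular I n k → IsRegular I n′ l →
            IsRegular I (n ℤ.+ n′) (zipWith ℤ._+_ k l)
regular-+ {k = k} {l} (≡.refl , pos) (≡.refl , pos′) =
  degree-+ k l , λ i i∉I → ≡.subst (0ℤ ℤ.≤_) (≡.sym (Vec.lookup-zipWith ℤ._+_ i k l))
    (ℤ.+-mono-≤ (pos i i∉I) (pos′ i i∉I))
  where
  open ℤ-Solver ℤ.+-*-commutativeRing
  degree-+ : ∀ k l → degree (zipWith ℤ._+_ k l) ≡ degree k ℤ.+ degree l
  degree-+ (k₀ ∷ k₁ ∷ k₂ ∷ []) (l₀ ∷ l₁ ∷ l₂ ∷ []) = solve 6 (λ k₀ k₁ k₂ l₀ l₁ l₂ →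
    ((k₀ :+ l₀) :+ (k₁ :+ l₁)) :+ (k₂ :+ l₂) := ((k₀ :+ k₁) :+ k₂) :+ ((l₀ :+ l₁) :+ l₂))
    ≡.refl k₀ k₁ k₂ l₀ l₁ l₂

regular-⊆ : ∀ {I J n m} → I ⊆ J → IsRegular I n m → IsRegular J n m
regular-⊆ I⊆J (deg , pos) = deg , λ i i∉J → pos i (i∉J ∘ I⊆J)

module QuarticAlgebra (R : CommutativeRing 0ℓ 0ℓ) (u : DoubleTernaryQuadraticForm R) where
  private module R = CommutativeRing R

  -- R[x₀^±¹, x₁^±¹, x₂^±¹]
  module Laurent = MonoidAlgebra R
    (Vec-isCommutativeMonoid ℤ.+-0-isCommutativeMonoid 3) (Vec.≡-dec ℤ._≟_)
  open Laurent using (FormalSum; scalar; Supported; supported-list; supported-++; supported-⊝; supported-⊛)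

  x^ : Fin 3 → Exponent
  x^ i = replicate 3 0ℤ [ i ]≔ 1ℤ

  -- u(η_c), a quadratic form in the xᵢ.
  conic : Fin 2 → FormalSum
  conic c = map (λ k → u c k , zipWith ℤ._+_ (x^ (proj₁ (factors k))) (x^ (proj₂ (factors k)))) (allFin 6)

  -- Γ I n p: p is a section of O(n) over D₊(∏_{i∈I} xᵢ), that is, an element of
  -- degree n of R[x₀,x₁,x₂] localised at ∏_{i∈I} xᵢ.
  Γ : Subset 3 → ℤ → FormalSum → Set
  Γ I n = Supported (IsRegular I n)

  Γ-0 : ∀ {I n} → Γ I n []
  Γ-0 m _ = R.refl

  Γ-⊛ : ∀ {I n n′ p q} → Γ I n p → Γ I n′ q → Γ I (n ℤ.+ n′) (p Laurent.⊛ q)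
  Γ-⊛ {I} {n} {n′} {p} {q} =
    supported-⊛ (isRegular? I n) (isRegular? I n′) (λ {k} {l} → regular-+ {I} {k = k} {l}) {p} {q}

  Γ-⊆ : ∀ {I J n p} → I ⊆ J → Γ I n p → Γ J n p
  Γ-⊆ I⊆J hp m ¬reg = hp m (¬reg ∘ regular-⊆ {m = m} I⊆J)

  open ČechKoszul Laurent.commutativeRing conic public

  vertex : Fin 3 → Subset 3
  vertex i = ⁅ i ⁆

  edge : Edge → Subset 3
  edge e = ⁅ src e ⁆ ∪ ⁅ tgt e ⁆

  src⊆ : ∀ e → vertex (src e) ⊆ edge e
  src⊆ e = p⊆p∪q ⁅ tgt e ⁆

  tgt⊆ : ∀ e → vertex (tgt e) ⊆ edge e
  tgt⊆ e = q⊆p∪q ⁅ src e ⁆ ⁅ tgt e ⁆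

  -2ℤ -4ℤ : ℤ
  -2ℤ = -[1+ 1 ]
  -4ℤ = -[1+ 3 ]

  record IsCochain⁻¹ (h : T⁻¹) : Set where
    field
      Γs : ∀ i c → Γ (vertex i) -2ℤ (s h i c)
      Γt : ∀ e → Γ (edge e) -4ℤ (t h e)
  open IsCochain⁻¹ public

  record IsCochain⁰ (z : T⁰) : Set where
    field
      Γf₀ : ∀ i → Γ (vertex i) 0ℤ (f₀ z i)
      Γf₁ : ∀ e c → Γ (edge e) -2ℤ (f₁ z e c)
      Γf₂ : Γ ⊤ -4ℤ (f₂ z)
  open IsCochain⁰ public

  private
    Γ-+ : ∀ {I n p q} → Γ I n p → Γ I n q → Γ I n (p ++ q)
    Γ-+ {p = p} {q} = supported-++ {p = p} {q}

    Γ-⊝ : ∀ {I n p} → Γ I n p → Γ I n (Laurent.⊝ p)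
    Γ-⊝ {p = p} = supported-⊝ {p = p}

    Γ-∧ : ∀ {I g h} → (∀ c → Γ I -2ℤ (g c)) → (∀ c → Γ I -2ℤ (h c)) → Γ I -4ℤ (g ∧ h)
    Γ-∧ {I} {g} {h} hg hh = Γ-+ {p = g 0F Laurent.⊛ h 1F}
      (Γ-⊛ {p = g 0F} {h 1F} (hg 0F) (hh 1F))
      (Γ-⊝ {p = g 1F Laurent.⊛ h 0F} (Γ-⊛ {p = g 1F} {h 0F} (hg 1F) (hh 0F)))

  cochain-const : ∀ r → IsCochain⁰ (const⁰ (scalar r))
  cochain-const r .Γf₀ i = supported-list {p = scalar r} ((≡.refl , λ j _ → nonneg j) ∷ [])
    where
    nonneg : ∀ j → 0ℤ ℤ.≤ lookup (replicate 3 0ℤ) j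
    nonneg 0F = ℤ.≤-refl
    nonneg 1F = ℤ.≤-refl
    nonneg 2F = ℤ.≤-refl
  cochain-const r .Γf₁ e c = Γ-0 {edge e} { -2ℤ }
  cochain-const r .Γf₂ = Γ-0 {⊤} { -4ℤ }

  cochain-0 : IsCochain⁰ (const⁰ [])
  cochain-0 .Γf₀ i = Γ-0 {vertex i} {0ℤ}
  cochain-0 .Γf₁ e c = Γ-0 {edge e} { -2ℤ }
  cochain-0 .Γf₂ = Γ-0 {⊤} { -4ℤ }

  cochain-⊞ : ∀ {z w} → IsCochain⁰ z → IsCochain⁰ w → IsCochain⁰ (z ⊞ w)
  cochain-⊞ {z} {w} hz hw .Γf₀ i = Γ-+ {p = f₀ z i} (Γf₀ hz i) (Γf₀ hw i)
  cochain-⊞ {z} {w} hz hw .Γf₁ e c = Γ-+ {p = f₁ z e c} (Γf₁ hz e c) (Γf₁ hw e c)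
  cochain-⊞ {z} {w} hz hw .Γf₂ = Γ-+ {p = f₂ z} (Γf₂ hz) (Γf₂ hw)

  cochain-⊟ : ∀ {z} → IsCochain⁰ z → IsCochain⁰ (⊟ z)
  cochain-⊟ {z} hz .Γf₀ i = Γ-⊝ {p = f₀ z i} (Γf₀ hz i)
  cochain-⊟ {z} hz .Γf₁ e c = Γ-⊝ {p = f₁ z e c} (Γf₁ hz e c)
  cochain-⊟ {z} hz .Γf₂ = Γ-⊝ {p = f₂ z} (Γf₂ hz)

  cochain-⊠ : ∀ {z w} → IsCochain⁰ z → IsCochain⁰ w → IsCochain⁰ (z ⊠ w)
  cochain-⊠ {z} {w} hz hw .Γf₀ i = Γ-⊛ {p = f₀ z i} {f₀ w i} (Γf₀ hz i) (Γf₀ hw i)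
  cochain-⊠ {z} {w} hz hw .Γf₁ e c = Γ-+ {p = f₀ z (src e) Laurent.⊛ f₁ w e c}
    (Γ-⊛ {p = f₀ z (src e)} {f₁ w e c} (Γ-⊆ {p = f₀ z (src e)} (src⊆ e) (Γf₀ hz (src e))) (Γf₁ hw e c))
    (Γ-⊛ {p = f₁ z e c} {f₀ w (tgt e)} (Γf₁ hz e c) (Γ-⊆ {p = f₀ w (tgt e)} (tgt⊆ e) (Γf₀ hw (tgt e))))
  cochain-⊠ {z} {w} hz hw .Γf₂ =
    Γ-+ {p = (f₀ z 0F Laurent.⊛ f₂ w) ++ (Laurent.⊝ (f₁ z e₀₁ ∧ f₁ w e₁₂))}
      (Γ-+ {p = f₀ z 0F Laurent.⊛ f₂ w}
        (Γ-⊛ {p = f₀ z 0F} {f₂ w} (Γ-⊆ {p = f₀ z 0F} ⊆⊤ (Γf₀ hz 0F)) (Γf₂ hw))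
        (Γ-⊝ {p = f₁ z e₀₁ ∧ f₁ w e₁₂} (Γ-∧ {g = f₁ z e₀₁} {f₁ w e₁₂}
          (λ c → Γ-⊆ {p = f₁ z e₀₁ c} ⊆⊤ (Γf₁ hz e₀₁ c))
          (λ c → Γ-⊆ {p = f₁ w e₁₂ c} ⊆⊤ (Γf₁ hw e₁₂ c)))))
      (Γ-⊛ {p = f₂ z} {f₀ w 2F} (Γf₂ hz) (Γ-⊆ {p = f₀ w 2F} ⊆⊤ (Γf₀ hw 2F)))

  cochain⁻-0 : IsCochain⁻¹ 0⁻¹
  cochain⁻-0 .Γs i c = Γ-0 {vertex i} { -2ℤ }
  cochain⁻-0 .Γt e = Γ-0 {edge e} { -4ℤ }

  cochain⁻-⊞ : ∀ {h k} → IsCochain⁻¹ h → IsCochain⁻¹ k → IsCochain⁻¹ (h ⊞⁻ k)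
  cochain⁻-⊞ {h} {k} hh hk .Γs i c = Γ-+ {p = s h i c} (Γs hh i c) (Γs hk i c)
  cochain⁻-⊞ {h} {k} hh hk .Γt e = Γ-+ {p = t h e} (Γt hh e) (Γt hk e)

  cochain⁻-⊟ : ∀ {h} → IsCochain⁻¹ h → IsCochain⁻¹ (⊟⁻ h)
  cochain⁻-⊟ {h} hh .Γs i c = Γ-⊝ {p = s h i c} (Γs hh i c)
  cochain⁻-⊟ {h} hh .Γt e = Γ-⊝ {p = t h e} (Γt hh e)

  cochain-⋉ : ∀ {h w} → IsCochain⁻¹ h → IsCochain⁰ w → IsCochain⁻¹ (h ⋉ w)
  cochain-⋉ {h} {w} hh hw .Γs i c = Γ-⊛ {p = s h i c} {f₀ w i} (Γs hh i c) (Γf₀ hw i)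
  cochain-⋉ {h} {w} hh hw .Γt e = Γ-+ {p = t h e Laurent.⊛ f₀ w (tgt e)}
    (Γ-⊛ {p = t h e} {f₀ w (tgt e)} (Γt hh e) (Γ-⊆ {p = f₀ w (tgt e)} (tgt⊆ e) (Γf₀ hw (tgt e))))
    (Γ-⊝ {p = s h (src e) ∧ f₁ w e} (Γ-∧ {g = s h (src e)} {f₁ w e}
      (λ c → Γ-⊆ {p = s h (src e) c} (src⊆ e) (Γs hh (src e) c)) (Γf₁ hw e)))

  cochain-⋊ : ∀ {z k} → IsCochain⁰ z → IsCochain⁻¹ k → IsCochain⁻¹ (z ⋊ k)
  cochain-⋊ {z} {k} hz hk .Γs i c = Γ-⊛ {p = f₀ z i} {s k i c} (Γf₀ hz i) (Γs hk i c)
  cochain-⋊ {z} {k} hz hk .Γt e = Γ-+ {p = f₀ z (src e) Laurent.⊛ t k e}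
    (Γ-⊛ {p = f₀ z (src e)} {t k e} (Γ-⊆ {p = f₀ z (src e)} (src⊆ e) (Γf₀ hz (src e))) (Γt hk e))
    (Γ-∧ {g = f₁ z e} {s k (tgt e)} (Γf₁ hz e)
      (λ c → Γ-⊆ {p = s k (tgt e) c} (tgt⊆ e) (Γs hk (tgt e) c)))

  Γ-conic : ∀ c → Γ ⊥ (+ 2) (conic c)
  Γ-conic c = supported-list {p = conic c}
    (from-yes (All.all? (isRegular? ⊥ (+ 2) ∘ proj₂) (conic c)))

  private
    Γ-*conic : ∀ {I n p} c → Γ I n p → Γ I (n ℤ.+ + 2) (p Laurent.⊛ conic c)
    Γ-*conic {I} {n} {p} c hp = Γ-⊛ {n = n} {+ 2} {p} {conic c} hp (Γ-⊆ {p = conic c} ⊥⊆ (Γ-conic c))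

    Γ-d₂ : ∀ {I p} c → Γ I -4ℤ p → Γ I -2ℤ (d₂ p c)
    Γ-d₂ {p = p} 0F hp = Γ-⊝ {p = p Laurent.⊛ conic 1F} (Γ-*conic {p = p} 1F hp)
    Γ-d₂ {p = p} 1F hp = Γ-*conic {p = p} 0F hp

  cochain-D⁻¹ : ∀ {h} → IsCochain⁻¹ h → IsCochain⁰ (D⁻¹ h)
  cochain-D⁻¹ {h} hh .Γf₀ i = Γ-+ {p = s h i 0F Laurent.⊛ conic 0F}
    (Γ-*conic {p = s h i 0F} 0F (Γs hh i 0F)) (Γ-*conic {p = s h i 1F} 1F (Γs hh i 1F))
  cochain-D⁻¹ {h} hh .Γf₁ e c = Γ-+ {p = δ⁰ (λ i → s h i c) e}
    (Γ-+ {p = s h (tgt e) c} (Γ-⊆ {p = s h (tgt e) c} (tgt⊆ e) (Γs hh (tgt e) c))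
      (Γ-⊝ {p = s h (src e) c} (Γ-⊆ {p = s h (src e) c} (src⊆ e) (Γs hh (src e) c))))
    (Γ-⊝ {p = d₂ (t h e) c} (Γ-d₂ {p = t h e} c (Γt hh e)))
  cochain-D⁻¹ {h} hh .Γf₂ = Γ-+ {p = t h e₁₂ ++ (Laurent.⊝ t h e₀₂)}
    (Γ-+ {p = t h e₁₂} (Γ-⊆ {p = t h e₁₂} ⊆⊤ (Γt hh e₁₂))
      (Γ-⊝ {p = t h e₀₂} (Γ-⊆ {p = t h e₀₂} ⊆⊤ (Γt hh e₀₂))))
    (Γ-⊆ {p = t h e₀₁} ⊆⊤ (Γt hh e₀₁))

  record Cocycle : Set where
    no-eta-equality
    field
      cochain   : T⁰
      isCochain : IsCochain⁰ cochain
      closed    : Closed cochain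
  open Cocycle public

  infix 4 _∼_
  record _∼_ (z w : Cocycle) : Set where
    field
      h           : T⁻¹
      isCochain⁻¹ : IsCochain⁻¹ h
      coboundary  : cochain z ≈⁰ cochain w ⊞ D⁻¹ h
  open _∼_ public

  private
    +D0 : ∀ w → w ⊞ D⁻¹ 0⁻¹ ≈⁰ w
    +D0 w = ≈⁰-trans (⊞-cong (≈⁰-refl {w}) D⁻¹-0) (≈⁰-trans (⊞-comm w _) (⊞-identityˡ w))

  ≈⁰⇒∼ : ∀ {z w} → cochain z ≈⁰ cochain w → z ∼ w
  ≈⁰⇒∼ {w = w} z≈w = record
    { h = 0⁻¹ ; isCochain⁻¹ = cochain⁻-0 ; coboundary = ≈⁰-trans z≈w (≈⁰-sym (+D0 (cochain w))) }

  ∼-refl : ∀ {z} → z ∼ z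
  ∼-refl = ≈⁰⇒∼ ≈⁰-refl

  private
    ⊞-swap : ∀ a b c d → (a ⊞ b) ⊞ (c ⊞ d) ≈⁰ (a ⊞ c) ⊞ (b ⊞ d)
    ⊞-swap a b c d = ≈⁰-trans (⊞-assoc a b (c ⊞ d)) (≈⁰-trans
      (⊞-cong (≈⁰-refl {a}) (≈⁰-trans (≈⁰-sym (⊞-assoc b c d)) (≈⁰-trans
        (⊞-cong (⊞-comm b c) (≈⁰-refl {d})) (⊞-assoc c b d))))
      (≈⁰-sym (⊞-assoc a c (b ⊞ d))))

  ∼-sym : ∀ {z w} → z ∼ w → w ∼ z
  ∼-sym {z} {w} e = record
    { h = ⊟⁻ h e
    ; isCochain⁻¹ = cochain⁻-⊟ (isCochain⁻¹ e)
    ; coboundary = ≈⁰-sym (≈⁰-trans (⊞-cong (coboundary e) (D⁻¹-⊟ (h e)))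
        (≈⁰-trans (⊞-assoc (cochain w) Dh (⊟ Dh))
        (≈⁰-trans (⊞-cong (≈⁰-refl {cochain w}) (≈⁰-trans (⊞-comm Dh (⊟ Dh)) (⊟-inverseˡ Dh)))
        (≈⁰-trans (⊞-comm (cochain w) _) (⊞-identityˡ (cochain w))))))
    }
    where Dh = D⁻¹ (h e)

  ∼-trans : ∀ {x y z} → x ∼ y → y ∼ z → x ∼ z
  ∼-trans {x} {y} {z} d e = record
    { h = h e ⊞⁻ h d
    ; isCochain⁻¹ = cochain⁻-⊞ (isCochain⁻¹ e) (isCochain⁻¹ d)
    ; coboundary = ≈⁰-trans (coboundary d) (≈⁰-trans
        (⊞-cong (coboundary e) (≈⁰-refl {D⁻¹ (h d)})) (≈⁰-trans
        (⊞-assoc (cochain z) (D⁻¹ (h e)) (D⁻¹ (h d)))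
        (⊞-cong (≈⁰-refl {cochain z}) (≈⁰-sym (D⁻¹-⊞ (h e) (h d))))))
    }

  infixl 6 _+Q_
  infixl 7 _*Q_
  _+Q_ _*Q_ : Cocycle → Cocycle → Cocycle
  (z +Q w) .cochain   = cochain z ⊞ cochain w
  (z +Q w) .isCochain = cochain-⊞ (isCochain z) (isCochain w)
  (z +Q w) .closed    = closed-⊞ (closed z) (closed w)
  (z *Q w) .cochain   = cochain z ⊠ cochain w
  (z *Q w) .isCochain = cochain-⊠ (isCochain z) (isCochain w)
  (z *Q w) .closed    = closed-⊠ (closed z) (closed w)

  -Q_ : Cocycle → Cocycle
  (-Q z) .cochain   = ⊟ cochain z
  (-Q z) .isCochain = cochain-⊟ (isCochain z)
  (-Q z) .closed    = closed-⊟ (closed z)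

  0Q : Cocycle
  0Q .cochain   = const⁰ []
  0Q .isCochain = cochain-0
  0Q .closed    = closed-const []

  -- The map induced by O → K_u.
  constant : R.Carrier → Cocycle
  constant r .cochain   = const⁰ (scalar r)
  constant r .isCochain = cochain-const r
  constant r .closed    = closed-const (scalar r)

  +Q-cong : ∀ {z z′ w w′} → z ∼ z′ → w ∼ w′ → z +Q w ∼ z′ +Q w′
  +Q-cong {z} {z′} {w} {w′} d e = record
    { h = h d ⊞⁻ h e
    ; isCochain⁻¹ = cochain⁻-⊞ (isCochain⁻¹ d) (isCochain⁻¹ e)
    ; coboundary = ≈⁰-trans (⊞-cong (coboundary d) (coboundary e)) (≈⁰-trans
        (⊞-swap (cochain z′) (D⁻¹ (h d)) (cochain w′) (D⁻¹ (h e)))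
        (⊞-cong (≈⁰-refl {cochain z′ ⊞ cochain w′}) (≈⁰-sym (D⁻¹-⊞ (h d) (h e)))))
    }

  -Q-cong : ∀ {z w} → z ∼ w → -Q z ∼ -Q w
  -Q-cong {z} {w} e = record
    { h = ⊟⁻ h e
    ; isCochain⁻¹ = cochain⁻-⊟ (isCochain⁻¹ e)
    ; coboundary = ≈⁰-trans (⊟-cong (coboundary e)) (≈⁰-trans (⊟-⊞ (cochain w) (D⁻¹ (h e)))
        (⊞-cong (≈⁰-refl {⊟ cochain w}) (≈⁰-sym (D⁻¹-⊟ (h e)))))
    }

  *Q-cong : ∀ {z z′ w w′} → z ∼ z′ → w ∼ w′ → z *Q w ∼ z′ *Q w′
  *Q-cong {z} {z′} {w} {w′} d e = ∼-trans {y = z′ *Q w} left right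
    where
    left : z *Q w ∼ z′ *Q w
    left = record
      { h = h d ⋉ cochain w
      ; isCochain⁻¹ = cochain-⋉ (isCochain⁻¹ d) (isCochain w)
      ; coboundary = ≈⁰-trans (⊠-cong (coboundary d) (≈⁰-refl {cochain w})) (≈⁰-trans
          (⊠-distribʳ (cochain w) (cochain z′) (D⁻¹ (h d)))
          (⊞-cong (≈⁰-refl {cochain z′ ⊠ cochain w}) (D⁻¹-⋉ (h d) (closed w))))
      }
    right : z′ *Q w ∼ z′ *Q w′
    right = record
      { h = cochain z′ ⋊ h e
      ; isCochain⁻¹ = cochain-⋊ (isCochain z′) (isCochain⁻¹ e)
      ; coboundary = ≈⁰-trans (⊠-cong (≈⁰-refl {cochain z′}) (coboundary e)) (≈⁰-trans
          (⊠-distribˡ (cochain z′) (cochain w′) (D⁻¹ (h e)))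
          (⊞-cong (≈⁰-refl {cochain z′ ⊠ cochain w′}) (D⁻¹-⋊ (h e) (closed z′))))
      }

  +Q-assoc : ∀ x y z → (x +Q y) +Q z ∼ x +Q (y +Q z)
  +Q-assoc x y z = ≈⁰⇒∼ (⊞-assoc (cochain x) (cochain y) (cochain z))

  +Q-comm : ∀ x y → x +Q y ∼ y +Q x
  +Q-comm x y = ≈⁰⇒∼ (⊞-comm (cochain x) (cochain y))

  +Q-identityˡ : ∀ x → 0Q +Q x ∼ x
  +Q-identityˡ x = ≈⁰⇒∼ (⊞-identityˡ (cochain x))

  -Q-inverseˡ : ∀ x → (-Q x) +Q x ∼ 0Q
  -Q-inverseˡ x = ≈⁰⇒∼ (⊟-inverseˡ (cochain x))

  *Q-assoc : ∀ x y z → (x *Q y) *Q z ∼ x *Q (y *Q z)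
  *Q-assoc x y z = ≈⁰⇒∼ (⊠-assoc (cochain x) (cochain y) (cochain z))

  *Q-identityˡ : ∀ x → constant R.1# *Q x ∼ x
  *Q-identityˡ x = ≈⁰⇒∼ (⊠-identityˡ (cochain x))

  *Q-distribˡ : ∀ x y z → x *Q (y +Q z) ∼ x *Q y +Q x *Q z
  *Q-distribˡ x y z = ≈⁰⇒∼ (⊠-distribˡ (cochain x) (cochain y) (cochain z))

  +Q-identityʳ : ∀ x → x +Q 0Q ∼ x
  +Q-identityʳ x = ∼-trans (+Q-comm x 0Q) (+Q-identityˡ x)

  -Q-inverseʳ : ∀ x → x +Q (-Q x) ∼ 0Q
  -Q-inverseʳ x = ∼-trans (+Q-comm x (-Q x)) (-Q-inverseˡ x)

  *Q-identityʳ : ∀ x → x *Q constant R.1# ∼ x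
  *Q-identityʳ x = ≈⁰⇒∼ (⊠-identityʳ (cochain x))

  *Q-distribʳ : ∀ x y z → (y +Q z) *Q x ∼ y *Q x +Q z *Q x
  *Q-distribʳ x y z = ≈⁰⇒∼ (⊠-distribʳ (cochain x) (cochain y) (cochain z))

  -- H⁰Rπ_*(K_u), computed as H⁰ of the total Čech–Koszul complex.
  ring : Ring 0ℓ 0ℓ
  ring = record
    { Carrier = Cocycle
    ; _≈_ = _∼_
    ; _+_ = _+Q_
    ; _*_ = _*Q_
    ; -_  = -Q_
    ; 0#  = 0Q
    ; 1#  = constant R.1#
    ; isRing = record
      { +-isAbelianGroup = record
        { isGroup = record
          { isMonoid = record
            { isSemigroup = record
              { isMagma = record
                { isEquivalence = record { refl = ∼-refl ; sym = ∼-sym ; trans = ∼-trans }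
                ; ∙-cong = +Q-cong
                }
              ; assoc = +Q-assoc
              }
            ; identity = +Q-identityˡ , +Q-identityʳ
            }
          ; inverse = -Q-inverseˡ , -Q-inverseʳ
          ; ⁻¹-cong = λ z∼w → -Q-cong z∼w
          }
        ; comm = +Q-comm
        }
      ; *-cong = *Q-cong
      ; *-assoc = *Q-assoc
      ; *-identity = *Q-identityˡ , *Q-identityʳ
      ; distrib = *Q-distribˡ , *Q-distribʳ
      }
    }

  Q : RawAlgebra R
  Q = record { rawRing = Ring.rawRing ring ; ι = constant }

-- IsPermutation i j k σ: (i, j, k) is a permutation of (0, 1, 2) of sign σ.
data IsPermutation : Fin 3 → Fin 3 → Fin 3 → Sign → Set where
  perm₀₁₂ : IsPermutation 0F 1F 2F Sign.+
  perm₁₂₀ : IsPermutation 1F 2F 0F Sign.+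
  perm₂₀₁ : IsPermutation 2F 0F 1F Sign.+
  perm₁₀₂ : IsPermutation 1F 0F 2F Sign.-
  perm₀₂₁ : IsPermutation 0F 2F 1F Sign.-
  perm₂₁₀ : IsPermutation 2F 1F 0F Sign.-

module Bhargava (R : CommutativeRing 0ℓ 0ℓ) (u : DoubleTernaryQuadraticForm R) where
  open CommutativeRing R
  open RingProperties ring
  open Sum +-monoid using (sum)
  open ℤ-Solver R

  a b : Fin 3 → Fin 3 → Carrier
  a i j = u 0F (index i j)
  b i j = u 1F (index i j)

  Λ : (ℓ₁ ℓ₂ ℓ₃ ℓ₄ : Fin 3) → Carrier
  Λ ℓ₁ ℓ₂ ℓ₃ ℓ₄ = a ℓ₁ ℓ₂ * b ℓ₃ ℓ₄ - b ℓ₁ ℓ₂ * a ℓ₃ ℓ₄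

  infix 8 _·_
  _·_ : Sign → Carrier → Carrier
  Sign.+ · x = x
  Sign.- · x = - x

  record MultiplicationTable : Set where
    field
      c  : Fin 3 → Fin 3 → Fin 3 → Carrier
      c⁰ : Fin 3 → Fin 3 → Carrier

      c-comm  : ∀ i j k → c i j k ≈ c j i k
      c-ijk   : ∀ {i j k σ} → IsPermutation i j k σ → c i j k ≈ σ · Λ j j i i
      c-iik   : ∀ {i j k σ} → IsPermutation i j k σ → c i i k ≈ σ · Λ i j i i
      c-jkk   : ∀ {i j k σ} → IsPermutation i j k σ → c j k k - c i j i ≈ σ · Λ j j i k
      c-iii   : ∀ {i j k σ} → IsPermutation i j k σ → (c i i i - c i j j) - c i k k ≈ σ · Λ i k i j
      c₀₁⁰≈0  : c 0F 1F 0F ≈ 0#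
      c₀₁¹≈0  : c 0F 1F 1F ≈ 0#
      c₀₂⁰≈0  : c 0F 2F 0F ≈ 0#
      c⁰-def  : ∀ i j k → k ≢ i →
                c⁰ i j ≈ sum (λ r → c j k r * c r i k - c i j r * c r k k)

  -- The relations determine these values.  That c⁰ i j does not depend on k is
  -- a polynomial identity in the coefficients of u.
  table : MultiplicationTable
  table = record
    { c       = λ i j → coeffs (index i j)
    ; c⁰      = λ i j → constantTerm i j (other i)
    ; c-comm  = λ i j k → reflexive (≡.cong (λ p → coeffs p k) (index-comm i j))
    ; c-ijk   = λ where
        perm₀₁₂ → prove ρ (cˢ 0F 1F 2F) (Λˢ 1F 1F 0F 0F) refl
        perm₁₂₀ → prove ρ (cˢ 1F 2F 0F) (Λˢ 2F 2F 1F 1F) refl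
        perm₂₀₁ → prove ρ (cˢ 2F 0F 1F) (Λˢ 0F 0F 2F 2F) refl
        perm₁₀₂ → prove ρ (cˢ 1F 0F 2F) (:- (Λˢ 0F 0F 1F 1F)) refl
        perm₀₂₁ → prove ρ (cˢ 0F 2F 1F) (:- (Λˢ 2F 2F 0F 0F)) refl
        perm₂₁₀ → prove ρ (cˢ 2F 1F 0F) (:- (Λˢ 1F 1F 2F 2F)) refl
    ; c-iik   = λ where
        perm₀₁₂ → refl
        perm₁₂₀ → refl
        perm₂₀₁ → refl
        perm₁₀₂ → refl
        perm₀₂₁ → refl
        perm₂₁₀ → refl
    ; c-jkk   = λ where
        perm₀₁₂ → prove ρ (cˢ 1F 2F 2F :- cˢ 0F 1F 0F) (Λˢ 1F 1F 0F 2F) refl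
        perm₁₂₀ → prove ρ (cˢ 2F 0F 0F :- cˢ 1F 2F 1F) (Λˢ 2F 2F 1F 0F) refl
        perm₂₀₁ → prove ρ (cˢ 0F 1F 1F :- cˢ 2F 0F 2F) (Λˢ 0F 0F 2F 1F) refl
        perm₁₀₂ → prove ρ (cˢ 0F 2F 2F :- cˢ 1F 0F 1F) (:- (Λˢ 0F 0F 1F 2F)) refl
        perm₀₂₁ → prove ρ (cˢ 2F 1F 1F :- cˢ 0F 2F 0F) (:- (Λˢ 2F 2F 0F 1F)) refl
        perm₂₁₀ → prove ρ (cˢ 1F 0F 0F :- cˢ 2F 1F 2F) (:- (Λˢ 1F 1F 2F 0F)) refl
    ; c-iii   = λ where
        perm₀₁₂ → prove ρ ((cˢ 0F 0F 0F :- cˢ 0F 1F 1F) :- cˢ 0F 2F 2F) (Λˢ 0F 2F 0F 1F) refl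
        perm₁₂₀ → prove ρ ((cˢ 1F 1F 1F :- cˢ 1F 2F 2F) :- cˢ 1F 0F 0F) (Λˢ 1F 0F 1F 2F) refl
        perm₂₀₁ → prove ρ ((cˢ 2F 2F 2F :- cˢ 2F 0F 0F) :- cˢ 2F 1F 1F) (Λˢ 2F 1F 2F 0F) refl
        perm₁₀₂ → prove ρ ((cˢ 1F 1F 1F :- cˢ 1F 0F 0F) :- cˢ 1F 2F 2F) (:- (Λˢ 1F 2F 1F 0F)) refl
        perm₀₂₁ → prove ρ ((cˢ 0F 0F 0F :- cˢ 0F 2F 2F) :- cˢ 0F 1F 1F) (:- (Λˢ 0F 1F 0F 2F)) refl
        perm₂₁₀ → prove ρ ((cˢ 2F 2F 2F :- cˢ 2F 1F 1F) :- cˢ 2F 0F 0F) (:- (Λˢ 2F 0F 2F 1F)) refl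
    ; c₀₁⁰≈0  = refl
    ; c₀₁¹≈0  = refl
    ; c₀₂⁰≈0  = refl
    ; c⁰-def  = c⁰-independent
    }
    where
    coeffs : Fin 6 → Fin 3 → Carrier
    coeffs 0F 0F = - Λ 0F 0F 1F 2F + Λ 0F 2F 0F 1F
    coeffs 0F 1F = - Λ 0F 2F 0F 0F
    coeffs 0F 2F = Λ 0F 1F 0F 0F
    coeffs 1F 0F = 0#
    coeffs 1F 1F = 0#
    coeffs 1F 2F = Λ 1F 1F 0F 0F
    coeffs 2F 0F = 0#
    coeffs 2F 1F = - Λ 2F 2F 0F 0F
    coeffs 2F 2F = - Λ 0F 0F 1F 2F
    coeffs 3F 0F = Λ 1F 2F 1F 1F
    coeffs 3F 1F = Λ 1F 1F 0F 2F + Λ 1F 0F 1F 2F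
    coeffs 3F 2F = - Λ 1F 0F 1F 1F
    coeffs 4F 0F = Λ 2F 2F 1F 1F
    coeffs 4F 1F = - Λ 2F 2F 0F 1F
    coeffs 4F 2F = Λ 1F 1F 0F 2F
    coeffs 5F 0F = - Λ 2F 1F 2F 2F
    coeffs 5F 1F = Λ 2F 0F 2F 2F
    coeffs 5F 2F = - Λ 2F 2F 0F 1F + Λ 2F 1F 2F 0F

    constantTerm : (i j k : Fin 3) → Carrier
    constantTerm i j k = sum (λ r → coeffs (index j k) r * coeffs (index r i) k
                                    - coeffs (index i j) r * coeffs (index r k) k)

    other : Fin 3 → Fin 3
    other 0F = 1F
    other 1F = 2F
    other 2F = 0F

    index-comm : ∀ i j → index i j ≡ index j i
    index-comm 0F 0F = ≡.refl
    index-comm 0F 1F = ≡.refl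
    index-comm 0F 2F = ≡.refl
    index-comm 1F 0F = ≡.refl
    index-comm 1F 1F = ≡.refl
    index-comm 1F 2F = ≡.refl
    index-comm 2F 0F = ≡.refl
    index-comm 2F 1F = ≡.refl
    index-comm 2F 2F = ≡.refl

    ρ : Vec Carrier 12
    ρ = Vec.map (u 0F) (Vec.allFin 6) Vec.++ Vec.map (u 1F) (Vec.allFin 6)

    Λˢ : (ℓ₁ ℓ₂ ℓ₃ ℓ₄ : Fin 3) → Polynomial 12
    Λˢ ℓ₁ ℓ₂ ℓ₃ ℓ₄ = aˢ ℓ₁ ℓ₂ :* bˢ ℓ₃ ℓ₄ :- bˢ ℓ₁ ℓ₂ :* aˢ ℓ₃ ℓ₄
      where
      aˢ bˢ : Fin 3 → Fin 3 → Polynomial 12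
      aˢ i j = var (combine {2} 0F (index i j))
      bˢ i j = var (combine {2} 1F (index i j))

    coeffsˢ : Fin 6 → Fin 3 → Polynomial 12
    coeffsˢ 0F 0F = :- Λˢ 0F 0F 1F 2F :+ Λˢ 0F 2F 0F 1F
    coeffsˢ 0F 1F = :- Λˢ 0F 2F 0F 0F
    coeffsˢ 0F 2F = Λˢ 0F 1F 0F 0F
    coeffsˢ 1F 0F = con 0ℤ
    coeffsˢ 1F 1F = con 0ℤ
    coeffsˢ 1F 2F = Λˢ 1F 1F 0F 0F
    coeffsˢ 2F 0F = con 0ℤ
    coeffsˢ 2F 1F = :- Λˢ 2F 2F 0F 0F
    coeffsˢ 2F 2F = :- Λˢ 0F 0F 1F 2F
    coeffsˢ 3F 0F = Λˢ 1F 2F 1F 1F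
    coeffsˢ 3F 1F = Λˢ 1F 1F 0F 2F :+ Λˢ 1F 0F 1F 2F
    coeffsˢ 3F 2F = :- Λˢ 1F 0F 1F 1F
    coeffsˢ 4F 0F = Λˢ 2F 2F 1F 1F
    coeffsˢ 4F 1F = :- Λˢ 2F 2F 0F 1F
    coeffsˢ 4F 2F = Λˢ 1F 1F 0F 2F
    coeffsˢ 5F 0F = :- Λˢ 2F 1F 2F 2F
    coeffsˢ 5F 1F = Λˢ 2F 0F 2F 2F
    coeffsˢ 5F 2F = :- Λˢ 2F 2F 0F 1F :+ Λˢ 2F 1F 2F 0F

    cˢ : Fin 3 → Fin 3 → Fin 3 → Polynomial 12
    cˢ i j = coeffsˢ (index i j)

    constantTermˢ : (i j k : Fin 3) → Polynomial 12
    constantTermˢ i j k = term 0F :+ (term 1F :+ (term 2F :+ con 0ℤ))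
      where
      term : Fin 3 → Polynomial 12
      term r = cˢ j k r :* cˢ r i k :- cˢ i j r :* cˢ r k k

    c⁰-independent : ∀ i j k → k ≢ i → constantTerm i j (other i) ≈ constantTerm i j k
    c⁰-independent 0F 0F 0F k≢i = contradiction ≡.refl k≢i
    c⁰-independent 0F 0F 1F _ = refl
    c⁰-independent 0F 0F 2F _ =
      prove ρ (constantTermˢ 0F 0F 1F) (constantTermˢ 0F 0F 2F) refl
    c⁰-independent 0F 1F 0F k≢i = contradiction ≡.refl k≢i
    c⁰-independent 0F 1F 1F _ = refl
    c⁰-independent 0F 1F 2F _ =
      prove ρ (constantTermˢ 0F 1F 1F) (constantTermˢ 0F 1F 2F) refl
    c⁰-independent 0F 2F 0F k≢i = contradiction ≡.refl k≢i
    c⁰-independent 0F 2F 1F _ = refl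
    c⁰-independent 0F 2F 2F _ =
      prove ρ (constantTermˢ 0F 2F 1F) (constantTermˢ 0F 2F 2F) refl
    c⁰-independent 1F 0F 0F _ =
      prove ρ (constantTermˢ 1F 0F 2F) (constantTermˢ 1F 0F 0F) refl
    c⁰-independent 1F 0F 1F k≢i = contradiction ≡.refl k≢i
    c⁰-independent 1F 0F 2F _ = refl
    c⁰-independent 1F 1F 0F _ =
      prove ρ (constantTermˢ 1F 1F 2F) (constantTermˢ 1F 1F 0F) refl
    c⁰-independent 1F 1F 1F k≢i = contradiction ≡.refl k≢i
    c⁰-independent 1F 1F 2F _ = refl
    c⁰-independent 1F 2F 0F _ =
      prove ρ (constantTermˢ 1F 2F 2F) (constantTermˢ 1F 2F 0F) refl
    c⁰-independent 1F 2F 1F k≢i = contradiction ≡.refl k≢i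
    c⁰-independent 1F 2F 2F _ = refl
    c⁰-independent 2F 0F 0F _ = refl
    c⁰-independent 2F 0F 1F _ =
      prove ρ (constantTermˢ 2F 0F 0F) (constantTermˢ 2F 0F 1F) refl
    c⁰-independent 2F 0F 2F k≢i = contradiction ≡.refl k≢i
    c⁰-independent 2F 1F 0F _ = refl
    c⁰-independent 2F 1F 1F _ =
      prove ρ (constantTermˢ 2F 1F 0F) (constantTermˢ 2F 1F 1F) refl
    c⁰-independent 2F 1F 2F k≢i = contradiction ≡.refl k≢i
    c⁰-independent 2F 2F 0F _ = refl
    c⁰-independent 2F 2F 1F _ =
      prove ρ (constantTermˢ 2F 2F 0F) (constantTermˢ 2F 2F 1F) refl
    c⁰-independent 2F 2F 2F k≢i = contradiction ≡.refl k≢i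

  -- The free module R⁴ with basis 1, α₀, α₁, α₂.
  algebra : MultiplicationTable → RawAlgebra R
  algebra T = record
    { rawRing = record
      { Carrier = Fin 4 → Carrier
      ; _≈_ = λ x y → ∀ i → x i ≈ y i
      ; _+_ = λ x y i → x i + y i
      ; _*_ = multiply
      ; -_  = λ x i → - x i
      ; 0#  = λ i → 0#
      ; 1#  = scalar 1#
      }
    ; ι = scalar
    }
    where
    open MultiplicationTable T

    scalar : Carrier → Fin 4 → Carrier
    scalar r 0F      = r
    scalar r (suc _) = 0#

    multiply : (x y : Fin 4 → Carrier) → Fin 4 → Carrier
    multiply x y 0F =
      x 0F * y 0F + sum (λ i → sum (λ j → x (suc i) * y (suc j) * c⁰ i j))
    multiply x y (suc k) =
      (x 0F * y (suc k) + x (suc k) * y 0F) + sum (λ i → sum (λ j → x (suc i) * y (suc j) * c i j k))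

-- With k = index i j, the variable aᵢⱼ is X (combine 0 k) and bᵢⱼ is X (combine 1 k).
open IntegerPolynomials 12 using (X) renaming (commutativeRing to ℤ[a,b]) public

universal : DoubleTernaryQuadraticForm ℤ[a,b]
universal c k = X (combine c k)

{-# OPTIONS --safe #-}
module Submission where

open import Defs

open import Algebra.Bundles using (CommutativeRing; RawRing; Ring)
open import Algebra.Morphism.Structures using (module RingMorphisms)
open import Algebra.Structures using (IsCommutativeMonoid)
open import Data.Bool.Base using (true; false; if_then_else_)
open import Data.Fin.Base using (Fin; zero; suc; combine)
open import Data.Fin.Patterns
open import Data.Fin.Properties using (_≟_)
open import Data.Fin.Subset using (⊤; _∉_)
open import Data.Fin.Subset.Properties using (⊥⊆)
open import Data.Integer.Base as ℤ using (ℤ; +_; -[1+_]; 0ℤ; 1ℤ; -1ℤ)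
open import Data.List.Base using ([]; _∷_; _++_)
open import Data.List.Relation.Unary.All using ([]; _∷_)
open import Data.Nat.Base as ℕ using (ℕ; zero; suc)
open import Data.Product.Base using (_×_; _,_; proj₁; proj₂; Σ-syntax)
open import Data.Vec.Base as Vec using (Vec; []; _∷_; lookup; zipWith; replicate; here; there)
open import Function.Base using (_∘_)
open import Level using (0ℓ)
open import Relation.Binary.Definitions using (DecidableEquality)
open import Relation.Binary.PropositionalEquality as ≡ using (_≡_; _≢_)
open import Relation.Nullary.Decidable using (Dec; yes; no; does; from-no; from-yes; _×-dec_; ¬?)
open import Relation.Nullary.Negation using (¬_; contradiction)
open import Relation.Unary using (Pred; Decidable)
import Algebra.Morphism.RingMonomorphism as RingMonomorphism
import Algebra.Properties.AbelianGroup as AbelianGroupProperties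
import Algebra.Properties.Group as GroupProperties
import Algebra.Properties.Ring as RingProperties
import Algebra.Properties.Semiring.Sum as SemiringSum
import Algebra.Solver.Ring as RingSolver
import Data.Integer.Properties as ℤ
import Data.Vec.Properties as Vec

-- Since O and O(-2) have no higher cohomology on ℙ² and Γ(O(-2)) = 0, the
-- hypercohomology Q of K_u is an extension of H²(O(-4)) by H⁰(O) = R.  The
-- quotient is free on the classes of x₀⁻²x₁⁻¹x₂⁻¹, x₀⁻¹x₁⁻²x₂⁻¹, x₀⁻¹x₁⁻¹x₂⁻²,
-- and these lift to cocycles αᵢ by two explicit antidifferentiations.  Their
-- coefficients κ in f₂ are the last three coordinates on Q; an explicit
-- functional ε that kills coboundaries and restricts to the identity of R
-- gives, after correction by the κᵢ, the first.  The c_{ij}^k are then read off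
-- from the products αᵢαⱼ, while the c_{ij}⁰ follow from associativity.

-- The constant term of `f₀` is not a function on Q: adding D h changes it by the constant term of
-- `d₁` applied to the s-part of h. A splitting of R → Q must therefore also read `f₁` and `f₂`, and
-- this is what makes `ε` more than a coefficient. It also gives the injectivity of R → Q. The other
-- obstacle is multiplication. The c_{ij}^k are quadratic in the coefficients of u and depend only
-- on `f₂` of a product. All operations on formal sums branch on exponents, never on coefficients,
-- so the products can be rerun with symbolic coefficients and compared by the ring solver. The
-- c_{ij}⁰ are quartic and would require `ε` of a product, which associativity makes avoidable; not
-- even the values ε(αᵢ) have to be known.

-- Coefficients of restrictions and products in a monoid algebra.

module Coefficients
  (R : CommutativeRing 0ℓ 0ℓ)
  {M : Set} {_∙_ : M → M → M} {ε : M}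
  (isCommutativeMonoid : IsCommutativeMonoid _≡_ _∙_ ε)
  (_≟_ : DecidableEquality M)
  where
  open CommutativeRing R
  open MonoidAlgebra R isCommutativeMonoid _≟_
  private module M = IsCommutativeMonoid isCommutativeMonoid

  coeff-restrict : ∀ {P : Pred M 0ℓ} (P? : Decidable P) p m →
                   coeff (restrict P? p) m ≈ (if does (P? m) then coeff p m else 0#)
  coeff-restrict P? p m = trans (coeff≈eval (restrict P? p) m)
    (trans (eval-restrict P? (δ m) p) (trans (eval-cong p atm) (constant (does (P? m)))))
    where
    atm : ∀ k → (if does (P? k) then δ m k else 0#) ≈ (if does (P? m) then δ m k else 0#)
    atm k with k ≟ m
    ... | yes ≡.refl = refl
    ... | no _ with does (P? k) | does (P? m)
    ...   | true  | true  = refl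
    ...   | true  | false = refl
    ...   | false | true  = refl
    ...   | false | false = refl
    constant : ∀ b → eval (λ k → if b then δ m k else 0#) p ≈ (if b then coeff p m else 0#)
    constant true  = sym (coeff≈eval p m)
    constant false = eval-0 p

  coeff-scalar⊛ : ∀ r p m → coeff (scalar r ⊛ p) m ≈ r * coeff p m
  coeff-scalar⊛ r p m = trans (coeff≈eval (scalar r ⊛ p) m)
    (trans (eval-⊛ (δ m) (scalar r) p) (trans (+-identityʳ _)
      (*-congˡ (trans (eval-cong p λ l → reflexive (≡.cong (δ m) (M.identityˡ l)))
        (sym (coeff≈eval p m))))))

  -- The hypotheses make `_⊘_` a division in `M`, so each term k of `p` meets exactly one monomial
  -- of `q` in the coefficient at m.
  coeff-⊛ : ∀ (_⊘_ : M → M → M) → (∀ k l m → k ∙ l ≡ m → l ≡ m ⊘ k) → (∀ k m → k ∙ (m ⊘ k) ≡ m) →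
            ∀ p q m → coeff (p ⊛ q) m ≈ eval (λ k → coeff q (m ⊘ k)) p
  coeff-⊛ _⊘_ solves ∙-⊘ p q m = trans (coeff≈eval (p ⊛ q) m)
    (trans (eval-⊛ (δ m) p q) (eval-cong p λ k →
      trans (eval-cong q (shift k)) (sym (coeff≈eval q (m ⊘ k)))))
    where
    shift : ∀ k l → δ m (k ∙ l) ≈ δ (m ⊘ k) l
    shift k l with (k ∙ l) ≟ m | l ≟ (m ⊘ k)
    ... | yes _  | yes _      = refl
    ... | no _   | no _       = refl
    ... | yes eq | no neq     = contradiction (solves k l m eq) neq
    ... | no neq | yes ≡.refl = contradiction (∙-⊘ k m) neq

-- Laurent exponents and the monomials that carry H².

open AbelianGroupProperties ℤ.+-0-abelianGroup using (xyx⁻¹≈y)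

_−_ : Exponent → Exponent → Exponent
_−_ = zipWith ℤ._-_

−-unique : ∀ k l m → zipWith ℤ._+_ k l ≡ m → l ≡ m − k
−-unique (k₀ ∷ k₁ ∷ k₂ ∷ []) (l₀ ∷ l₁ ∷ l₂ ∷ []) _ ≡.refl
  rewrite xyx⁻¹≈y k₀ l₀ | xyx⁻¹≈y k₁ l₁ | xyx⁻¹≈y k₂ l₂ = ≡.refl

+-− : ∀ k m → zipWith ℤ._+_ k (m − k) ≡ m
+-− (k₀ ∷ k₁ ∷ k₂ ∷ []) (m₀ ∷ m₁ ∷ m₂ ∷ [])
  rewrite ≡.trans (≡.sym (ℤ.+-assoc k₀ m₀ (ℤ.- k₀))) (xyx⁻¹≈y k₀ m₀)
        | ≡.trans (≡.sym (ℤ.+-assoc k₁ m₁ (ℤ.- k₁))) (xyx⁻¹≈y k₁ m₁)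
        | ≡.trans (≡.sym (ℤ.+-assoc k₂ m₂ (ℤ.- k₂))) (xyx⁻¹≈y k₂ m₂) = ≡.refl

Nonneg : Fin 3 → Pred Exponent 0ℓ
Nonneg i m = 0ℤ ℤ.≤ lookup m i

nonneg? : ∀ i → Decidable (Nonneg i)
nonneg? i m = 0ℤ ℤ.≤? lookup m i

-- These monomials are regular over no double intersection, so those of degree n give the Čech basis
-- of H²(O(n)).
AllNegative : Pred Exponent 0ℓ
AllNegative m = ¬ Nonneg 0F m × ¬ Nonneg 1F m × ¬ Nonneg 2F m

socle : Fin 3 → Exponent
socle 0F = -[1+ 1 ] ∷ -1ℤ ∷ -1ℤ ∷ []
socle 1F = -1ℤ ∷ -[1+ 1 ] ∷ -1ℤ ∷ []
socle 2F = -1ℤ ∷ -1ℤ ∷ -[1+ 1 ] ∷ []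

-- Three negative exponents sum to at most -3. This is H²(O(-2)) = 0.
allNegative-≢-2 : ∀ m → AllNegative m → ¬ degree m ≡ -[1+ 1 ]
allNegative-≢-2 (+ _ ∷ _ ∷ _ ∷ []) (neg , _) _ = neg (ℤ.+≤+ ℕ.z≤n)
allNegative-≢-2 (-[1+ _ ] ∷ + _ ∷ _ ∷ []) (_ , neg , _) _ = neg (ℤ.+≤+ ℕ.z≤n)
allNegative-≢-2 (-[1+ _ ] ∷ -[1+ _ ] ∷ + _ ∷ []) (_ , _ , neg) _ = neg (ℤ.+≤+ ℕ.z≤n)
allNegative-≢-2 (-[1+ _ ] ∷ -[1+ _ ] ∷ -[1+ _ ] ∷ []) _ ()

-- For exponents -1-a, -1-b, -1-c the degree condition becomes a + b + c = 1, which has three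
-- solutions.
allNegative-socle : ∀ m → AllNegative m → degree m ≡ -[1+ 3 ] → Σ[ i ∈ Fin 3 ] m ≡ socle i
allNegative-socle (+ _ ∷ _ ∷ _ ∷ []) (neg , _) _ = contradiction (ℤ.+≤+ ℕ.z≤n) neg
allNegative-socle (-[1+ _ ] ∷ + _ ∷ _ ∷ []) (_ , neg , _) _ = contradiction (ℤ.+≤+ ℕ.z≤n) neg
allNegative-socle (-[1+ _ ] ∷ -[1+ _ ] ∷ + _ ∷ []) (_ , _ , neg) _ = contradiction (ℤ.+≤+ ℕ.z≤n) neg
allNegative-socle (-[1+ 1 ] ∷ -[1+ 0 ] ∷ -[1+ 0 ] ∷ []) _ ≡.refl = 0F , ≡.refl
allNegative-socle (-[1+ 0 ] ∷ -[1+ 1 ] ∷ -[1+ 0 ] ∷ []) _ ≡.refl = 1F , ≡.refl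
allNegative-socle (-[1+ 0 ] ∷ -[1+ 0 ] ∷ -[1+ 1 ] ∷ []) _ ≡.refl = 2F , ≡.refl

nonneg-zero : ∀ m → Nonneg 0F m → Nonneg 1F m → Nonneg 2F m → degree m ≡ 0ℤ → replicate 3 0ℤ ≡ m
nonneg-zero (+ 0 ∷ + 0 ∷ + 0 ∷ []) _ _ _ ≡.refl = ≡.refl

socle-negative : ∀ i j → ¬ Nonneg j (socle i)
socle-negative 0F 0F ()
socle-negative 0F 1F ()
socle-negative 0F 2F ()
socle-negative 1F 0F ()
socle-negative 1F 1F ()
socle-negative 1F 2F ()
socle-negative 2F 0F ()
socle-negative 2F 1F ()
socle-negative 2F 2F ()

-- Čech cohomology of O(n): explicit primitives of 2-cochains and 1-cocycles.

module Splitting (R : CommutativeRing 0ℓ 0ℓ) (u : DoubleTernaryQuadraticForm R) where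
  open CommutativeRing R
  open RingProperties ring using (-0#≈0#)
  open ℤ-Solver R
  open QuarticAlgebra R u hiding (ring; h)
  open Laurent using (FormalSum; coeff; restrict; ⊝_; _≋_; at; coeff-++; coeff-⊝;
    supported-⊝; supported-++)
  open Coefficients R (Vec-isCommutativeMonoid ℤ.+-0-isCommutativeMonoid 3) (Vec.≡-dec ℤ._≟_) public

  coeff-δ⁰ : ∀ f e m → coeff (δ⁰ f e) m ≈ coeff (f (tgt e)) m - coeff (f (src e)) m
  coeff-δ⁰ f e m = trans (coeff-++ (f (tgt e)) _ m) (+-congˡ (coeff-⊝ (f (src e)) m))

  coeff-δ¹ : ∀ f m → coeff (δ¹ f) m ≈ (coeff (f e₁₂) m - coeff (f e₀₂) m) + coeff (f e₀₁) m
  coeff-δ¹ f m = trans (coeff-++ (f e₁₂ ++ (⊝ f e₀₂)) (f e₀₁) m)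
    (+-congʳ (trans (coeff-++ (f e₁₂) _ m) (+-congˡ (coeff-⊝ (f e₀₂) m))))

  Γ-restrict : ∀ {I J n} {P : Pred Exponent 0ℓ} (P? : Decidable P) p →
               (∀ m → P m → IsRegular I n m → IsRegular J n m) →
               Γ I n p → Γ J n (restrict P? p)
  Γ-restrict {J = J} {n} P? p P⇒J hp m ¬reg = trans (coeff-restrict P? p m) vanish
    where
    vanish : (if does (P? m) then coeff p m else 0#) ≈ 0#
    vanish with P? m
    ... | yes Pm = hp m (¬reg ∘ P⇒J m Pm)
    ... | no _   = refl

  Γ-++ : ∀ {I n} p q → Γ I n p → Γ I n q → Γ I n (p ++ q)
  Γ-++ p q = supported-++ {p = p} {q}

  Γ-⊝ : ∀ {I n} p → Γ I n p → Γ I n (⊝ p)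
  Γ-⊝ p = supported-⊝ {p = p}

  -- H²(O(n)): a monomial with a nonnegative exponent is regular on the edge
  -- opposite to it; among several such edges the first is chosen.

  Assigned : Edge → Pred Exponent 0ℓ
  Assigned e₀₁ m = Nonneg 2F m
  Assigned e₀₂ m = Nonneg 1F m × ¬ Nonneg 2F m
  Assigned e₁₂ m = Nonneg 0F m × ¬ Nonneg 1F m × ¬ Nonneg 2F m

  assigned? : ∀ e → Decidable (Assigned e)
  assigned? e₀₁ m = nonneg? 2F m
  assigned? e₀₂ m = nonneg? 1F m ×-dec ¬? (nonneg? 2F m)
  assigned? e₁₂ m = nonneg? 0F m ×-dec ¬? (nonneg? 1F m) ×-dec ¬? (nonneg? 2F m)

  assigned⇒regular : ∀ {n} e m → Assigned e m → IsRegular ⊤ n m → IsRegular (edge e) n m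
  assigned⇒regular e₀₁ m 0≤ (deg , _) = deg , λ where
    0F i∉ → contradiction here i∉
    1F i∉ → contradiction (there here) i∉
    2F _  → 0≤
  assigned⇒regular e₀₂ m (0≤ , _) (deg , _) = deg , λ where
    0F i∉ → contradiction here i∉
    1F _  → 0≤
    2F i∉ → contradiction (there (there here)) i∉
  assigned⇒regular e₁₂ m (0≤ , _) (deg , _) = deg , λ where
    0F _  → 0≤
    1F i∉ → contradiction (there here) i∉
    2F i∉ → contradiction (there (there here)) i∉

  -- The sign on `e₀₂` cancels the one with which that edge enters `δ¹`.
  split : FormalSum → Edge → FormalSum
  split p e₀₁ = restrict (assigned? e₀₁) p
  split p e₀₂ = ⊝ restrict (assigned? e₀₂) p
  split p e₁₂ = restrict (assigned? e₁₂) p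

  Γ-split : ∀ {n} p → Γ ⊤ n p → ∀ e → Γ (edge e) n (split p e)
  Γ-split p hp e₀₁ = Γ-restrict (assigned? e₀₁) p (assigned⇒regular e₀₁) hp
  Γ-split p hp e₀₂ = Γ-⊝ (restrict (assigned? e₀₂) p)
    (Γ-restrict (assigned? e₀₂) p (assigned⇒regular e₀₂) hp)
  Γ-split p hp e₁₂ = Γ-restrict (assigned? e₁₂) p (assigned⇒regular e₁₂) hp

  -- The predicates `Assigned` are mutually exclusive and miss only the all-negative monomials, so
  -- at any other monomial a single edge carries the whole coefficient.
  δ¹-split : ∀ p → (∀ m → AllNegative m → coeff p m ≈ 0#) → δ¹ (split p) ≋ p
  δ¹-split p h .at m = trans (coeff-δ¹ (split p) m) (trans
    (+-cong (+-cong (coeff-restrict (assigned? e₁₂) p m)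
                    (-‿cong (trans (coeff-⊝ (restrict (assigned? e₀₂) p) m)
                                   (-‿cong (coeff-restrict (assigned? e₀₂) p m)))))
            (coeff-restrict (assigned? e₀₁) p m))
    (pieces (nonneg? 0F m) (nonneg? 1F m) (nonneg? 2F m)
      λ ¬0≤ ¬1≤ ¬2≤ → h m (¬0≤ , ¬1≤ , ¬2≤)))
    where
    only₀₁ : ∀ {r} → (0# - - 0#) + r ≈ r
    only₀₁ = solve 1 (λ r → (con 0ℤ :- :- con 0ℤ) :+ r := r) refl _
    only₀₂ : ∀ {r} → (0# - - r) + 0# ≈ r
    only₀₂ = solve 1 (λ r → (con 0ℤ :- :- r) :+ con 0ℤ := r) refl _
    only₁₂ : ∀ {r} → (r - - 0#) + 0# ≈ r
    only₁₂ = solve 1 (λ r → (r :- :- con 0ℤ) :+ con 0ℤ := r) refl _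
    -- With the three decisions abstracted, matching on them makes the compound tests reduce.
    pieces : ∀ {A B C : Set} (a? : Dec A) (b? : Dec B) (c? : Dec C) {r} →
             (¬ A → ¬ B → ¬ C → r ≈ 0#) →
             ((if does (a? ×-dec ¬? b? ×-dec ¬? c?) then r else 0#)
               - - (if does (b? ×-dec ¬? c?) then r else 0#))
             + (if does c? then r else 0#) ≈ r
    pieces (yes _) (yes _) (yes _) h = only₀₁
    pieces (yes _) (no _)  (yes _) h = only₀₁
    pieces (no _)  (yes _) (yes _) h = only₀₁
    pieces (no _)  (no _)  (yes _) h = only₀₁
    pieces (yes _) (yes _) (no _)  h = only₀₂
    pieces (no _)  (yes _) (no _)  h = only₀₂
    pieces (yes _) (no _)  (no _)  h = only₁₂
    pieces (no ¬a) (no ¬b) (no ¬c) h = trans only₀₁ (sym (h ¬a ¬b ¬c))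

  -- H¹(O(n)) = 0: in a 1-cocycle only monomials with at most one negative
  -- exponent occur.  One with negative exponent i is put on the vertex i, and a
  -- monomial without negative exponents on the vertices 1 and 2.

  Negative₀ Regular₁ Regular₂ : Pred Exponent 0ℓ
  Negative₀ m = ¬ Nonneg 0F m × Nonneg 1F m × Nonneg 2F m
  Regular₁ m = Nonneg 0F m × Nonneg 2F m
  Regular₂ m = Nonneg 0F m × Nonneg 1F m

  negative₀? : Decidable Negative₀
  negative₀? m = ¬? (nonneg? 0F m) ×-dec nonneg? 1F m ×-dec nonneg? 2F m

  regular₁? : Decidable Regular₁
  regular₁? m = nonneg? 0F m ×-dec nonneg? 2F m

  regular₂? : Decidable Regular₂
  regular₂? m = nonneg? 0F m ×-dec nonneg? 1F m

  -- A primitive is unique up to global sections. Giving vertex 0 no monomial without negative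
  -- exponents fixes that freedom: on such monomials the values at vertices 1 and 2 are those of
  -- `g e₀₁` and `g e₀₂`.
  integral : (Edge → FormalSum) → Fin 3 → FormalSum
  integral g 0F = ⊝ restrict negative₀? (g e₀₁)
  integral g 1F = restrict regular₁? (g e₀₁)
  integral g 2F = restrict regular₂? (g e₀₂)

  Γ-integral : ∀ {n} g → (∀ e → Γ (edge e) n (g e)) → ∀ i → Γ (vertex i) n (integral g i)
  Γ-integral g hg 0F = Γ-⊝ (restrict negative₀? (g e₀₁)) (Γ-restrict negative₀? (g e₀₁)
    (λ m (_ , 1≤ , 2≤) (deg , _) → deg , λ where
      0F i∉ → contradiction here i∉
      1F _  → 1≤
      2F _  → 2≤) (hg e₀₁))
  Γ-integral g hg 1F = Γ-restrict regular₁? (g e₀₁)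
    (λ m (0≤ , 2≤) (deg , _) → deg , λ where
      0F _  → 0≤
      1F i∉ → contradiction (there here) i∉
      2F _  → 2≤) (hg e₀₁)
  Γ-integral g hg 2F = Γ-restrict regular₂? (g e₀₂)
    (λ m (0≤ , 1≤) (deg , _) → deg , λ where
      0F _  → 0≤
      1F _  → 1≤
      2F i∉ → contradiction (there (there here)) i∉) (hg e₀₂)

  opposite : Edge → Fin 3
  opposite e₀₁ = 2F
  opposite e₀₂ = 1F
  opposite e₁₂ = 0F

  edge-vanish : ∀ {n} e p → Γ (edge e) n p → ∀ m → ¬ Nonneg (opposite e) m → coeff p m ≈ 0#
  edge-vanish {n} e p hp m neg = hp m λ (_ , pos) → neg (pos (opposite e) (opposite∉ e))
    where
    opposite∉ : ∀ e → opposite e ∉ edge e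
    opposite∉ e₀₁ (there (there ()))
    opposite∉ e₀₂ (there ())
    opposite∉ e₁₂ ()

  private
    -- One monomial at a time: the r's are its coefficients on the three edges, and below `A`, `B`,
    -- `C` say that its exponents of x₀, x₁, x₂ are nonnegative. Two negative exponents kill two of
    -- the r's by regularity, and then the cocycle relation kills the third.
    module Values {r₀₁ r₀₂ r₁₂ : Carrier} (closed : (r₁₂ - r₀₂) + r₀₁ ≈ 0#) where
      r₀₂≈ : r₀₂ ≈ r₁₂ + r₀₁
      r₀₂≈ = trans (solve 3 (λ x y z → y := (z :+ x) :- ((z :- y) :+ x)) refl r₀₁ r₀₂ r₁₂)
        (trans (+-congˡ (trans (-‿cong closed) -0#≈0#)) (+-identityʳ _))

      value₀ value₁ value₂ : ∀ {A B C : Set} → Dec A → Dec B → Dec C → Carrier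
      value₀ a? b? c? = - (if does (¬? a? ×-dec b? ×-dec c?) then r₀₁ else 0#)
      value₁ a? b? c? = if does (a? ×-dec c?) then r₀₁ else 0#
      value₂ a? b? c? = if does (a? ×-dec b?) then r₀₂ else 0#

      module _ {A B C : Set} (h₁₂ : ¬ A → r₁₂ ≈ 0#) (h₀₂ : ¬ B → r₀₂ ≈ 0#) (h₀₁ : ¬ C → r₀₁ ≈ 0#) where
        private
          0-‿-0≈0 : 0# - - 0# ≈ 0#
          0-‿-0≈0 = solve 0 (con 0ℤ :- :- con 0ℤ := con 0ℤ) refl
          0-0≈0 : 0# - 0# ≈ 0#
          0-0≈0 = solve 0 (con 0ℤ :- con 0ℤ := con 0ℤ) refl
          r-‿-0 : ∀ r → r - - 0# ≈ r
          r-‿-0 = solve 1 (λ r → r :- :- con 0ℤ := r) refl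
          0-‿-r : ∀ r → 0# - - r ≈ r
          0-‿-r = solve 1 (λ r → con 0ℤ :- :- r := r) refl
          z+x-x : (r₁₂ + r₀₁) - r₀₁ ≈ r₁₂
          z+x-x = solve 2 (λ x z → (z :+ x) :- x := z) refl r₀₁ r₁₂
          ≈12 : r₀₁ ≈ 0# → r₀₂ ≈ r₁₂
          ≈12 h = trans r₀₂≈ (trans (+-congˡ h) (+-identityʳ _))
          ≈01 : r₁₂ ≈ 0# → r₀₂ ≈ r₀₁
          ≈01 h = trans r₀₂≈ (trans (+-congʳ h) (+-identityˡ _))

        edge₀₁ : (a? : Dec A) (b? : Dec B) (c? : Dec C) → value₁ a? b? c? - value₀ a? b? c? ≈ r₀₁
        edge₀₁ (yes _) b?      (yes _) = r-‿-0 r₀₁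
        edge₀₁ (no ¬a) (yes _) (yes _) = 0-‿-r r₀₁
        edge₀₁ (no ¬a) (no ¬b) (yes _) = trans 0-‿-0≈0 (trans (sym (h₀₂ ¬b)) (≈01 (h₁₂ ¬a)))
        edge₀₁ (yes _) b?      (no ¬c) = trans 0-‿-0≈0 (sym (h₀₁ ¬c))
        edge₀₁ (no _)  (yes _) (no ¬c) = trans 0-‿-0≈0 (sym (h₀₁ ¬c))
        edge₀₁ (no _)  (no _)  (no ¬c) = trans 0-‿-0≈0 (sym (h₀₁ ¬c))

        edge₀₂ : (a? : Dec A) (b? : Dec B) (c? : Dec C) → value₂ a? b? c? - value₀ a? b? c? ≈ r₀₂
        edge₀₂ (yes _) (yes _) c?      = r-‿-0 r₀₂
        edge₀₂ (no ¬a) (yes _) (yes _) = trans (0-‿-r r₀₁) (sym (≈01 (h₁₂ ¬a)))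
        edge₀₂ (no ¬a) (yes _) (no ¬c) = trans 0-‿-0≈0 (trans (sym (h₀₁ ¬c)) (sym (≈01 (h₁₂ ¬a))))
        edge₀₂ (yes _) (no ¬b) c?      = trans 0-‿-0≈0 (sym (h₀₂ ¬b))
        edge₀₂ (no _)  (no ¬b) c?      = trans 0-‿-0≈0 (sym (h₀₂ ¬b))

        edge₁₂ : (a? : Dec A) (b? : Dec B) (c? : Dec C) → value₂ a? b? c? - value₁ a? b? c? ≈ r₁₂
        edge₁₂ (no ¬a) b?      c?      = trans 0-0≈0 (sym (h₁₂ ¬a))
        edge₁₂ (yes _) (yes _) (yes _) = trans (+-congʳ r₀₂≈) z+x-x
        edge₁₂ (yes _) (yes _) (no ¬c) = trans (solve 1 (λ r → r :- con 0ℤ := r) refl r₀₂) (≈12 (h₀₁ ¬c))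
        edge₁₂ (yes _) (no ¬b) (yes _) = trans (+-congʳ (trans (sym (h₀₂ ¬b)) r₀₂≈)) z+x-x
        edge₁₂ (yes _) (no ¬b) (no ¬c) = trans 0-0≈0 (trans (sym (h₀₂ ¬b)) (≈12 (h₀₁ ¬c)))

  δ⁰-integral : ∀ {n} g → (∀ e → Γ (edge e) n (g e)) → δ¹ g ≋ [] → ∀ e → δ⁰ (integral g) e ≋ g e
  δ⁰-integral {n} g hg δg≋0 e .at m = trans (coeff-δ⁰ (integral g) e m) (on e)
    where
    open Values {coeff (g e₀₁) m} {coeff (g e₀₂) m} {coeff (g e₁₂) m}
      (trans (sym (coeff-δ¹ g m)) (at δg≋0 m))
    v₀ : coeff (integral g 0F) m ≈ _
    v₀ = trans (coeff-⊝ (restrict negative₀? (g e₀₁)) m) (-‿cong (coeff-restrict negative₀? (g e₀₁) m))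
    v₁ : coeff (integral g 1F) m ≈ _
    v₁ = coeff-restrict regular₁? (g e₀₁) m
    v₂ : coeff (integral g 2F) m ≈ _
    v₂ = coeff-restrict regular₂? (g e₀₂) m
    vanish : ∀ e → ¬ Nonneg (opposite e) m → coeff (g e) m ≈ 0#
    vanish e = edge-vanish e (g e) (hg e) m
    h₀ = vanish e₁₂
    h₁ = vanish e₀₂
    h₂ = vanish e₀₁
    0? = nonneg? 0F m
    1? = nonneg? 1F m
    2? = nonneg? 2F m
    on : ∀ e → coeff (integral g (tgt e)) m - coeff (integral g (src e)) m ≈ coeff (g e) m
    on e₀₁ = trans (+-cong v₁ (-‿cong v₀)) (edge₀₁ h₀ h₁ h₂ 0? 1? 2?)
    on e₀₂ = trans (+-cong v₂ (-‿cong v₀)) (edge₀₂ h₀ h₁ h₂ 0? 1? 2?)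
    on e₁₂ = trans (+-cong v₂ (-‿cong v₁)) (edge₁₂ h₀ h₁ h₂ 0? 1? 2?)

-- Lifting classes of H²(O(-4)) to cocycles, and the kernel of κ.

module Cohomology (R : CommutativeRing 0ℓ 0ℓ) (u : DoubleTernaryQuadraticForm R) where
  open CommutativeRing R
  open QuarticAlgebra R u hiding (ring; h)
  open Bhargava R u using (Λ)
  open Splitting R u
  open Laurent using (FormalSum; coeff; ⊝_; _≋_; at; coeff-++; coeff-⊝; scalar; supported-list)
  private
    module L = CommutativeRing Laurent.commutativeRing
    module LS = ℤ-Solver Laurent.commutativeRing
    module L′ = RingProperties L.ring
    module RS = ℤ-Solver R
    module Q = Ring (QuarticAlgebra.ring R u)

  Γ-⊛conic : ∀ {I n} p c → Γ I n p → Γ I (n ℤ.+ + 2) (p Laurent.⊛ conic c)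
  Γ-⊛conic {I} {n} p c hp =
    Γ-⊛ {n = n} {+ 2} {p} {conic c} hp (Γ-⊆ {p = conic c} ⊥⊆ (Γ-conic c))

  Γ-d₂ : ∀ {I} p c → Γ I -4ℤ p → Γ I -2ℤ (d₂ p c)
  Γ-d₂ p 0F hp = Γ-⊝ (p Laurent.⊛ conic 1F) (Γ-⊛conic p 1F hp)
  Γ-d₂ p 1F hp = Γ-⊛conic p 0F hp

  Γ-d₁ : ∀ {I} g → (∀ c → Γ I -2ℤ (g c)) → Γ I 0ℤ (d₁ g)
  Γ-d₁ g hg = Γ-++ (g 0F Laurent.⊛ conic 0F) (g 1F Laurent.⊛ conic 1F)
    (Γ-⊛conic (g 0F) 0F (hg 0F)) (Γ-⊛conic (g 1F) 1F (hg 1F))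

  Γ-scalar : ∀ {I} r → Γ I 0ℤ (scalar r)
  Γ-scalar r = supported-list {p = scalar r} ((≡.refl , λ where
    0F _ → ℤ.≤-refl
    1F _ → ℤ.≤-refl
    2F _ → ℤ.≤-refl) ∷ [])

  -- Closedness in C²(K⁻¹) demands δ f₁ = -d₂ f₂, which is solvable because H²(O(-2)) = 0.
  d₂-primitive : FormalSum → Edge → Fin 2 → FormalSum
  d₂-primitive p e c = split (⊝ d₂ p c) e

  -- The summand `n` is the freedom H⁰(O) left in solving δ f₀ = d₁ f₁. Regularity of `p` is kept
  -- out of the arguments so that the cochain can be evaluated with symbolic coefficients.
  liftCochain : FormalSum → Carrier → T⁰
  liftCochain p n .f₀ i = integral (λ e → d₁ (d₂-primitive p e)) i ++ scalar n
  liftCochain p n .f₁ = d₂-primitive p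
  liftCochain p n .f₂ = p

  module _ (p : FormalSum) (hp : Γ ⊤ -4ℤ p) where
    private
      f = d₂-primitive p

      g : Edge → FormalSum
      g e = d₁ (f e)

      Γf : ∀ e c → Γ (edge e) -2ℤ (f e c)
      Γf e c = Γ-split (⊝ d₂ p c) (Γ-⊝ (d₂ p c) (Γ-d₂ p c hp)) e

      Γg : ∀ e → Γ (edge e) 0ℤ (g e)
      Γg e = Γ-d₁ (f e) (Γf e)

      δf : ∀ c → δ¹ (λ e → f e c) ≋ ⊝ d₂ p c
      δf c = δ¹-split (⊝ d₂ p c) λ m neg →
        Γ-⊝ (d₂ p c) (Γ-d₂ p c hp) m λ (deg , _) → allNegative-≢-2 m neg deg

      -- `d₁` commutes with δ, so the left side is -d₁ d₂ p = 0; this permits the second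
      -- antidifferentiation.
      δg : δ¹ g ≋ []
      δg = L.trans
        (LS.solve 8 (λ x x′ y y′ z z′ a b →
          ((x :* a :+ x′ :* b) :- (y :* a :+ y′ :* b)) :+ (z :* a :+ z′ :* b) :=
          ((x :- y) :+ z) :* a :+ ((x′ :- y′) :+ z′) :* b) L.refl
          (f e₁₂ 0F) (f e₁₂ 1F) (f e₀₂ 0F) (f e₀₂ 1F) (f e₀₁ 0F) (f e₀₁ 1F) (conic 0F) (conic 1F))
        (L.trans (L.+-cong (L.*-congʳ {conic 0F} (δf 0F)) (L.*-congʳ {conic 1F} (δf 1F)))
          (LS.solve 3 (λ p a b → (:- :- (p :* b)) :* a :+ (:- (p :* a)) :* b := con 0ℤ) L.refl
            p (conic 0F) (conic 1F)))
        where open LS using (_:=_; _:+_; _:*_; _:-_; :-_; con)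

    lift : Carrier → Cocycle
    lift n .cochain = liftCochain p n
    lift n .isCochain .Γf₀ i =
      Γ-++ (integral g i) (scalar n) (Γ-integral g Γg i) (Γ-scalar n)
    lift n .isCochain .Γf₁ = Γf
    lift n .isCochain .Γf₂ = hp
    lift n .closed .closed₀ e = L.trans
      (LS.solve 4 (λ a b k g → ((a :+ k) :- (b :+ k)) :- g := (a :- b) :- g) L.refl
        (integral g (tgt e)) (integral g (src e)) (scalar n) (g e))
      (L.trans (L.+-congʳ (δ⁰-integral g Γg δg e)) (L.-‿inverseʳ (g e)))
      where open LS using (_:=_; _:+_; _:-_)
    lift n .closed .closed₁ c = L.trans (L.+-congʳ (δf c)) (L.-‿inverseˡ (d₂ p c))

  κ : Fin 3 → T⁰ → Carrier
  κ i z = coeff (f₂ z) (socle i)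

  boundary : ∀ h → IsCochain⁻¹ h → Cocycle
  boundary h hh .cochain = D⁻¹ h
  boundary h hh .isCochain = cochain-D⁻¹ hh
  boundary h hh .closed = closed-D⁻¹ h

  boundary∼0 : ∀ h hh → boundary h hh ∼ 0Q
  boundary∼0 h hh = record
    { h = h ; isCochain⁻¹ = hh ; coboundary = ≈⁰-sym (⊞-identityˡ (D⁻¹ h)) }

  minus-boundary : ∀ z h hh → z ∼ z +Q (-Q boundary h hh)
  minus-boundary z h hh = Q.sym (Q.trans (Q.+-congˡ {z}
    (Q.trans (-Q-cong {boundary h hh} {0Q} (boundary∼0 h hh)) (RingProperties.-0#≈0# (QuarticAlgebra.ring R u))))
    (Q.+-identityʳ z))

  -- The κᵢ record the class of `f₂` in H²(O(-4)); once they vanish, `f₂` is the Čech coboundary of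
  -- its splitting.
  kill-f₂ : ∀ z → (∀ i → κ i (cochain z) ≈ 0#) → Σ[ w ∈ Cocycle ] z ∼ w × f₂ (cochain w) ≋ []
  kill-f₂ z κ≈0 = _ , minus-boundary z h hh ,
    L.trans (L.+-congˡ {f₂ (cochain z)} (L.-‿cong (δ¹-split (f₂ (cochain z)) vanish))) (L.-‿inverseʳ (f₂ (cochain z)))
    where
    h : T⁻¹
    h .s i c = []
    h .t = split (f₂ (cochain z))
    hh : IsCochain⁻¹ h
    hh .Γs i c = Γ-0 {vertex i} { -2ℤ }
    hh .Γt = Γ-split (f₂ (cochain z)) (Γf₂ (isCochain z))
    vanish : ∀ m → AllNegative m → coeff (f₂ (cochain z)) m ≈ 0#
    vanish m neg with degree m ℤ.≟ -4ℤ
    ... | no deg≢ = Γf₂ (isCochain z) m (deg≢ ∘ proj₁)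
    ... | yes deg with allNegative-socle m neg deg
    ...   | i , ≡.refl = κ≈0 i

  -- With `f₂` zero, `closed₁` says that the components of `f₁` are Čech 1-cocycles of O(-2), hence
  -- coboundaries. Taking `t` zero leaves `f₂` untouched.
  kill-f₁ : ∀ z → f₂ (cochain z) ≋ [] →
            Σ[ w ∈ Cocycle ] z ∼ w × (∀ e c → f₁ (cochain w) e c ≋ []) × f₂ (cochain w) ≋ []
  kill-f₁ z f₂≋0 = _ , minus-boundary z h hh , f₁≋0 , L.trans (L.+-identityʳ (f₂ (cochain z))) f₂≋0
    where
    g : Fin 2 → Edge → FormalSum
    g c e = f₁ (cochain z) e c
    h : T⁻¹
    h .s i c = integral (g c) i
    h .t e = []
    hh : IsCochain⁻¹ h
    hh .Γs i c = Γ-integral (g c) (λ e → Γf₁ (isCochain z) e c) i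
    hh .Γt e = Γ-0 {edge e} { -4ℤ }
    d₂≋0 : ∀ c → d₂ (f₂ (cochain z)) c ≋ []
    d₂≋0 0F = L.trans (L.-‿cong (L.trans (L.*-congʳ {conic 1F} f₂≋0) (L.zeroˡ (conic 1F)))) L′.-0#≈0#
    d₂≋0 1F = L.trans (L.*-congʳ {conic 0F} f₂≋0) (L.zeroˡ (conic 0F))
    δg : ∀ c → δ¹ (g c) ≋ []
    δg c = L.trans (L.sym (L.trans (L.+-congˡ {δ¹ (g c)} (d₂≋0 c)) (L.+-identityʳ (δ¹ (g c)))))
      (closed₁ (closed z) c)
    primitive-δ : ∀ e c → δ⁰ (integral (g c)) e ≋ g c e
    primitive-δ e c = δ⁰-integral (g c) (λ e → Γf₁ (isCochain z) e c) (δg c) e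
    f₁≋0 : ∀ e c → f₁ (cochain z) e c L.- (δ⁰ (λ i → s h i c) e L.- d₂ [] c) ≋ []
    f₁≋0 e c = L.trans
      (L.+-congˡ {f₁ (cochain z) e c} (L.-‿cong
        (L.trans (L.+-cong {y = f₁ (cochain z) e c} (primitive-δ e c) (L.-‿cong (d₂-0 c)))
          (L.trans (L.+-congˡ {f₁ (cochain z) e c} L′.-0#≈0#) (L.+-identityʳ (f₁ (cochain z) e c))))))
      (L.-‿inverseʳ (f₁ (cochain z) e c))

  -- Two charts suffice: regularity on D₊(x₀) leaves only the exponent of x₀ free to be negative,
  -- and regularity on D₊(x₁) excludes that. In degree 0 only the monomial 1 remains.
  globalSection : ∀ p q → Γ (vertex 0F) 0ℤ p → Γ (vertex 1F) 0ℤ q → q ≋ p →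
                  p ≋ scalar (coeff p (replicate 3 0ℤ))
  globalSection p q hp hq q≋p .at m with Vec.≡-dec ℤ._≟_ (replicate 3 0ℤ) m
  ... | yes ≡.refl = sym (+-identityʳ _)
  ... | no 0≢m = trans (vanish (isRegular? (vertex 0F) 0ℤ m) (nonneg? 0F m)) (sym (+-identityʳ _))
    where
    vanish : Dec (IsRegular (vertex 0F) 0ℤ m) → Dec (Nonneg 0F m) → coeff p m ≈ 0#
    vanish (no ¬reg) _ = hp m ¬reg
    vanish (yes (deg , pos)) (yes 0≤) = contradiction
      (nonneg-zero m 0≤ (pos 1F λ { (there ()) }) (pos 2F λ { (there (there ())) }) deg) 0≢m
    vanish (yes _) (no ¬0≤) = trans (sym (at q≋p m)) (hq m λ (_ , pos) → ¬0≤ (pos 0F λ ()))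

  kill-f₀ : ∀ z → (∀ e c → f₁ (cochain z) e c ≋ []) → f₂ (cochain z) ≋ [] →
            Σ[ r ∈ Carrier ] z ∼ constant r
  kill-f₀ z f₁≋0 f₂≋0 = _ , ≈⁰⇒∼ {z} (record
    { eq₀ = λ where
        0F → global
        1F → L.trans (δf≋0 e₀₁) global
        2F → L.trans (δf≋0 e₀₂) global
    ; eq₁ = f₁≋0
    ; eq₂ = f₂≋0
    })
    where
    f : Fin 3 → FormalSum
    f = f₀ (cochain z)
    d₁≋0 : ∀ e → d₁ (f₁ (cochain z) e) ≋ []
    d₁≋0 e = L.trans (L.+-cong
      (L.trans (L.*-congʳ {conic 0F} (f₁≋0 e 0F)) (L.zeroˡ (conic 0F)))
      (L.trans (L.*-congʳ {conic 1F} (f₁≋0 e 1F)) (L.zeroˡ (conic 1F)))) (L.+-identityˡ [])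
    δf≋0 : ∀ e → f (tgt e) ≋ f (src e)
    δf≋0 e = L.trans
      (LS.solve 3 (λ a b g → a := ((a :- b) :- g) :+ (b :+ g)) L.refl
        (f (tgt e)) (f (src e)) (d₁ (f₁ (cochain z) e)))
      (L.trans (L.+-cong (closed₀ (closed z) e) (L.+-congˡ {f (src e)} (d₁≋0 e)))
        (L.trans (L.+-identityˡ (f (src e) ++ [])) (L.+-identityʳ (f (src e)))))
      where open LS using (_:=_; _:+_; _:-_)
    global : f 0F ≋ scalar (coeff (f 0F) (replicate 3 0ℤ))
    global = globalSection (f 0F) (f 1F) (Γf₀ (isCochain z) 0F) (Γf₀ (isCochain z) 1F) (δf≋0 e₀₁)

  -- Exactness of R → Q → H²(O(-4)) at Q. The order matters: the `t`-part of a coboundary moves `f₁`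
  -- and `f₂`, while the `s`-part moves only `f₀` and `f₁`.
  ker-κ : ∀ z → (∀ i → κ i (cochain z) ≈ 0#) → Σ[ r ∈ Carrier ] z ∼ constant r
  ker-κ z κ≈0 =
    let z₁ , z∼z₁ , f₂≋0 = kill-f₂ z κ≈0
        z₂ , z₁∼z₂ , f₁≋0 , f₂≋0′ = kill-f₁ z₁ f₂≋0
        r , z₂∼r = kill-f₀ z₂ f₁≋0 f₂≋0′
    in r , ∼-trans {z} {z₁} (z∼z₁) (∼-trans {z₁} {z₂} z₁∼z₂ z₂∼r)

  κ-cong : ∀ i {z w} → z ≈⁰ w → κ i z ≈ κ i w
  κ-cong i z≈w = at (eq₂ z≈w) (socle i)

  κ-⊞ : ∀ i z w → κ i (z ⊞ w) ≈ κ i z + κ i w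
  κ-⊞ i z w = coeff-++ (f₂ z) (f₂ w) (socle i)

  -- A socle monomial has all exponents negative, so it occurs on no edge.
  κ-D⁻¹ : ∀ i h → IsCochain⁻¹ h → κ i (D⁻¹ h) ≈ 0#
  κ-D⁻¹ i h hh = trans (coeff-δ¹ (t h) (socle i)) (trans
    (+-cong (+-cong (vanish i e₁₂) (-‿cong (vanish i e₀₂))) (vanish i e₀₁))
    (RS.solve 0 ((con 0ℤ :- con 0ℤ) :+ con 0ℤ := con 0ℤ) refl))
    where
    open RS using (_:=_; _:+_; _:-_; con)
    vanish : ∀ i e → coeff (t h e) (socle i) ≈ 0#
    vanish i e = edge-vanish e (t h e) (Γt hh e) (socle i) (socle-negative i (opposite e))

  -- Linear functionals on Q, and a retraction ε of R → Q.

  record IsLinear (φ : Cocycle → Carrier) : Set where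
    field
      ∼-cong     : ∀ {z w} → z ∼ w → φ z ≈ φ w
      +-homo     : ∀ z w → φ (z +Q w) ≈ φ z + φ w
      scale-homo : ∀ r z → φ (constant r *Q z) ≈ r * φ z

  constant-⊠ : ∀ r z → const⁰ (scalar r) ⊠ z ≈⁰ record
    { f₀ = λ i → scalar r L.* f₀ z i
    ; f₁ = λ e c → scalar r L.* f₁ z e c
    ; f₂ = scalar r L.* f₂ z
    }
  constant-⊠ r z = record
    { eq₀ = λ i → L.refl
    ; eq₁ = λ e c → L.+-identityʳ (scalar r L.* f₁ z e c)
    ; eq₂ = L.trans (L.+-identityʳ ((scalar r L.* f₂ z) ++ [])) (L.+-identityʳ (scalar r L.* f₂ z))
    }

  -- The Čech product is not commutative on cochains, so moving scalars across a factor needs its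
  -- own argument.
  constant-central : ∀ r z → z *Q constant r ∼ constant r *Q z
  constant-central r z = ≈⁰⇒∼ {z *Q constant r} (≈⁰-trans (record
    { eq₀ = λ i → L.*-comm (f₀ z′ i) (scalar r)
    ; eq₁ = λ e c → LS.solve 3 (λ a b s → a :* con 0ℤ :+ b :* s := s :* b) L.refl
        (f₀ z′ (src e)) (f₁ z′ e c) (scalar r)
    ; eq₂ = LS.solve 5 (λ a b c m s →
        (a :* con 0ℤ :- (b :* con 0ℤ :- c :* con 0ℤ)) :+ m :* s := s :* m) L.refl
        (f₀ z′ 0F) (f₁ z′ e₀₁ 0F) (f₁ z′ e₀₁ 1F) (f₂ z′) (scalar r)
    }) (≈⁰-sym (constant-⊠ r z′)))
    where
    open LS using (_:=_; _:+_; _:*_; _:-_; con)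
    z′ = cochain z

  linear : ∀ (φ : T⁰ → Carrier) → (∀ {z w} → z ≈⁰ w → φ z ≈ φ w) →
           (∀ z w → φ (z ⊞ w) ≈ φ z + φ w) → (∀ h → IsCochain⁻¹ h → φ (D⁻¹ h) ≈ 0#) →
           (∀ r z → φ (const⁰ (scalar r) ⊠ z) ≈ r * φ z) → IsLinear (φ ∘ cochain)
  linear φ φ-cong φ-⊞ φ-D⁻¹ φ-scale = record
    { ∼-cong = λ {z} {w} e → trans (φ-cong (coboundary e))
        (trans (φ-⊞ (cochain w) _) (trans (+-congˡ (φ-D⁻¹ _ (isCochain⁻¹ e))) (+-identityʳ _)))
    ; +-homo = λ z w → φ-⊞ (cochain z) (cochain w)
    ; scale-homo = λ r z → φ-scale r (cochain z)
    }

  κ-linear : ∀ i → IsLinear (κ i ∘ cochain)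
  κ-linear i = linear (κ i) (κ-cong i) (κ-⊞ i) (κ-D⁻¹ i) λ r z →
    trans (κ-cong i (constant-⊠ r z)) (coeff-scalar⊛ r (f₂ z) (socle i))

  -- Exchanging the factors makes the sum run over the six known terms of the conic instead of those
  -- of `p`.
  coeff-⊛conic : ∀ p c m → coeff (p Laurent.⊛ conic c) m ≈ Laurent.eval (λ k → coeff p (m − k)) (conic c)
  coeff-⊛conic p c m = trans (at (L.*-comm p (conic c)) m) (coeff-⊛ _−_ −-unique +-− (conic c) p m)

  x₀⁻² x₀⁻³x₁⁻¹ x₀⁻²x₁⁻² x₀⁻⁴ : Exponent
  x₀⁻² = -[1+ 1 ] ∷ 0ℤ ∷ 0ℤ ∷ []
  x₀⁻³x₁⁻¹ = -[1+ 2 ] ∷ -1ℤ ∷ 0ℤ ∷ []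
  x₀⁻²x₁⁻² = -[1+ 1 ] ∷ -[1+ 1 ] ∷ 0ℤ ∷ []
  x₀⁻⁴ = -[1+ 3 ] ∷ 0ℤ ∷ 0ℤ ∷ []

  -- Among the inverses of the six quadratic monomials only x₀⁻² is regular on D₊(x₀).
  coeff-vertex⊛conic : ∀ p c → Γ (vertex 0F) -2ℤ p →
                       coeff (p Laurent.⊛ conic c) (replicate 3 0ℤ) ≈ u c 0F * coeff p x₀⁻²
  coeff-vertex⊛conic p c hp = trans (coeff-⊛conic p c (replicate 3 0ℤ)) (trans
    (+-congˡ (trans (+-cong (vanish 1F (from-no (regular? 1F)))
             (trans (+-cong (vanish 2F (from-no (regular? 2F)))
             (trans (+-cong (vanish 3F (from-no (regular? 3F)))
             (trans (+-cong (vanish 4F (from-no (regular? 4F)))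
             (trans (+-congʳ (vanish 5F (from-no (regular? 5F))))
             (+-identityˡ _))) (+-identityˡ _))) (+-identityˡ _))) (+-identityˡ _))) (+-identityˡ _)))
    (+-identityʳ _))
    where
    shift : Fin 6 → Exponent
    shift k = replicate 3 0ℤ − zipWith ℤ._+_ (x^ (proj₁ (factors k))) (x^ (proj₂ (factors k)))
    regular? = λ k → isRegular? (vertex 0F) -2ℤ (shift k)
    vanish : ∀ k → ¬ IsRegular (vertex 0F) -2ℤ (shift k) → u c k * coeff p (shift k) ≈ 0#
    vanish k ¬reg = trans (*-congˡ (hp (shift k) ¬reg)) (zeroʳ _)

  -- Dividing x₀⁻² by a quadratic monomial stays regular on D₊(x₀x₁) exactly when that monomial does
  -- not involve x₂.
  coeff-edge⊛conic : ∀ p c → Γ (edge e₀₁) -4ℤ p → coeff (p Laurent.⊛ conic c) x₀⁻² ≈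
    u c 0F * coeff p x₀⁻⁴ + (u c 1F * coeff p x₀⁻³x₁⁻¹ + u c 3F * coeff p x₀⁻²x₁⁻²)
  coeff-edge⊛conic p c hp = trans (coeff-⊛conic p c x₀⁻²) (+-congˡ (+-congˡ
    (trans (+-cong (vanish 2F (from-no (regular? 2F)))
           (trans (+-congˡ (trans (+-cong (vanish 4F (from-no (regular? 4F)))
           (trans (+-congʳ (vanish 5F (from-no (regular? 5F))))
           (+-identityˡ _))) (+-identityˡ _))) (+-identityʳ _))) (+-identityˡ _))))
    where
    shift : Fin 6 → Exponent
    shift k = x₀⁻² − zipWith ℤ._+_ (x^ (proj₁ (factors k))) (x^ (proj₂ (factors k)))
    regular? = λ k → isRegular? (edge e₀₁) -4ℤ (shift k)
    vanish : ∀ k → ¬ IsRegular (edge e₀₁) -4ℤ (shift k) → u c k * coeff p (shift k) ≈ 0#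
    vanish k ¬reg = trans (*-congˡ (hp (shift k) ¬reg)) (zeroʳ _)

  combination : Carrier → (Fin 2 → Carrier) → Carrier → Carrier → Carrier
  combination x y v w = ((x + (u 0F 0F * y 0F + u 1F 0F * y 1F)) - Λ 0F 0F 0F 1F * v) - Λ 0F 0F 1F 1F * w

  combination-cong : ∀ {x x′ y y′ v v′ w w′} → x ≈ x′ → (∀ c → y c ≈ y′ c) → v ≈ v′ → w ≈ w′ →
                     combination x y v w ≈ combination x′ y′ v′ w′
  combination-cong p q r s = +-cong (+-cong (+-cong p (+-cong (*-congˡ (q 0F)) (*-congˡ (q 1F))))
    (-‿cong (*-congˡ r))) (-‿cong (*-congˡ s))

  -- In D⁻¹ h, the constant term of f₀ comes from the x₀⁻²-coefficients of s₀.  The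
  -- terms in f₁ cancel it and leave Λ₀₀₀₁ and Λ₀₀₁₁ times the coefficients of t₀₁ at
  -- x₀⁻³x₁⁻¹ and x₀⁻²x₁⁻², at which t₀₁ is the only contribution to δ¹ t.
  ε : T⁰ → Carrier
  ε z = combination (coeff (f₀ z 0F) (replicate 3 0ℤ)) (λ c → coeff (f₁ z e₀₁ c) x₀⁻²)
                    (coeff (f₂ z) x₀⁻³x₁⁻¹) (coeff (f₂ z) x₀⁻²x₁⁻²)

  ε-cong : ∀ {z w} → z ≈⁰ w → ε z ≈ ε w
  ε-cong {z} {w} e = combination-cong
    {y = λ c → coeff (f₁ z e₀₁ c) x₀⁻²} {λ c → coeff (f₁ w e₀₁ c) x₀⁻²}
    (at (eq₀ e 0F) _) (λ c → at (eq₁ e e₀₁ c) x₀⁻²) (at (eq₂ e) _) (at (eq₂ e) _)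

  ε-⊞ : ∀ z w → ε (z ⊞ w) ≈ ε z + ε w
  ε-⊞ z w = trans
    (combination-cong {y = λ c → coeff (f₁ z e₀₁ c ++ f₁ w e₀₁ c) x₀⁻²}
        {λ c → coeff (f₁ z e₀₁ c) x₀⁻² + coeff (f₁ w e₀₁ c) x₀⁻²}
      (coeff-++ (f₀ z 0F) (f₀ w 0F) _) (λ c → coeff-++ (f₁ z e₀₁ c) (f₁ w e₀₁ c) x₀⁻²)
      (coeff-++ (f₂ z) (f₂ w) _) (coeff-++ (f₂ z) (f₂ w) _))
    (RS.solve 14 (λ a b p q x x′ y₀ y₀′ y₁ y₁′ v v′ w w′ →
      ((((x :+ x′) :+ (a :* (y₀ :+ y₀′) :+ b :* (y₁ :+ y₁′))) :- p :* (v :+ v′)) :- q :* (w :+ w′)) :=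
      (((x :+ (a :* y₀ :+ b :* y₁)) :- p :* v) :- q :* w) :+
      (((x′ :+ (a :* y₀′ :+ b :* y₁′)) :- p :* v′) :- q :* w′)) refl
      (u 0F 0F) (u 1F 0F) (Λ 0F 0F 0F 1F) (Λ 0F 0F 1F 1F) _ _ _ _ _ _ _ _ _ _)
    where open RS using (_:=_; _:+_; _:*_; _:-_)

  ε-scale : ∀ r z → ε (const⁰ (scalar r) ⊠ z) ≈ r * ε z
  ε-scale r z = trans (ε-cong (constant-⊠ r z)) (trans
    (combination-cong {y = λ c → coeff (scalar r L.* f₁ z e₀₁ c) x₀⁻²} {λ c → r * coeff (f₁ z e₀₁ c) x₀⁻²}
      (coeff-scalar⊛ r (f₀ z 0F) _) (λ c → coeff-scalar⊛ r (f₁ z e₀₁ c) x₀⁻²)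
      (coeff-scalar⊛ r (f₂ z) _) (coeff-scalar⊛ r (f₂ z) _))
    (RS.solve 10 (λ r a b p q x y₀ y₁ v w →
      (((r :* x) :+ (a :* (r :* y₀) :+ b :* (r :* y₁))) :- p :* (r :* v)) :- q :* (r :* w) :=
      r :* (((x :+ (a :* y₀ :+ b :* y₁)) :- p :* v) :- q :* w)) refl
      r (u 0F 0F) (u 1F 0F) (Λ 0F 0F 0F 1F) (Λ 0F 0F 1F 1F) _ _ _ _ _))
    where open RS using (_:=_; _:+_; _:*_; _:-_)

  ε-D⁻¹ : ∀ h → IsCochain⁻¹ h → ε (D⁻¹ h) ≈ 0#
  ε-D⁻¹ h hh = trans
    (combination-cong {y = λ c → coeff (f₁ (D⁻¹ h) e₀₁ c) x₀⁻²} {y}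
      (trans (coeff-++ (s h 0F 0F Laurent.⊛ conic 0F) _ _)
        (+-cong (coeff-vertex⊛conic (s h 0F 0F) 0F (Γs hh 0F 0F))
               (coeff-vertex⊛conic (s h 0F 1F) 1F (Γs hh 0F 1F))))
      (λ c → trans (coeff-++ (δ⁰ (λ i → s h i c) e₀₁) (⊝ d₂ (t h e₀₁) c) x₀⁻²)
        (+-cong (trans (coeff-δ⁰ (λ i → s h i c) e₀₁ x₀⁻²)
                  (+-congʳ (Γs hh 1F c x₀⁻² (from-no (isRegular? (vertex 1F) -2ℤ x₀⁻²)))))
                (trans (coeff-⊝ (d₂ (t h e₀₁) c) x₀⁻²) (-‿cong (coeff-d₂ c)))))
      (face x₀⁻³x₁⁻¹ (from-no (isRegular? (edge e₁₂) -4ℤ x₀⁻³x₁⁻¹))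
        (from-no (isRegular? (edge e₀₂) -4ℤ x₀⁻³x₁⁻¹)))
      (face x₀⁻²x₁⁻² (from-no (isRegular? (edge e₁₂) -4ℤ x₀⁻²x₁⁻²))
        (from-no (isRegular? (edge e₀₂) -4ℤ x₀⁻²x₁⁻²))))
    -- `T₀` cancels between the two `f₁`-terms, having the coefficient a₀b₀ - b₀a₀. It could not be
    -- removed through `f₂`, since x₀⁻⁴ is also regular on `e₀₂`.
    (RS.solve 11 (λ a₀ a₁ a₃ b₀ b₁ b₃ S₀ S₁ T₀ T₁ T₃ →
      (((a₀ :* S₀ :+ b₀ :* S₁) :+
        (a₀ :* ((con 0ℤ :- S₀) :- :- (b₀ :* T₀ :+ (b₁ :* T₁ :+ b₃ :* T₃))) :+
         b₀ :* ((con 0ℤ :- S₁) :- (a₀ :* T₀ :+ (a₁ :* T₁ :+ a₃ :* T₃)))))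
        :- (a₀ :* b₁ :- b₀ :* a₁) :* ((con 0ℤ :- con 0ℤ) :+ T₁))
        :- (a₀ :* b₃ :- b₀ :* a₃) :* ((con 0ℤ :- con 0ℤ) :+ T₃) := con 0ℤ) refl
      (u 0F 0F) (u 0F 1F) (u 0F 3F) (u 1F 0F) (u 1F 1F) (u 1F 3F)
      (coeff (s h 0F 0F) x₀⁻²) (coeff (s h 0F 1F) x₀⁻²)
      (coeff (t h e₀₁) x₀⁻⁴) (coeff (t h e₀₁) x₀⁻³x₁⁻¹) (coeff (t h e₀₁) x₀⁻²x₁⁻²))
    where
    open RS using (_:=_; _:+_; _:*_; _:-_; :-_; con)
    T : Fin 2 → Carrier
    T c = u c 0F * coeff (t h e₀₁) x₀⁻⁴ +
          (u c 1F * coeff (t h e₀₁) x₀⁻³x₁⁻¹ + u c 3F * coeff (t h e₀₁) x₀⁻²x₁⁻²)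
    dT : Fin 2 → Carrier
    dT 0F = - T 1F
    dT 1F = T 0F
    y : Fin 2 → Carrier
    y c = (0# - coeff (s h 0F c) x₀⁻²) - dT c
    coeff-d₂ : ∀ c → coeff (d₂ (t h e₀₁) c) x₀⁻² ≈ dT c
    coeff-d₂ 0F = trans (coeff-⊝ (t h e₀₁ Laurent.⊛ conic 1F) x₀⁻²)
      (-‿cong (coeff-edge⊛conic (t h e₀₁) 1F (Γt hh e₀₁)))
    coeff-d₂ 1F = coeff-edge⊛conic (t h e₀₁) 0F (Γt hh e₀₁)
    face : ∀ m → ¬ IsRegular (edge e₁₂) -4ℤ m → ¬ IsRegular (edge e₀₂) -4ℤ m →
           coeff (δ¹ (t h)) m ≈ (0# - 0#) + coeff (t h e₀₁) m
    face m ¬e₁₂ ¬e₀₂ = trans (coeff-δ¹ (t h) m)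
      (+-congʳ (+-cong (Γt hh e₁₂ m ¬e₁₂) (-‿cong (Γt hh e₀₂ m ¬e₀₂))))

  ε-linear : IsLinear (ε ∘ cochain)
  ε-linear = linear ε ε-cong ε-⊞ ε-D⁻¹ ε-scale

  ε-constant : ∀ r → ε (const⁰ (scalar r)) ≈ r
  ε-constant r = RS.solve 5 (λ r a b p q →
    (((r :+ con 0ℤ) :+ (a :* con 0ℤ :+ b :* con 0ℤ)) :- p :* con 0ℤ) :- q :* con 0ℤ := r) refl
    r (u 0F 0F) (u 1F 0F) (Λ 0F 0F 0F 1F) (Λ 0F 0F 1F 1F)
    where open RS using (_:=_; _:+_; _:*_; _:-_; con)

-- Recognising Bhargava's algebra from linear coordinates.

module Recognition
  (R : CommutativeRing 0ℓ 0ℓ) (u : DoubleTernaryQuadraticForm R)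
  (T : Bhargava.MultiplicationTable R u)
  (A : Ring 0ℓ 0ℓ)
  where
  open CommutativeRing R hiding (zero)
  open Bhargava R u using (algebra)
  open Bhargava.MultiplicationTable T
  private
    module A = Ring A
    module ΣA = SemiringSum A.semiring
    module B = RawAlgebra (algebra T)
  open SemiringSum semiring using (sum; sum-cong-≋; *-distribˡ-sum; ∑-distrib-+)
  open ℤ-Solver R

  -- `φ-αα` prescribes only the α-coordinates of products, because associativity in `A` forces the
  -- constant ones. Freeness of `A` comes from `φ-kernel` and the values of `φ` on 1 and the αᵢ.
  record Coordinates : Set where
    field
      ι          : Carrier → A.Carrier
      ι-1        : ι 1# A.≈ A.1#
      ι-central  : ∀ r x → x A.* ι r A.≈ ι r A.* x
      φ          : A.Carrier → Fin 4 → Carrier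
      φ-cong     : ∀ {x y} → x A.≈ y → ∀ k → φ x k ≈ φ y k
      φ-+        : ∀ x y k → φ (x A.+ y) k ≈ φ x k + φ y k
      φ-scale    : ∀ r x k → φ (ι r A.* x) k ≈ r * φ x k
      φ-ι        : ∀ r k → φ (ι r) k ≈ B.ι r k
      φ-kernel   : ∀ x → (∀ k → φ x k ≈ 0#) → x A.≈ A.0#
      α          : Fin 3 → A.Carrier
      φ-α₀       : ∀ i → φ (α i) 0F ≈ 0#
      φ-α        : ∀ i k → φ (α i) (suc k) ≈ (if does (i ≟ k) then 1# else 0#)
      φ-αα       : ∀ i j k → φ (α i A.* α j) (suc k) ≈ c i j k

  module Isomorphism (coordinates : Coordinates) where
    open Coordinates coordinates

    basis : Fin 4 → A.Carrier
    basis 0F      = A.1#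
    basis (suc i) = α i

    combination : (Fin 4 → Carrier) → A.Carrier
    combination y = ΣA.sum (λ i → ι (y i) A.* basis i)

    φ-0 : ∀ k → φ A.0# k ≈ 0#
    φ-0 k = trans (φ-cong (A.sym (A.zeroʳ (ι 0#))) k) (trans (φ-scale 0# A.0# k) (zeroˡ _))

    φ-neg : ∀ x k → φ (A.- x) k ≈ - φ x k
    φ-neg x k = GroupProperties.inverseˡ-unique +-group _ _
      (trans (sym (φ-+ (A.- x) x k)) (trans (φ-cong (A.-‿inverseˡ x) k) (φ-0 k)))

    φ-sum : ∀ {n} (f : Fin n → A.Carrier) k → φ (ΣA.sum f) k ≈ sum (λ i → φ (f i) k)
    φ-sum {zero}  f k = φ-0 k
    φ-sum {suc n} f k = trans (φ-+ (f zero) _ k) (+-congˡ (φ-sum (λ i → f (suc i)) k))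

    φ-1 : ∀ k → φ A.1# k ≈ B.1# k
    φ-1 k = trans (φ-cong (A.sym ι-1) k) (φ-ι 1# k)

    select : ∀ (x : Fin 3 → Carrier) k → sum (λ i → x i * (if does (i ≟ k) then 1# else 0#)) ≈ x k
    select x 0F = trans (+-congʳ (*-identityʳ _))
      (solve 3 (λ a b c → a :+ (b :* con 0ℤ :+ (c :* con 0ℤ :+ con 0ℤ)) := a) refl (x 0F) (x 1F) (x 2F))
    select x 1F = trans (+-congˡ (+-congʳ (*-identityʳ _)))
      (solve 3 (λ a b c → a :* con 0ℤ :+ (b :+ (c :* con 0ℤ :+ con 0ℤ)) := b) refl (x 0F) (x 1F) (x 2F))
    select x 2F = trans (+-congˡ (+-congˡ (+-congʳ (*-identityʳ _))))
      (solve 3 (λ a b c → a :* con 0ℤ :+ (b :* con 0ℤ :+ (c :+ con 0ℤ)) := c) refl (x 0F) (x 1F) (x 2F))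

    φ-combination : ∀ y k → φ (combination y) k ≈ y k
    φ-combination y k = trans (φ-sum (λ i → ι (y i) A.* basis i) k)
      (trans (sum-cong-≋ (λ i → φ-scale (y i) (basis i) k)) (coordinate k))
      where
      coordinate : ∀ k → sum (λ i → y i * φ (basis i) k) ≈ y k
      coordinate 0F = trans (+-cong (trans (*-congˡ (φ-1 0F)) (*-identityʳ _))
          (sum-cong-≋ λ i → *-congˡ {y (suc i)} (φ-α₀ i)))
        (solve 4 (λ a b c d → a :+ (b :* con 0ℤ :+ (c :* con 0ℤ :+ (d :* con 0ℤ :+ con 0ℤ))) := a)
          refl (y 0F) (y 1F) (y 2F) (y 3F))
      coordinate (suc k) = trans (+-cong (trans (*-congˡ (φ-1 (suc k))) (zeroʳ _))
          (trans (sum-cong-≋ λ i → *-congˡ {y (suc i)} (φ-α i k)) (select (λ i → y (suc i)) k)))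
        (+-identityˡ _)

    φ-injective : ∀ {x y} → (∀ k → φ x k ≈ φ y k) → x A.≈ y
    φ-injective {x} {y} φx≈φy = GroupProperties.x∙y⁻¹≈ε⇒x≈y A.+-group x y (φ-kernel _ λ k →
      trans (φ-+ x (A.- y) k) (trans (+-cong (φx≈φy k) (φ-neg y k)) (-‿inverseʳ _)))

    expand : ∀ x → x A.≈ combination (φ x)
    expand x = φ-injective λ k → sym (φ-combination (φ x) k)

    φ-*ˡ : ∀ x y k → φ (x A.* y) k ≈ sum (λ i → φ x i * φ (basis i A.* y) k)
    φ-*ˡ x y k = trans
      (φ-cong (A.trans (A.*-congʳ (expand x)) (ΣA.*-distribʳ-sum y terms)) k)
      (trans (φ-sum (λ i → terms i A.* y) k) (sum-cong-≋ λ i →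
        trans (φ-cong (A.*-assoc _ _ _) k) (φ-scale (φ x i) (basis i A.* y) k)))
      where
      terms : Fin 4 → A.Carrier
      terms i = ι (φ x i) A.* basis i

    φ-*ʳ : ∀ x y k → φ (x A.* y) k ≈ sum (λ j → φ y j * φ (x A.* basis j) k)
    φ-*ʳ x y k = trans
      (φ-cong (A.trans (A.*-congˡ (expand y)) (ΣA.*-distribˡ-sum x terms)) k)
      (trans (φ-sum (λ j → x A.* terms j) k) (sum-cong-≋ λ j →
        trans (φ-cong (A.trans (A.sym (A.*-assoc _ _ _))
          (A.trans (A.*-congʳ (ι-central (φ y j) x)) (A.*-assoc _ _ _))) k)
        (φ-scale (φ y j) (x A.* basis j) k)))
      where
      terms : Fin 4 → A.Carrier
      terms j = ι (φ y j) A.* basis j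

    scale-sum : ∀ r (y d : Fin 3 → Carrier) → r * sum (λ j → y j * d j) ≈ sum (λ j → (r * y j) * d j)
    scale-sum r y d = trans (*-distribˡ-sum r (λ j → y j * d j)) (sum-cong-≋ λ j → sym (*-assoc r (y j) (d j)))

    -- Compare the α_k-coordinates of (αᵢαⱼ)α_k and αᵢ(αⱼα_k).
    φ-αα₀ : ∀ i j k → k ≢ i → φ (α i A.* α j) 0F ≈ c⁰ i j
    φ-αα₀ i j k k≢i = trans solved (sym (trans (c⁰-def i j k k≢i) difference))
      where
      F G : Fin 3 → Carrier
      F r = c j k r * c r i k
      G r = c i j r * c r k k
      d = φ (α i A.* α j) 0F
      δ-refl : φ (α k) (suc k) ≈ 1#
      δ-refl = trans (φ-α k k) (same k)
        where
        same : ∀ k → (if does (k ≟ k) then 1# else 0#) ≈ 1#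
        same 0F = refl
        same 1F = refl
        same 2F = refl
      δ-≢ : ∀ i k → k ≢ i → (if does (i ≟ k) then 1# else 0#) ≈ 0#
      δ-≢ 0F 0F k≢i = contradiction ≡.refl k≢i
      δ-≢ 0F 1F _ = refl
      δ-≢ 0F 2F _ = refl
      δ-≢ 1F 0F _ = refl
      δ-≢ 1F 1F k≢i = contradiction ≡.refl k≢i
      δ-≢ 1F 2F _ = refl
      δ-≢ 2F 0F _ = refl
      δ-≢ 2F 1F _ = refl
      δ-≢ 2F 2F k≢i = contradiction ≡.refl k≢i
      -- The constant part d of αᵢαⱼ contributes d α_k, so d enters with coefficient 1.
      left : φ ((α i A.* α j) A.* α k) (suc k) ≈ d + sum G
      left = trans (φ-*ˡ (α i A.* α j) (α k) (suc k)) (+-cong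
        (trans (*-congˡ (trans (φ-cong (A.*-identityˡ (α k)) (suc k)) δ-refl)) (*-identityʳ d))
        (sum-cong-≋ λ r → *-cong (φ-αα i j r) (φ-αα r k k)))
      -- The constant part of αⱼα_k contributes only a multiple of αᵢ, which has no α_k-coordinate
      -- since k ≠ i.
      right : φ (α i A.* (α j A.* α k)) (suc k) ≈ sum F
      right = trans (φ-*ʳ (α i) (α j A.* α k) (suc k)) (trans (+-cong
        (trans (*-congˡ (trans (φ-cong (A.*-identityʳ (α i)) (suc k)) (trans (φ-α i k) (δ-≢ i k k≢i)))) (zeroʳ _))
        (sum-cong-≋ λ r → *-cong (φ-αα j k r) (trans (φ-αα i r k) (c-comm i r k)))) (+-identityˡ _))
      solved : d ≈ sum F - sum G
      solved = trans (solve 2 (λ d y → d := (d :+ y) :- y) refl d (sum G))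
        (+-congʳ (trans (sym left) (trans (φ-cong (A.*-assoc (α i) (α j) (α k)) (suc k)) right)))
      difference : sum (λ r → F r - G r) ≈ sum F - sum G
      difference = solve 6 (λ x₀ x₁ x₂ y₀ y₁ y₂ →
        (x₀ :- y₀) :+ ((x₁ :- y₁) :+ ((x₂ :- y₂) :+ con 0ℤ)) :=
        (x₀ :+ (x₁ :+ (x₂ :+ con 0ℤ))) :- (y₀ :+ (y₁ :+ (y₂ :+ con 0ℤ)))) refl
        (F 0F) (F 1F) (F 2F) (G 0F) (G 1F) (G 2F)

    φ-αα-0 : ∀ i j → φ (α i A.* α j) 0F ≈ c⁰ i j
    φ-αα-0 0F j = φ-αα₀ 0F j 1F λ ()
    φ-αα-0 1F j = φ-αα₀ 1F j 0F λ ()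
    φ-αα-0 2F j = φ-αα₀ 2F j 0F λ ()

    φ-* : ∀ x y k → φ (x A.* y) k ≈ (φ x B.* φ y) k
    φ-* x y 0F = trans (φ-*ˡ x y 0F) (+-cong
      (*-congˡ (φ-cong (A.*-identityˡ y) 0F))
      (sum-cong-≋ λ i → trans (*-congˡ {φ x (suc i)} (trans (φ-*ʳ (α i) y 0F) (trans (+-cong
          (trans (*-congˡ (trans (φ-cong (A.*-identityʳ (α i)) 0F) (φ-α₀ i))) (zeroʳ _))
          (sum-cong-≋ λ j → *-congˡ {φ y (suc j)} (φ-αα-0 i j))) (+-identityˡ _))))
        (scale-sum (φ x (suc i)) (λ j → φ y (suc j)) (c⁰ i))))
    φ-* x y (suc k) = trans (φ-*ˡ x y (suc k)) (trans (+-cong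
      (*-congˡ (φ-cong (A.*-identityˡ y) (suc k)))
      (sum-cong-≋ λ i → trans (*-congˡ {φ x (suc i)} (trans (φ-*ʳ (α i) y (suc k)) (+-cong
          (*-congˡ (trans (φ-cong (A.*-identityʳ (α i)) (suc k)) (φ-α i k)))
          (sum-cong-≋ λ j → *-congˡ {φ y (suc j)} (φ-αα i j k)))))
        (trans (distribˡ _ _ _) (+-cong (sym (*-assoc _ _ _))
          (scale-sum (φ x (suc i)) (λ j → φ y (suc j)) (λ j → c i j k))))))
      (trans (+-congˡ (∑-distrib-+ {3} (λ i → (φ x (suc i) * φ y 0F) * (if does (i ≟ k) then 1# else 0#))
                             (λ i → sum (λ j → (φ x (suc i) * φ y (suc j)) * c i j k))))
        (trans (+-congˡ (+-congʳ (select (λ i → φ x (suc i) * φ y 0F) k))) (sym (+-assoc _ _ _)))))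

    isomorphism : record { rawRing = A.rawRing ; ι = ι } ≅ algebra T
    isomorphism = φ , record
      { isRingMonomorphism = record
        { isRingHomomorphism = record
          { isSemiringHomomorphism = record
            { isNearSemiringHomomorphism = record
              { +-isMonoidHomomorphism = record
                { isMagmaHomomorphism = record
                  { isRelHomomorphism = record { cong = φ-cong }
                  ; homo = φ-+
                  }
                ; ε-homo = φ-0
                }
              ; *-homo = φ-*
              }
            ; 1#-homo = φ-1
            }
          ; -‿homo = φ-neg
          }
        ; injective = φ-injective
        }
      ; surjective = λ y → combination y , λ z≈ k → trans (φ-cong z≈ k) (φ-combination y k)
      } , φ-ι

-- Reifying computations over R for the ring solver.

module Expressions (R : CommutativeRing 0ℓ 0ℓ) {n : ℕ} (ρ : Vec (CommutativeRing.Carrier R) n) where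
  open CommutativeRing R
  private module S = ℤ-Solver R
  open S using (Polynomial; con; _:+_; _:*_; :-_)
  open RingSolver ℤ.+-*-rawRing S.almostCommutativeRing S.morphism S.fromℤ-≟ using (⟦_⟧)

  -- Rerunning a computation with expressions in place of elements of R reifies its
  -- result for the solver.
  expressionRawRing : RawRing 0ℓ 0ℓ
  expressionRawRing = record
    { Carrier = Polynomial n
    ; _≈_ = λ p q → ⟦ p ⟧ ρ ≈ ⟦ q ⟧ ρ
    ; _+_ = _:+_
    ; _*_ = _:*_
    ; -_ = :-_
    ; 0# = con 0ℤ
    ; 1# = con 1ℤ
    }

  open RingMorphisms expressionRawRing rawRing using (IsRingMonomorphism)

  -- Expressions count as equal when their values at `ρ` are, so evaluation is injective by
  -- definition and the ring laws pull back from `R`.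
  ⟦⟧-isRingMonomorphism : IsRingMonomorphism (λ p → ⟦ p ⟧ ρ)
  ⟦⟧-isRingMonomorphism = record
    { isRingHomomorphism = record
      { isSemiringHomomorphism = record
        { isNearSemiringHomomorphism = record
          { +-isMonoidHomomorphism = record
            { isMagmaHomomorphism = record
              { isRelHomomorphism = record { cong = λ p≈q → p≈q }
              ; homo = λ p q → refl
              }
            ; ε-homo = refl
            }
          ; *-homo = λ p q → refl
          }
        ; 1#-homo = +-identityʳ 1#
        }
      ; -‿homo = λ p → refl
      }
    ; injective = λ p≈q → p≈q
    }

  expressionRing : CommutativeRing 0ℓ 0ℓ
  expressionRing = record
    { isCommutativeRing = RingMonomorphism.isCommutativeRing ⟦⟧-isRingMonomorphism isCommutativeRing }

-- The generators αᵢ and their multiples.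

module Generators (R : CommutativeRing 0ℓ 0ℓ) (u : DoubleTernaryQuadraticForm R) where
  open CommutativeRing R
  open QuarticAlgebra R u hiding (ring; h)
  open Laurent using (FormalSum; supported-list)
  open Bhargava R u using (Λ; table; module MultiplicationTable)
  open Cohomology R u public

  monomial : Fin 3 → Carrier → FormalSum
  monomial i r = (r , socle i) ∷ []

  Γ-monomial : ∀ i r → Γ ⊤ -4ℤ (monomial i r)
  Γ-monomial i r = supported-list {p = monomial i r} (regular i ∷ [])
    where
    regular : ∀ i → IsRegular ⊤ -4ℤ (socle i)
    regular 0F = from-yes (isRegular? ⊤ -4ℤ (socle 0F))
    regular 1F = from-yes (isRegular? ⊤ -4ℤ (socle 1F))
    regular 2F = from-yes (isRegular? ⊤ -4ℤ (socle 2F))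

  -- Adding n to αᵢ adds n to c_{ij}ʲ for j ≠ i; these values of n make c₀₁⁰, c₀₁¹
  -- and c₀₂⁰ vanish.
  normalization : Fin 3 → Carrier
  normalization 0F = - Λ 0F 0F 1F 2F + Λ 0F 2F 0F 1F
  normalization _ = 0#

  -- A multiple of αᵢ: the solver cannot handle 1# as a coefficient, because con 1ℤ
  -- evaluates to 1# + 0#.
  generator : Fin 3 → Carrier → T⁰
  generator i r = liftCochain (monomial i r) (normalization i * r)

  α : Fin 3 → Carrier → Cocycle
  α i r = lift (monomial i r) (Γ-monomial i r) (normalization i * r)

  structureConstant : Fin 3 → Fin 3 → Fin 3 → Carrier
  structureConstant = MultiplicationTable.c table

-- The structure constants of αᵢαⱼ.

module Products (R : CommutativeRing 0ℓ 0ℓ) (u : DoubleTernaryQuadraticForm R)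
                (r s : CommutativeRing.Carrier R) where
  open CommutativeRing R
  open ℤ-Solver R
  open QuarticAlgebra R u using (_⊠_)
  open Generators R u

  private
    ρ : Vec Carrier 14
    ρ = r ∷ s ∷ Vec.map (u 0F) (Vec.allFin 6) Vec.++ Vec.map (u 1F) (Vec.allFin 6)

    open Expressions R ρ using (expressionRing)

    rˢ sˢ : Polynomial 14
    rˢ = var 0F
    sˢ = var 1F

    uˢ : DoubleTernaryQuadraticForm expressionRing
    uˢ c k = var (suc (suc (combine {2} c k)))

    module G = Generators expressionRing uˢ
    module QA = QuarticAlgebra expressionRing uˢ

    κˢ : Fin 3 → Fin 3 → Fin 3 → Polynomial 14
    κˢ i j k = G.κ k (G.generator i rˢ QA.⊠ G.generator j sˢ)

    cˢ : Fin 3 → Fin 3 → Fin 3 → Polynomial 14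
    cˢ i j k = (rˢ :* sˢ) :* G.structureConstant i j k

  -- All exponents are closed terms, so the computation takes the same branches over expressions as
  -- over `R`, and evaluating its symbolic result gives back the original. Each case becomes a
  -- polynomial identity in r, s and the twelve coefficients of u.
  κ-product : ∀ i j k → κ k (generator i r ⊠ generator j s) ≈ (r * s) * structureConstant i j k
  κ-product 0F 0F 0F = prove ρ (κˢ 0F 0F 0F) (cˢ 0F 0F 0F) refl
  κ-product 0F 0F 1F = prove ρ (κˢ 0F 0F 1F) (cˢ 0F 0F 1F) refl
  κ-product 0F 0F 2F = prove ρ (κˢ 0F 0F 2F) (cˢ 0F 0F 2F) refl
  κ-product 0F 1F 0F = prove ρ (κˢ 0F 1F 0F) (cˢ 0F 1F 0F) refl
  κ-product 0F 1F 1F = prove ρ (κˢ 0F 1F 1F) (cˢ 0F 1F 1F) refl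
  κ-product 0F 1F 2F = prove ρ (κˢ 0F 1F 2F) (cˢ 0F 1F 2F) refl
  κ-product 0F 2F 0F = prove ρ (κˢ 0F 2F 0F) (cˢ 0F 2F 0F) refl
  κ-product 0F 2F 1F = prove ρ (κˢ 0F 2F 1F) (cˢ 0F 2F 1F) refl
  κ-product 0F 2F 2F = prove ρ (κˢ 0F 2F 2F) (cˢ 0F 2F 2F) refl
  κ-product 1F 0F 0F = prove ρ (κˢ 1F 0F 0F) (cˢ 1F 0F 0F) refl
  κ-product 1F 0F 1F = prove ρ (κˢ 1F 0F 1F) (cˢ 1F 0F 1F) refl
  κ-product 1F 0F 2F = prove ρ (κˢ 1F 0F 2F) (cˢ 1F 0F 2F) refl
  κ-product 1F 1F 0F = prove ρ (κˢ 1F 1F 0F) (cˢ 1F 1F 0F) refl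
  κ-product 1F 1F 1F = prove ρ (κˢ 1F 1F 1F) (cˢ 1F 1F 1F) refl
  κ-product 1F 1F 2F = prove ρ (κˢ 1F 1F 2F) (cˢ 1F 1F 2F) refl
  κ-product 1F 2F 0F = prove ρ (κˢ 1F 2F 0F) (cˢ 1F 2F 0F) refl
  κ-product 1F 2F 1F = prove ρ (κˢ 1F 2F 1F) (cˢ 1F 2F 1F) refl
  κ-product 1F 2F 2F = prove ρ (κˢ 1F 2F 2F) (cˢ 1F 2F 2F) refl
  κ-product 2F 0F 0F = prove ρ (κˢ 2F 0F 0F) (cˢ 2F 0F 0F) refl
  κ-product 2F 0F 1F = prove ρ (κˢ 2F 0F 1F) (cˢ 2F 0F 1F) refl
  κ-product 2F 0F 2F = prove ρ (κˢ 2F 0F 2F) (cˢ 2F 0F 2F) refl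
  κ-product 2F 1F 0F = prove ρ (κˢ 2F 1F 0F) (cˢ 2F 1F 0F) refl
  κ-product 2F 1F 1F = prove ρ (κˢ 2F 1F 1F) (cˢ 2F 1F 1F) refl
  κ-product 2F 1F 2F = prove ρ (κˢ 2F 1F 2F) (cˢ 2F 1F 2F) refl
  κ-product 2F 2F 0F = prove ρ (κˢ 2F 2F 0F) (cˢ 2F 2F 0F) refl
  κ-product 2F 2F 1F = prove ρ (κˢ 2F 2F 1F) (cˢ 2F 2F 1F) refl
  κ-product 2F 2F 2F = prove ρ (κˢ 2F 2F 2F) (cˢ 2F 2F 2F) refl

-- The coordinates on Q and the isomorphism.

module QuarticCoordinates (R : CommutativeRing 0ℓ 0ℓ) (u : DoubleTernaryQuadraticForm R) where
  open CommutativeRing R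
  open ℤ-Solver R
  open SemiringSum semiring using (sum; sum-cong-≋)
  open QuarticAlgebra R u hiding (ring; h)
  open Laurent using (scalar; mk≋; _≋_)
  open Bhargava R u using (table)
  open Generators R u
  open Recognition R u table (QuarticAlgebra.ring R u)
  open IsLinear

  -- With `w` the values of ε on the αᵢ, this functional vanishes on every αᵢ and still agrees with
  -- ε on constants, where the κᵢ are zero.
  corrected : Carrier → (Fin 3 → Carrier) → (Fin 3 → Carrier) → Carrier
  corrected e x w = e - sum (λ i → x i * w i)

  corrected-cong : ∀ {e e′ x x′} w → e ≈ e′ → (∀ i → x i ≈ x′ i) → corrected e x w ≈ corrected e′ x′ w
  corrected-cong w e≈e′ x≈x′ = +-cong e≈e′ (-‿cong (sum-cong-≋ λ i → *-congʳ {w i} (x≈x′ i)))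

  corrected-+ : ∀ e e′ x x′ w →
                corrected (e + e′) (λ i → x i + x′ i) w ≈ corrected e x w + corrected e′ x′ w
  corrected-+ e e′ x x′ w = solve 11 (λ e e′ x x′ y y′ t t′ a b c →
    (e :+ e′) :- ((x :+ x′) :* a :+ ((y :+ y′) :* b :+ ((t :+ t′) :* c :+ con 0ℤ))) :=
    (e :- (x :* a :+ (y :* b :+ (t :* c :+ con 0ℤ)))) :+
    (e′ :- (x′ :* a :+ (y′ :* b :+ (t′ :* c :+ con 0ℤ))))) refl
    e e′ (x 0F) (x′ 0F) (x 1F) (x′ 1F) (x 2F) (x′ 2F) (w 0F) (w 1F) (w 2F)

  corrected-* : ∀ r e x w → corrected (r * e) (λ i → r * x i) w ≈ r * corrected e x w
  corrected-* r e x w = solve 8 (λ r e x y t a b c →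
    (r :* e) :- ((r :* x) :* a :+ ((r :* y) :* b :+ ((r :* t) :* c :+ con 0ℤ))) :=
    r :* (e :- (x :* a :+ (y :* b :+ (t :* c :+ con 0ℤ))))) refl
    r e (x 0F) (x 1F) (x 2F) (w 0F) (w 1F) (w 2F)

  corrected-0 : ∀ e w → corrected e (λ _ → 0#) w ≈ e
  corrected-0 e w = solve 4 (λ e a b c →
    e :- (con 0ℤ :* a :+ (con 0ℤ :* b :+ (con 0ℤ :* c :+ con 0ℤ))) := e) refl
    e (w 0F) (w 1F) (w 2F)

  corrected-unit : ∀ w i → corrected (w i) (λ k → if does (i ≟ k) then 1# else 0#) w ≈ 0#
  corrected-unit w 0F = trans (+-congˡ (-‿cong (+-congʳ (*-identityˡ _))))
    (solve 3 (λ a b c → a :- (a :+ (con 0ℤ :* b :+ (con 0ℤ :* c :+ con 0ℤ))) := con 0ℤ)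
      refl (w 0F) (w 1F) (w 2F))
  corrected-unit w 1F = trans (+-congˡ (-‿cong (+-congˡ (+-congʳ (*-identityˡ _)))))
    (solve 3 (λ a b c → b :- (con 0ℤ :* a :+ (b :+ (con 0ℤ :* c :+ con 0ℤ))) := con 0ℤ)
      refl (w 0F) (w 1F) (w 2F))
  corrected-unit w 2F = trans (+-congˡ (-‿cong (+-congˡ (+-congˡ (+-congʳ (*-identityˡ _))))))
    (solve 3 (λ a b c → c :- (con 0ℤ :* a :+ (con 0ℤ :* b :+ (c :+ con 0ℤ))) := con 0ℤ)
      refl (w 0F) (w 1F) (w 2F))

  -- These values stay unevaluated: the correction removes them whatever they are.
  εα : Fin 3 → Carrier
  εα i = ε (generator i 1#)

  coordinate : Cocycle → Fin 4 → Carrier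
  coordinate z 0F      = corrected (ε (cochain z)) (λ i → κ i (cochain z)) εα
  coordinate z (suc i) = κ i (cochain z)

  coordinate-linear : ∀ k → IsLinear (λ z → coordinate z k)
  coordinate-linear 0F = record
    { ∼-cong = λ z∼w → corrected-cong εα (∼-cong ε-linear z∼w) (λ i → ∼-cong (κ-linear i) z∼w)
    ; +-homo = λ z w → trans
        (corrected-cong εα (+-homo ε-linear z w) (λ i → +-homo (κ-linear i) z w))
        (corrected-+ _ _ (λ i → κ i (cochain z)) (λ i → κ i (cochain w)) εα)
    ; scale-homo = λ r z → trans
        (corrected-cong εα (scale-homo ε-linear r z) (λ i → scale-homo (κ-linear i) r z))
        (corrected-* r _ (λ i → κ i (cochain z)) εα)
    }
  coordinate-linear (suc i) = κ-linear i

  κ-generator : ∀ i k → κ k (generator i 1#) ≈ (if does (i ≟ k) then 1# else 0#)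
  κ-generator 0F 0F = +-identityʳ _
  κ-generator 0F 1F = +-identityʳ _
  κ-generator 0F 2F = +-identityʳ _
  κ-generator 1F 0F = +-identityʳ _
  κ-generator 1F 1F = +-identityʳ _
  κ-generator 1F 2F = +-identityʳ _
  κ-generator 2F 0F = +-identityʳ _
  κ-generator 2F 1F = +-identityʳ _
  κ-generator 2F 2F = +-identityʳ _

  coordinate₀-generator : ∀ i → coordinate (α i 1#) 0F ≈ 0#
  coordinate₀-generator i = trans (corrected-cong εα refl (κ-generator i)) (corrected-unit εα i)

  coordinate₀-κ≈0 : ∀ z → (∀ i → κ i (cochain z) ≈ 0#) → coordinate z 0F ≈ ε (cochain z)
  coordinate₀-κ≈0 z κ≈0 = trans (corrected-cong εα refl κ≈0) (corrected-0 _ εα)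

  coordinate-constant : ∀ r k → coordinate (constant r) k ≈ RawAlgebra.ι (Bhargava.algebra R u table) r k
  coordinate-constant r 0F = trans (coordinate₀-κ≈0 (constant r) (λ i → refl)) (ε-constant r)
  coordinate-constant r (suc k) = refl

  constant-0 : ∀ {r} → r ≈ 0# → constant r ∼ 0Q
  constant-0 {r} r≈0 = ≈⁰⇒∼ {constant r} (record
    { eq₀ = λ i → scalar-0 ; eq₁ = λ e c → mk≋ λ m → refl ; eq₂ = mk≋ λ m → refl })
    where
    scalar-0 : scalar r ≋ []
    scalar-0 ._≋_.at m with does (Vec.≡-dec ℤ._≟_ (replicate 3 0ℤ) m)
    ... | true  = trans (+-identityʳ r) r≈0
    ... | false = +-identityʳ 0#

  -- Vanishing κᵢ make `z` cohomologous to a constant `r`. The correction is then zero, so the first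
  -- coordinate is ε, which returns `r`.
  coordinate-kernel : ∀ z → (∀ k → coordinate z k ≈ 0#) → z ∼ 0Q
  coordinate-kernel z φ≈0 = ∼-trans {z} {constant r} z∼r (constant-0 r≈0)
    where
    r = proj₁ (ker-κ z λ i → φ≈0 (suc i))
    z∼r = proj₂ (ker-κ z λ i → φ≈0 (suc i))
    r≈0 : r ≈ 0#
    r≈0 = trans (sym (ε-constant r)) (trans (sym (∼-cong ε-linear z∼r))
      (trans (sym (coordinate₀-κ≈0 z (λ i → φ≈0 (suc i)))) (φ≈0 0F)))

  coordinates : Coordinates
  coordinates = record
    { ι = constant
    ; ι-1 = ∼-refl {constant 1#}
    ; ι-central = constant-central
    ; φ = coordinate
    ; φ-cong = λ z∼w k → ∼-cong (coordinate-linear k) z∼w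
    ; φ-+ = λ z w k → +-homo (coordinate-linear k) z w
    ; φ-scale = λ r z k → scale-homo (coordinate-linear k) r z
    ; φ-ι = coordinate-constant
    ; φ-kernel = coordinate-kernel
    ; α = λ i → α i 1#
    ; φ-α₀ = coordinate₀-generator
    ; φ-α = κ-generator
    ; φ-αα = λ i j k → trans (Products.κ-product R u 1# 1# i j k)
        (trans (*-congʳ (*-identityˡ 1#)) (*-identityˡ _))
    }

  open Isomorphism coordinates public using (isomorphism)

theorem5p1 : QuarticAlgebra.Q ℤ[a,b] universal
    ≅ Bhargava.algebra ℤ[a,b] universal (Bhargava.table ℤ[a,b] universal)
theorem5p1 = QuarticCoordinates.isomorphism ℤ[a,b] universal
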